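{- Let $m\in\{2,3,4,5\}$, let $a,b,c\in\mathbb{Z}$ be such that $f(x)=x^6+ax^m+bx+c$ is irreducible over $\mathbb{Q}$, and let $K=\mathbb{Q}(\theta)$ where $\theta$ is a root of $f(x)$. (i) If $a$, $b$ and $c+1$ are all divisible by $8$, then $v_2(i(K))=2$. (ii) If $a$, $b$ and $c+1$ are all divisible by $9$, then $v_3(i(K))=1$. In either case, $K$ is non-monogenic.
   Context: $O_K$ denotes the ring of algebraic integers of $K$. For $\alpha\in O_K$, $\operatorname{ind}\alpha$ denotes the index of the subgroup $\mathbb{Z}[\alpha]$ in $O_K$ (as additive groups). The index of the field is $i(K)=\gcd\{\operatorname{ind}\alpha : \alpha\in O_K,\ K=\mathbb{Q}(\alpha)\}$. For a rational prime $p$ and an integer $r$, $v_p(r)$ is the exponent of the highest power of $p$ dividing $r$. $K$ is called monogenic if $O_K=\mathbb{Z}[\alpha]$ for some $\alpha\in O_K$, and non-monogenic otherwise. -}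

module Defs where

open import Data.Nat using (ℕ; zero; suc; _≡ᵇ_; _^_)
open import Data.Nat.Divisibility using (_∣_)
open import Data.Integer using (ℤ)
open import Data.Rational using (ℚ; 0ℚ; 1ℚ; _+_; _*_; -_; _-_; _/_)
open import Data.Bool using (if_then_else_)
open import Data.List using (List; []; _∷_; _∷ʳ_; length; map)
open import Data.Vec using (Vec; []; _∷_; zipWith; tabulate; toList; lookup)
import Data.Vec as Vec
open import Data.Fin using (Fin; toℕ)
open import Data.Product using (Σ; ∃; _×_)
open import Data.Sum using (_⊎_)
open import Relation.Binary.PropositionalEquality using (_≡_; _≢_)
open import Relation.Nullary using (¬_)

ι : ℤ → ℚ
ι z = z / 1

Valuation : ℕ → ℕ → ℕ → Set
Valuation p r k = (p ^ k ∣ r) × ¬ (p ^ suc k ∣ r)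

-- Polynomials over ℚ as coefficient lists, lowest degree first.

addP : List ℚ → List ℚ → List ℚ
addP [] q = q
addP (x ∷ p) [] = x ∷ p
addP (x ∷ p) (y ∷ q) = (x + y) ∷ addP p q

mulP : List ℚ → List ℚ → List ℚ
mulP [] q = []
mulP (x ∷ p) q = addP (map (x *_) q) (0ℚ ∷ mulP p q)

fCoeff : ℕ → ℤ → ℤ → ℤ → ℕ → ℚ
fCoeff m a b c i =
  (if i ≡ᵇ 6 then 1ℚ else 0ℚ) + ((if i ≡ᵇ m then ι a else 0ℚ)
  + ((if i ≡ᵇ 1 then ι b else 0ℚ) + (if i ≡ᵇ 0 then ι c else 0ℚ)))

fPoly : ℕ → ℤ → ℤ → ℤ → List ℚ
fPoly m a b c = toList (tabulate {n = 7} (λ i → fCoeff m a b c (toℕ i)))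

-- Irreducible over ℚ: f is not a product of two nonconstant rational
-- polynomials.  Factors are written with explicit nonzero leading
-- coefficients (g ∷ʳ lg has degree = length g exactly).
IrreducibleQ : List ℚ → Set
IrreducibleQ f = ∀ (g h : List ℚ) (lg lh : ℚ) → lg ≢ 0ℚ → lh ≢ 0ℚ →
  mulP (g ∷ʳ lg) (h ∷ʳ lh) ≡ f → (length g ≡ 0) ⊎ (length h ≡ 0)

-- The field K = ℚ(θ) ≅ ℚ[x]/(f), elements written in the ℚ-basis
-- 1, θ, …, θ^5 as coefficient vectors.

module Field (m : ℕ) (a b c : ℤ) where

  K : Set
  K = Vec ℚ 6

  0K : K
  0K = tabulate (λ _ → 0ℚ)

  1K : K
  1K = 1ℚ ∷ 0ℚ ∷ 0ℚ ∷ 0ℚ ∷ 0ℚ ∷ 0ℚ ∷ []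

  _+K_ : K → K → K
  _+K_ = zipWith _+_

  _•_ : ℚ → K → K
  q • v = Vec.map (q *_) v

  -K_ : K → K
  -K v = Vec.map -_ v

  _-K_ : K → K → K
  x -K y = x +K (-K y)

  θ⁶ : K
  θ⁶ = tabulate (λ i → - fCoeff m a b c (toℕ i))

  mulθ : K → K
  mulθ (c0 ∷ c1 ∷ c2 ∷ c3 ∷ c4 ∷ c5 ∷ []) =
    (0ℚ ∷ c0 ∷ c1 ∷ c2 ∷ c3 ∷ c4 ∷ []) +K (c5 • θ⁶)

  horner : List ℚ → K → K
  horner [] x = 0K
  horner (q ∷ qs) x = (q • x) +K mulθ (horner qs x)

  _*K_ : K → K → K
  x *K y = horner (toList y) x

  evalK : List ℚ → K → K
  evalK [] α = 0K
  evalK (q ∷ qs) α = (q • 1K) +K (α *K evalK qs α)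

  evalZ : List ℤ → K → K
  evalZ g α = evalK (map ι g) α

  InOK : K → Set
  InOK α = ∃ λ (g : List ℤ) → evalZ (g ∷ʳ 1ℤ) α ≡ 0K
    where open import Data.Integer using () renaming (1ℤ to 1ℤ)

  InZ[_] : K → K → Set
  InZ[ α ] β = ∃ λ (g : List ℤ) → evalZ g α ≡ β

  Generates : K → Set
  Generates α = ∀ β → ∃ λ (g : List ℚ) → ∃ λ (h : List ℚ) →
    (evalK h α ≢ 0K) × (β *K evalK h α ≡ evalK g α)

  Index : K → ℕ → Set
  Index α n = Σ (Vec K n) λ r →
    (∀ i → InOK (lookup r i)) ×
    (∀ β → InOK β → ∃ λ i → InZ[ α ] (β -K lookup r i)) ×
    (∀ β i j → InZ[ α ] (β -K lookup r i) → InZ[ α ] (β -K lookup r j) → i ≡ j)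

  IsFieldIndex : ℕ → Set
  IsFieldIndex d =
    (∀ α n → InOK α → Generates α → Index α n → d ∣ n) ×
    (∀ e → (∀ α n → InOK α → Generates α → Index α n → e ∣ n) → e ∣ d)

  Monogenic : Set
  Monogenic = ∃ λ α → InOK α × (∀ β → InOK β → InZ[ α ] β)

{-# OPTIONS --safe #-}
module Submission where

-- Only f ≡ x⁶ − 1 modulo 8 (p = 2) or 9 (p = 3) matters.  By Euler's formula the trace is
-- y ↦ λ₅ (f′(θ) y), where λ₅ is the coefficient of θ⁵; since traces of integral elements are
-- integers, f′(θ) O_K ⊆ ℤ[θ], and f′(θ) is p times a unit modulo p.  So O_K lies p-locally between
-- ℤ[θ] and p⁻¹ℤ[θ], where it equals an explicit order Λ.  With v = 2 or 1:
--
-- * Λ modulo its radical is 𝔽₂² × 𝔽₄² or 𝔽₃⁴, where z⁴ = z or z³ = z.  The image of ℤ[α] has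
--   dimension at most 4 of 6, or 3 of 4, so p^v divides every index.
-- * For an explicit α, ℤ[α] together with (α⁴ − α)/2 and α(α⁴ − α)/2, or with (α³ − α)²/3,
--   generates Λ modulo p, so p^(v+1) does not divide the index of α.
--
-- The claims to be proved are negative or decidable, so choices are made under double negation.

open import Defs renaming (ι to ι₀)
open import Level using (0ℓ)
open import Algebra.Bundles using (CommutativeRing)
open import Algebra.Structures using (IsCommutativeRing)
import Algebra.Properties.Ring as RingP
import Algebra.Properties.Semiring.Exp as SemiringExp
import Algebra.Properties.Semiring.Sum as SemiringSum
import Algebra.Solver.Ring
open import Algebra.Solver.Ring.AlmostCommutativeRing using (fromCommutativeRing; _-Raw-AlmostCommutative⟶_)
open import Data.Bool using (if_then_else_; true; false)
open import Data.Fin as Fin using (Fin; zero; suc; toℕ; fromℕ<; inject₁; combine; remQuot; finToFun; funToFin)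
open import Data.Fin.Induction using (>-weakInduction)
open import Data.Fin.Patterns
open import Data.Fin.Permutation using (Permutation; permutation; _⟨$⟩ʳ_)
import Data.Fin.Properties as FinP
open import Data.Fin.Properties using (suc-injective; toℕ-inject₁)
open import Data.Integer as Z using (ℤ; 0ℤ; 1ℤ)
import Data.Integer.Divisibility as ℤDU
import Data.Integer.Divisibility.Signed as ℤD
open ℤD using (divides) renaming (_∣_ to _∣ℤ_; _∣?_ to _∣ℤ?_)
import Data.Integer.DivMod as ℤDM
import Data.Integer.Properties as ℤP
open import Data.Integer.Solver renaming (module +-*-Solver to ℤR)
open import Data.List as List using (List; []; _∷_; _∷ʳ_; length)
import Data.Maybe as Maybe
open import Data.Nat as ℕ using (ℕ; zero; suc; NonZero; _≡ᵇ_)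
import Data.Nat.Divisibility as ℕD
import Data.Nat.DivMod as ℕDM
open import Data.Nat.GCD using (gcd-zeroʳ)
open import Data.Nat.Induction using (<-rec)
open import Data.Nat.Primality using (Prime; prime?; euclidsLemma)
import Data.Nat.Properties as ℕP
open import Data.Product using (Σ; ∃; _×_; _,_; proj₁; proj₂; uncurry)
open import Data.Rational as ℚ using (ℚ; 0ℚ; 1ℚ; toℚᵘ; mkℚ)
import Data.Rational.Properties as ℚP
open import Data.Rational.Solver renaming (module +-*-Solver to ℚR)
import Data.Rational.Unnormalised as ℚᵘ
import Data.Rational.Unnormalised.Properties as ℚᵘP
open import Data.Sum using (inj₁; inj₂)
open import Data.Vec using (Vec; []; _∷_; zipWith; map; replicate; lookup; toList; tabulate)
open import Data.Vec.Properties using (lookup-zipWith; lookup-map; lookup∘tabulate)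
open import Data.Vec.Relation.Unary.All as All using (All; []; _∷_)
open import Function using (_∘_)
open import Relation.Binary.PropositionalEquality hiding (J)
open import Relation.Nullary using (¬_; Dec; yes; no)
open import Relation.Nullary.Decidable using (map′; dec⇒maybe; ¬?; decidable-stable; from-yes; from-no)
open import Relation.Nullary.Negation using (contradiction)
open SemiringSum (CommutativeRing.semiring ℚP.+-*-commutativeRing) using ()
  renaming (sum to sumℚ; sum-cong-≗ to sumℚ-cong; ∑-comm to sumℚ-comm; ∑-distrib-+ to sumℚ-+; *-distribˡ-sum to *-sumℚ; *-distribʳ-sum to sumℚ-*)
open SemiringSum (CommutativeRing.semiring ℤP.+-*-commutativeRing) using ()
  renaming (sum to sumℤ; sum-cong-≗ to sumℤ-cong)
open SemiringSum ℕP.+-*-semiring using ()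
  renaming (sum to sumℕ; sum-cong-≗ to sumℕ-cong; ∑-comm to sumℕ-comm; sum-permute to sumℕ-permute)

-- The value v measures a shortage of residues. A power basis modulo p of 𝔽₂² × 𝔽₄² would need two
-- irreducible quadratics over 𝔽₂, and only x² + x + 1 exists; for 𝔽₃⁴ it would need four elements
-- of 𝔽₃. In either case the powers of an element z with z^q = z are spanned by 1, z, ..., z^(q-1),
-- and v = r - q, where r is the dimension of the quotient. The α of the upper bound separates as
-- many factors as possible, and the divided elements adjoined to ℤ[α] recover what is missing
-- modulo p.
--
-- The obstacle is that O_K is unknown away from p. Comparisons of O_K with Λ therefore hold only up
-- to an integer multiplier u ≡ 1 modulo p, which is invisible modulo p and adds only factors prime
-- to p to an index. These multipliers come from Nakayama's lemma in determinant form.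
--
-- At 2 the modulus is p³ rather than p²: κ = (θ³ - 1)/2 satisfies κ² + κ = (θ⁶ - 1)/4, and the
-- vanishing of this modulo 2 splits Λ/2Λ into two copies of 𝔽₂[θ]/(θ³ - 1).

-- The integers inside the rationals.

toℚᵘ-ι₀ : ∀ z → toℚᵘ (ι₀ z) ℚᵘ.≃ (z ℚᵘ./ 1)
toℚᵘ-ι₀ z = ℚP.toℚᵘ-fromℚᵘ (ℚᵘ.mkℚᵘ z 0)

ι₀-+ : ∀ x y → ι₀ (x Z.+ y) ≡ ι₀ x ℚ.+ ι₀ y
ι₀-+ x y = ℚP.toℚᵘ-injective (begin
  toℚᵘ (ι₀ (x Z.+ y))             ≈⟨ toℚᵘ-ι₀ (x Z.+ y) ⟩
  (x Z.+ y) ℚᵘ./ 1               ≈⟨ ℚᵘ.*≡* (cong (Z._* 1ℤ) (cong₂ Z._+_ (sym (ℤP.*-identityʳ x)) (sym (ℤP.*-identityʳ y)))) ⟩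
  (x ℚᵘ./ 1) ℚᵘ.+ (y ℚᵘ./ 1)     ≈⟨ ℚᵘP.+-cong (ℚᵘP.≃-sym (toℚᵘ-ι₀ x)) (ℚᵘP.≃-sym (toℚᵘ-ι₀ y)) ⟩
  toℚᵘ (ι₀ x) ℚᵘ.+ toℚᵘ (ι₀ y)     ≈⟨ ℚᵘP.≃-sym (ℚP.toℚᵘ-homo-+ (ι₀ x) (ι₀ y)) ⟩
  toℚᵘ (ι₀ x ℚ.+ ι₀ y)             ∎)
  where open import Relation.Binary.Reasoning.Setoid ℚᵘP.≃-setoid

ι₀-* : ∀ x y → ι₀ (x Z.* y) ≡ ι₀ x ℚ.* ι₀ y
ι₀-* x y = ℚP.toℚᵘ-injective (begin
  toℚᵘ (ι₀ (x Z.* y))             ≈⟨ toℚᵘ-ι₀ (x Z.* y) ⟩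
  (x Z.* y) ℚᵘ./ 1               ≈⟨ ℚᵘ.*≡* refl ⟩
  (x ℚᵘ./ 1) ℚᵘ.* (y ℚᵘ./ 1)     ≈⟨ ℚᵘP.*-cong (ℚᵘP.≃-sym (toℚᵘ-ι₀ x)) (ℚᵘP.≃-sym (toℚᵘ-ι₀ y)) ⟩
  toℚᵘ (ι₀ x) ℚᵘ.* toℚᵘ (ι₀ y)     ≈⟨ ℚᵘP.≃-sym (ℚP.toℚᵘ-homo-* (ι₀ x) (ι₀ y)) ⟩
  toℚᵘ (ι₀ x ℚ.* ι₀ y)             ∎)
  where open import Relation.Binary.Reasoning.Setoid ℚᵘP.≃-setoid

ι₀-injective : ∀ {x y} → ι₀ x ≡ ι₀ y → x ≡ y
ι₀-injective {x} {y} e with ℚP./-injective-≃ (ℚᵘ.mkℚᵘ x 0) (ℚᵘ.mkℚᵘ y 0) e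
... | ℚᵘ.*≡* p = trans (sym (ℤP.*-identityʳ x)) (trans p (ℤP.*-identityʳ y))

ι₀-neg : ∀ x → ι₀ (Z.- x) ≡ ℚ.- ι₀ x
ι₀-neg x = begin
  ι₀ (Z.- x)                           ≡⟨ solve 2 (λ a b → a := (:- b) :+ (a :+ b)) refl (ι₀ (Z.- x)) (ι₀ x) ⟩
  ℚ.- ι₀ x ℚ.+ (ι₀ (Z.- x) ℚ.+ ι₀ x)     ≡⟨ cong (ℚ.- ι₀ x ℚ.+_) (sym (ι₀-+ (Z.- x) x)) ⟩
  ℚ.- ι₀ x ℚ.+ ι₀ (Z.- x Z.+ x)         ≡⟨ cong (λ z → ℚ.- ι₀ x ℚ.+ ι₀ z) (ℤP.+-inverseˡ x) ⟩
  ℚ.- ι₀ x ℚ.+ 0ℚ                      ≡⟨ ℚP.+-identityʳ _ ⟩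
  ℚ.- ι₀ x ∎
  where open ≡-Reasoning
        open ℚR

ι₀ₙ : ℕ → ℚ
ι₀ₙ n = ι₀ (Z.+ n)

recip : ℕ → ℚ
recip zero    = 0ℚ
recip (suc n) = Z.+ 1 ℚ./ suc n

recip-inverse₀ : ∀ n .{{_ : NonZero n}} → recip n ℚ.* ι₀ₙ n ≡ 1ℚ
recip-inverse₀ (suc n) = ℚP.toℚᵘ-injective (begin
  toℚᵘ (recip (suc n) ℚ.* ι₀ₙ (suc n))          ≈⟨ ℚP.toℚᵘ-homo-* (recip (suc n)) (ι₀ₙ (suc n)) ⟩
  toℚᵘ (recip (suc n)) ℚᵘ.* toℚᵘ (ι₀ₙ (suc n))  ≈⟨ ℚᵘP.*-cong (ℚP.toℚᵘ-fromℚᵘ (ℚᵘ.mkℚᵘ (Z.+ 1) n)) (toℚᵘ-ι₀ (Z.+ suc n)) ⟩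
  ℚᵘ.mkℚᵘ (Z.+ 1) n ℚᵘ.* ℚᵘ.mkℚᵘ (Z.+ suc n) 0 ≈⟨ ℚᵘ.*≡* (cong (λ k → Z.+ suc k) (trans (ℕP.*-identityʳ (n ℕ.+ 0)) (trans (ℕP.+-identityʳ n) (sym (trans (ℕP.+-identityʳ (n ℕ.* 1)) (ℕP.*-identityʳ n)))))) ⟩
  ℚᵘ.mkℚᵘ (Z.+ 1) 0                            ≈⟨ ℚᵘ.*≡* refl ⟩
  toℚᵘ 1ℚ ∎)
  where open import Relation.Binary.Reasoning.Setoid ℚᵘP.≃-setoid

↥≡*↧₀ : ∀ q → q ℚ.* ι₀ₙ (ℚ.↧ₙ q) ≡ ι₀ (ℚ.↥ q)
↥≡*↧₀ q@(mkℚ n d-1 _) = ℚP.toℚᵘ-injective (begin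
  toℚᵘ (q ℚ.* ι₀ₙ (suc d-1))          ≈⟨ ℚP.toℚᵘ-homo-* q (ι₀ₙ (suc d-1)) ⟩
  toℚᵘ q ℚᵘ.* toℚᵘ (ι₀ₙ (suc d-1))    ≈⟨ ℚᵘP.*-cong (ℚᵘP.≃-refl {toℚᵘ q}) (toℚᵘ-ι₀ (Z.+ suc d-1)) ⟩
  ℚᵘ.mkℚᵘ n d-1 ℚᵘ.* ℚᵘ.mkℚᵘ (Z.+ suc d-1) 0  ≈⟨ ℚᵘ.*≡* (trans (ℤP.*-identityʳ _) (cong (n Z.*_) (sym (cong Z.+_ (ℕP.*-identityʳ (suc d-1)))))) ⟩
  n ℚᵘ./ 1                           ≈⟨ ℚᵘP.≃-sym (toℚᵘ-ι₀ n) ⟩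
  toℚᵘ (ι₀ n) ∎)
  where open import Relation.Binary.Reasoning.Setoid ℚᵘP.≃-setoid

-- Opaque, because unfolding z / 1 exposes the normalisation of a fraction.
opaque
  ι : ℤ → ℚ
  ι = ι₀

  ι≡ι₀ : ∀ z → ι z ≡ ι₀ z
  ι≡ι₀ z = refl

  ι-+ : ∀ x y → ι (x Z.+ y) ≡ ι x ℚ.+ ι y
  ι-+ = ι₀-+

  ι-* : ∀ x y → ι (x Z.* y) ≡ ι x ℚ.* ι y
  ι-* = ι₀-*

  ι-neg : ∀ x → ι (Z.- x) ≡ ℚ.- ι x
  ι-neg = ι₀-neg

  ι-injective : ∀ {x y} → ι x ≡ ι y → x ≡ y
  ι-injective = ι₀-injective

ιₙ : ℕ → ℚ
ιₙ n = ι (Z.+ n)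

opaque
  unfolding ι

  recip-inverse : ∀ n .{{_ : NonZero n}} → recip n ℚ.* ιₙ n ≡ 1ℚ
  recip-inverse = recip-inverse₀

  ↥≡*↧ : ∀ q → q ℚ.* ιₙ (ℚ.↧ₙ q) ≡ ι (ℚ.↥ q)
  ↥≡*↧ = ↥≡*↧₀

Int : ℚ → Set
Int q = ∃ λ z → q ≡ ι z

opaque
  unfolding ι

  -- An integral `q` equals its own numerator, so one comparison decides. Through this test double
  -- negations are later removed from statements about coordinates.
  Int? : ∀ q → Dec (Int q)
  Int? q = map′ (λ e → ℚ.↥ q , e) (λ { (z , refl) → sym (cong ι (↥ι z)) }) (q ℚP.≟ ι (ℚ.↥ q))
    where
    ↥ι : ∀ z → ℚ.↥ (ι z) ≡ z
    ↥ι z = trans (sym (ℤP.*-identityʳ _))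
      (trans (cong (λ k → ℚ.↥ (ι z) Z.* Z.+ k) (sym (gcd-zeroʳ Z.∣ z ∣))) (ℚP.↥-/ z 1))

Int-0 : Int 0ℚ
Int-0 = 0ℤ , sym (ι≡ι₀ 0ℤ)

Int-1 : Int 1ℚ
Int-1 = 1ℤ , sym (ι≡ι₀ 1ℤ)

Int-+ : ∀ {p q} → Int p → Int q → Int (p ℚ.+ q)
Int-+ (x , refl) (y , refl) = x Z.+ y , sym (ι-+ x y)

Int-* : ∀ {p q} → Int p → Int q → Int (p ℚ.* q)
Int-* (x , refl) (y , refl) = x Z.* y , sym (ι-* x y)

Int-neg : ∀ {p} → Int p → Int (ℚ.- p)
Int-neg (x , refl) = Z.- x , sym (ι-neg x)

Int-ι : ∀ z → Int (ι z)
Int-ι z = z , refl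

-- `P` need not be decidable: if no least element existed, strong induction would refute `P`
-- everywhere. Hence the double negation.
least : ∀ (P : ℕ → Set) n → P n → ¬ ¬ (∃ λ m → P m × (∀ k → k ℕ.< m → ¬ P k))
least P n pn h = <-rec (λ n → ¬ P n) (λ n rec pn → h (n , pn , λ k k<n → rec k<n)) n pn

-- Lattices in ℚⁿ and their bases.

infixl 6 _⊕_
infixr 7 _⊙_

_⊕_ : ∀ {n} → Vec ℚ n → Vec ℚ n → Vec ℚ n
_⊕_ = zipWith ℚ._+_

_⊙_ : ∀ {n} → ℚ → Vec ℚ n → Vec ℚ n
q ⊙ v = map (q ℚ.*_) v

0v : ∀ {n} → Vec ℚ n
0v = replicate _ 0ℚ

comb : ∀ {m n} → Vec ℚ m → Vec (Vec ℚ n) m → Vec ℚ n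
comb []       []       = 0v
comb (q ∷ qs) (v ∷ vs) = (q ⊙ v) ⊕ comb qs vs

AllInt : ∀ {n} → Vec ℚ n → Set
AllInt = All Int

-- A full lattice known only through its closure properties and ℤⁿ ⊆ M ⊆ D⁻¹ℤⁿ. No generators are
-- supplied, because the lattices in question are cut out by conditions on their elements.
record Lattice {n} (M : Vec ℚ n → Set) : Set where
  field
    add   : ∀ {x y} → M x → M y → M (x ⊕ y)
    scale : ∀ z {x} → M x → M (ι z ⊙ x)
    int   : ∀ {x} → AllInt x → M x
    D     : ℕ
    D≢0   : NonZero D
    bound : ∀ {x} → M x → AllInt (ιₙ D ⊙ x)

record DualBasis {n} (M : Vec ℚ n → Set) : Set where
  field
    s      : Vec ℚ n → Vec ℚ n
    s-⊕    : ∀ x y → s (x ⊕ y) ≡ s x ⊕ s y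
    s-⊙    : ∀ q x → s (q ⊙ x) ≡ q ⊙ s x
    t      : Vec (Vec ℚ n) n
    t∈     : All M t
    expand : ∀ x → x ≡ comb (s x) t
    s-int  : ∀ {x} → M x → AllInt (s x)

module _ where
  private
    open ℚR

    0⊙ : ∀ {n} (x : Vec ℚ n) z → (z ⊙ (0ℚ ∷ x)) ≡ 0ℚ ∷ (z ⊙ x)
    0⊙ x z = cong (_∷ (z ⊙ x)) (ℚP.*-zeroʳ z)

    comb-0∷ : ∀ {m n} (qs : Vec ℚ m) (vs : Vec (Vec ℚ n) m) → comb qs (map (0ℚ ∷_) vs) ≡ 0ℚ ∷ comb qs vs
    comb-0∷ []       []       = refl
    comb-0∷ (q ∷ qs) (v ∷ vs) = trans (cong₂ _⊕_ (0⊙ v q) (comb-0∷ qs vs)) refl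

    s-lin-+ : ∀ {n} (x y b : Vec ℚ n) p q c →
      (x ⊕ y) ⊕ (ℚ.- ((p ℚ.+ q) ℚ.* c) ⊙ b) ≡ (x ⊕ (ℚ.- (p ℚ.* c) ⊙ b)) ⊕ (y ⊕ (ℚ.- (q ℚ.* c) ⊙ b))
    s-lin-+ [] [] [] p q c = refl
    s-lin-+ (x ∷ xs) (y ∷ ys) (b ∷ bs) p q c = cong₂ _∷_
      (solve 6 (λ x y b p q c → (x :+ y) :+ (:- ((p :+ q) :* c)) :* b := (x :+ (:- (p :* c)) :* b) :+ (y :+ (:- (q :* c)) :* b)) refl x y b p q c)
      (s-lin-+ xs ys bs p q c)

    s-lin-* : ∀ {n} (x b : Vec ℚ n) r p c →
      (r ⊙ x) ⊕ (ℚ.- ((r ℚ.* p) ℚ.* c) ⊙ b) ≡ r ⊙ (x ⊕ (ℚ.- (p ℚ.* c) ⊙ b))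
    s-lin-* [] [] r p c = refl
    s-lin-* (x ∷ xs) (b ∷ bs) r p c = cong₂ _∷_
      (solve 5 (λ x b r p c → (r :* x) :+ (:- ((r :* p) :* c)) :* b := r :* (x :+ (:- (p :* c)) :* b)) refl x b r p c)
      (s-lin-* xs bs r p c)

    cancel-⊕ : ∀ {n} (x b : Vec ℚ n) p → x ≡ (p ⊙ b) ⊕ (x ⊕ (ℚ.- p ⊙ b))
    cancel-⊕ [] [] p = refl
    cancel-⊕ (x ∷ xs) (b ∷ bs) p = cong₂ _∷_
      (solve 3 (λ x b p → x := p :* b :+ (x :+ (:- p) :* b)) refl x b p) (cancel-⊕ xs bs p)

    AllInt-0 : ∀ n → AllInt (0v {n})
    AllInt-0 zero    = []
    AllInt-0 (suc n) = Int-0 ∷ AllInt-0 n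

    All-map-0 : ∀ {m n} {M : Vec ℚ (suc n) → Set} {vs : Vec (Vec ℚ n) m} →
      All (λ v → M (0ℚ ∷ v)) vs → All M (map (0ℚ ∷_) vs)
    All-map-0 []       = []
    All-map-0 (p ∷ ps) = p ∷ All-map-0 ps

  -- Hermite normal form: the first basis vector has the least positive leading
  -- coordinate c / D.  Finding that least element is the only classical step.
  dualBasis : ∀ n {M : Vec ℚ n → Set} → Lattice M → ¬ ¬ DualBasis M
  dualBasis zero {M} L h = h record
    { s = λ x → x ; s-⊕ = λ _ _ → refl ; s-⊙ = λ _ _ → refl ; t = [] ; t∈ = []
    ; expand = λ { [] → refl } ; s-int = λ { {[]} _ → [] } }
  dualBasis (suc n) {M} L h = least Lead D lead-D λ where
      (zero , (_ , () , _) , _)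
      (c@(suc _) , (_ , _ , bt , b∈) , min) → dualBasis n L′ λ B → h (extend c bt b∈ min B)
    where
    open Lattice L
    instance _ = D≢0

    Lead : ℕ → Set
    Lead c = ∃ λ k → c ≡ suc k × ∃ λ x → M (ιₙ c ℚ.* recip D ∷ x)

    -- The first unit vector lies in ℤⁿ ⊆ M and 1 = D · (1/D), so there is a leading numerator from
    -- which to start the search for the least one.
    lead-D : Lead D
    lead-D = lead D D≢0 (int (subst Int (sym (trans (ℚP.*-comm (ιₙ D) (recip D)) (recip-inverse D))) Int-1 ∷ AllInt-0 n))
      where
      lead : ∀ d → NonZero d → ∀ {q} → M (q ∷ 0v) → ∃ λ k → d ≡ suc k × ∃ λ x → M (q ∷ x)
      lead (suc d) _ p = d , refl , 0v , p

    L′ : Lattice (λ x → M (0ℚ ∷ x))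
    L′ = record
      { add = λ p q → add p q
      ; scale = λ z {x} p → subst M (0⊙ x (ι z)) (scale z p)
      ; int = λ p → int (Int-0 ∷ p)
      ; D = D ; D≢0 = D≢0
      ; bound = λ p → All.tail (bound p) }

    module _ (c : ℕ) .{{_ : NonZero c}} (bt : Vec ℚ n) (b∈ : M (ιₙ c ℚ.* recip D ∷ bt))
             (min : ∀ k → k ℕ.< c → ¬ Lead k) (B : DualBasis (λ x → M (0ℚ ∷ x))) where
      private
        module B = DualBasis B

      γ γ⁻¹ : ℚ
      γ   = ιₙ c ℚ.* recip D
      γ⁻¹ = ιₙ D ℚ.* recip c

      γγ⁻¹ : γ⁻¹ ℚ.* γ ≡ 1ℚ
      γγ⁻¹ = trans (solve 4 (λ c d e f → (d :* f) :* (c :* e) := (f :* c) :* (e :* d)) refl (ιₙ c) (ιₙ D) (recip D) (recip c))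
        (cong₂ ℚ._*_ (recip-inverse c) (recip-inverse D))

      S : Vec ℚ (suc n) → Vec ℚ (suc n)
      S (z ∷ x) = z ℚ.* γ⁻¹ ∷ B.s (x ⊕ (ℚ.- (z ℚ.* γ⁻¹) ⊙ bt))

      S-int : ∀ {x} → M x → AllInt (S x)
      S-int {z ∷ x} p with bound p
      ... | (k , Dz≡k) ∷ _ = q∈ ∷ B.s-int (subst M rest≡ (add p (scale (Z.- q) b∈)))
        where
        open ≡-Reasoning
        r : ℕ
        r = k ℤDM.%ℕ c
        q : ℤ
        q = k ℤDM./ℕ c
        k≡ : ι k ≡ ιₙ r ℚ.+ ι q ℚ.* ιₙ c
        k≡ = trans (cong ι (ℤDM.a≡a%ℕn+[a/ℕn]*n k c)) (trans (ι-+ (Z.+ r) (q Z.* Z.+ c)) (cong (ιₙ r ℚ.+_) (ι-* q (Z.+ c))))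
        z≡ : z ≡ (ιₙ r ℚ.+ ι q ℚ.* ιₙ c) ℚ.* recip D
        z≡ = begin
          z ≡⟨ sym (ℚP.*-identityˡ z) ⟩
          1ℚ ℚ.* z ≡⟨ cong (ℚ._* z) (sym (recip-inverse D)) ⟩
          recip D ℚ.* ιₙ D ℚ.* z ≡⟨ ℚP.*-assoc (recip D) (ιₙ D) z ⟩
          recip D ℚ.* (ιₙ D ℚ.* z) ≡⟨ cong (recip D ℚ.*_) (trans Dz≡k k≡) ⟩
          recip D ℚ.* (ιₙ r ℚ.+ ι q ℚ.* ιₙ c) ≡⟨ ℚP.*-comm (recip D) _ ⟩
          _ ∎
        head≡ : z ℚ.+ ι (Z.- q) ℚ.* γ ≡ ιₙ r ℚ.* recip D
        head≡ = trans (cong₂ (λ u v → u ℚ.+ v ℚ.* γ) z≡ (ι-neg q))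
          (solve 4 (λ r q c d → (r :+ q :* c) :* d :+ (:- q) :* (c :* d) := r :* d) refl (ιₙ r) (ι q) (ιₙ c) (recip D))
        -- Subtracting q times the basis vector leaves an element of `M` with leading numerator r <
        -- c, which the minimality of c excludes unless r = 0.
        r≡0 : r ≡ 0
        r≡0 = small r (_ , subst (λ w → M (w ∷ (x ⊕ (ι (Z.- q) ⊙ bt)))) head≡ (add p (scale (Z.- q) b∈))) (ℤDM.n%ℕd<d k c)
          where
          small : ∀ r → (∃ λ y → M (ιₙ r ℚ.* recip D ∷ y)) → r ℕ.< c → r ≡ 0
          small zero    _ _   = refl
          small (suc r) e r<c = contradiction (r , refl , e) (min (suc r) r<c)
        z≡qγ : z ≡ ι q ℚ.* γ
        z≡qγ = trans z≡ (trans (cong (λ r → (r ℚ.+ ι q ℚ.* ιₙ c) ℚ.* recip D) (trans (cong ιₙ r≡0) (ι≡ι₀ 0ℤ)))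
          (solve 3 (λ q c d → (con 0ℚ :+ q :* c) :* d := q :* (c :* d)) refl (ι q) (ιₙ c) (recip D)))
        zγ⁻¹≡q : z ℚ.* γ⁻¹ ≡ ι q
        zγ⁻¹≡q = begin
          z ℚ.* γ⁻¹            ≡⟨ cong (ℚ._* γ⁻¹) z≡qγ ⟩
          ι q ℚ.* γ ℚ.* γ⁻¹    ≡⟨ ℚP.*-assoc (ι q) γ γ⁻¹ ⟩
          ι q ℚ.* (γ ℚ.* γ⁻¹)  ≡⟨ cong (ι q ℚ.*_) (trans (ℚP.*-comm γ γ⁻¹) γγ⁻¹) ⟩
          ι q ℚ.* 1ℚ           ≡⟨ ℚP.*-identityʳ (ι q) ⟩
          ι q ∎
        q∈ : Int (z ℚ.* γ⁻¹)
        q∈ = q , zγ⁻¹≡q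
        rest≡ : (z ∷ x) ⊕ (ι (Z.- q) ⊙ (γ ∷ bt)) ≡ 0ℚ ∷ (x ⊕ (ℚ.- (z ℚ.* γ⁻¹) ⊙ bt))
        rest≡ = cong₂ _∷_ (trans head≡ (trans (cong (ℚ._* recip D) (trans (cong ιₙ r≡0) (ι≡ι₀ 0ℤ))) (ℚP.*-zeroˡ (recip D))))
          (cong (λ w → x ⊕ (w ⊙ bt)) (trans (ι-neg q) (cong ℚ.-_ (sym zγ⁻¹≡q))))

      extend : DualBasis M
      extend = record
        { s = S
        ; s-⊕ = λ { (p ∷ x) (q ∷ y) → cong₂ _∷_ (ℚP.*-distribʳ-+ γ⁻¹ p q)
                    (trans (cong B.s (s-lin-+ x y bt p q γ⁻¹)) (B.s-⊕ _ _)) }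
        ; s-⊙ = λ { r (p ∷ x) → cong₂ _∷_ (ℚP.*-assoc r p γ⁻¹)
                    (trans (cong B.s (s-lin-* x bt r p γ⁻¹)) (B.s-⊙ r _)) }
        ; t = (γ ∷ bt) ∷ map (0ℚ ∷_) B.t
        ; t∈ = b∈ ∷ All-map-0 B.t∈
        ; expand = λ { (z ∷ x) → sym (begin
            ((z ℚ.* γ⁻¹) ⊙ (γ ∷ bt)) ⊕ comb (B.s (w z x)) (map (0ℚ ∷_) B.t)
              ≡⟨ cong (((z ℚ.* γ⁻¹) ⊙ (γ ∷ bt)) ⊕_) (comb-0∷ (B.s (w z x)) B.t) ⟩
            ((z ℚ.* γ⁻¹) ⊙ (γ ∷ bt)) ⊕ (0ℚ ∷ comb (B.s (w z x)) B.t)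
              ≡⟨ cong (λ y → ((z ℚ.* γ⁻¹) ⊙ (γ ∷ bt)) ⊕ (0ℚ ∷ y)) (sym (B.expand (w z x))) ⟩
            ((z ℚ.* γ⁻¹) ⊙ (γ ∷ bt)) ⊕ (0ℚ ∷ w z x)
              ≡⟨ cong₂ _∷_ (trans (ℚP.+-identityʳ _) (trans (ℚP.*-assoc z γ⁻¹ γ) (trans (cong (z ℚ.*_) γγ⁻¹) (ℚP.*-identityʳ z)))) (sym (cancel-⊕ x bt (z ℚ.* γ⁻¹))) ⟩
            z ∷ x ∎) }
        ; s-int = S-int }
        where
        open ≡-Reasoning
        w : ℚ → Vec ℚ n → Vec ℚ n
        w z x = x ⊕ (ℚ.- (z ℚ.* γ⁻¹) ⊙ bt)

-- An interface to ℚ[x]/(f): power basis, lattices, coordinates.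

δ : ∀ {n} → Fin n → Fin n → ℚ
δ zero    zero    = 1ℚ
δ zero    (suc j) = 0ℚ
δ (suc i) zero    = 0ℚ
δ (suc i) (suc j) = δ i j

last5 : Fin 6
last5 = 5F

record Ring≡ : Set₁ where
  infixl 6 _+_
  infixl 7 _*_
  infix  8 -_
  field
    K : Set
    _+_ _*_ : K → K → K
    -_ : K → K
    0# 1# : K
    isCommutativeRing : IsCommutativeRing _≡_ _+_ _*_ -_ 0# 1#

  ring : CommutativeRing 0ℓ 0ℓ
  ring = record { isCommutativeRing = isCommutativeRing }
  open SemiringSum (CommutativeRing.semiring ring) using (sum; *-distribˡ-sum; sum-cong-≗) public
  open SemiringExp (CommutativeRing.semiring ring) using (_^_) public

  -- A nominal wrapper: over a concrete ring the conversion checker would otherwise evaluate the sum.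
  record IsSum {n} (f : Fin n → K) (x : K) : Set where
    constructor isSum
    field sum≡ : x ≡ sum f
  open IsSum public

-- The algebra ℚ[x]/(x⁶ − Σ τᵢ xⁱ) with its power basis.
record PowerBasis : Set₁ where
  field
    ring≡ : Ring≡
  open Ring≡ ring≡ public
  field
    j   : ℚ → K
    j-+ : ∀ p q → j (p ℚ.+ q) ≡ j p + j q
    j-* : ∀ p q → j (p ℚ.* q) ≡ j p * j q
    j-1 : j 1ℚ ≡ 1#
    θ    : K
    coef : Fin 6 → K → ℚ
    coef-+ : ∀ i x y → coef i (x + y) ≡ coef i x ℚ.+ coef i y
    coef-j : ∀ i q x → coef i (j q * x) ≡ q ℚ.* coef i x
    expand : ∀ x → IsSum (λ i → j (coef i x) * θ ^ toℕ i) x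
    coef-θ^ : ∀ i k → coef i (θ ^ toℕ k) ≡ δ i k
    τ      : Fin 6 → ℤ
    coef-θ*-zero : ∀ x → coef zero (θ * x) ≡ coef last5 x ℚ.* ι (τ zero)
    coef-θ*-suc  : ∀ i x → coef (suc i) (θ * x) ≡ coef (inject₁ i) x ℚ.+ coef last5 x ℚ.* ι (τ (suc i))

  record Zθ (x : K) : Set where
    constructor zθ
    field coef-int : ∀ i → Int (coef i x)
  open Zθ public

module _ (P : PowerBasis) where
  open PowerBasis P

  record LatticeK (M : K → Set) : Set where
    field
      add   : ∀ {x y} → M x → M y → M (x + y)
      scale : ∀ z {x} → M x → M (j (ι z) * x)
      int   : ∀ {x} → Zθ x → M x
      D     : ℕ
      D≢0   : NonZero D
      bound : ∀ {x} → M x → Zθ (j (ιₙ D) * x)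

  record DualBasisK (M : K → Set) : Set where
    field
      s      : Fin 6 → K → ℚ
      s-+    : ∀ i x y → s i (x + y) ≡ s i x ℚ.+ s i y
      s-j    : ∀ i q x → s i (j q * x) ≡ q ℚ.* s i x
      t      : Fin 6 → K
      t∈     : ∀ i → M (t i)
      s-expand : ∀ x → IsSum (λ i → j (s i x) * t i) x
      s-int  : ∀ {x} → M x → ∀ i → Int (s i x)

-- The facts about K from which the arithmetic below is derived. `dualBasisK` is a field because its
-- proof works with coordinate vectors, which the interface hides.
record Setting : Set₁ where
  field
    powerBasis : PowerBasis
  open PowerBasis powerBasis public
  field
    dualBasisK : ∀ {M} → LatticeK powerBasis M → ¬ ¬ DualBasisK powerBasis M

-- The field of the statement as a commutative ring with a power basis.

module _ where
  private
    open ℚR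

    ⊕-assoc : ∀ {n} (x y z : Vec ℚ n) → (x ⊕ y) ⊕ z ≡ x ⊕ (y ⊕ z)
    ⊕-assoc [] [] [] = refl
    ⊕-assoc (x ∷ xs) (y ∷ ys) (z ∷ zs) = cong₂ _∷_ (ℚP.+-assoc x y z) (⊕-assoc xs ys zs)

    ⊕-comm : ∀ {n} (x y : Vec ℚ n) → x ⊕ y ≡ y ⊕ x
    ⊕-comm [] [] = refl
    ⊕-comm (x ∷ xs) (y ∷ ys) = cong₂ _∷_ (ℚP.+-comm x y) (⊕-comm xs ys)

    ⊕-0 : ∀ {n} (x : Vec ℚ n) → 0v ⊕ x ≡ x
    ⊕-0 [] = refl
    ⊕-0 (x ∷ xs) = cong₂ _∷_ (ℚP.+-identityˡ x) (⊕-0 xs)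

    ⊕-inv : ∀ {n} (x : Vec ℚ n) → map ℚ.-_ x ⊕ x ≡ 0v
    ⊕-inv [] = refl
    ⊕-inv (x ∷ xs) = cong₂ _∷_ (ℚP.+-inverseˡ x) (⊕-inv xs)

    ⊙-⊕ : ∀ {n} q (x y : Vec ℚ n) → q ⊙ (x ⊕ y) ≡ (q ⊙ x) ⊕ (q ⊙ y)
    ⊙-⊕ q [] [] = refl
    ⊙-⊕ q (x ∷ xs) (y ∷ ys) = cong₂ _∷_ (ℚP.*-distribˡ-+ q x y) (⊙-⊕ q xs ys)

    +-⊙ : ∀ {n} p q (x : Vec ℚ n) → (p ℚ.+ q) ⊙ x ≡ (p ⊙ x) ⊕ (q ⊙ x)
    +-⊙ p q [] = refl
    +-⊙ p q (x ∷ xs) = cong₂ _∷_ (ℚP.*-distribʳ-+ x p q) (+-⊙ p q xs)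

    *-⊙ : ∀ {n} p q (x : Vec ℚ n) → (p ℚ.* q) ⊙ x ≡ p ⊙ (q ⊙ x)
    *-⊙ p q [] = refl
    *-⊙ p q (x ∷ xs) = cong₂ _∷_ (ℚP.*-assoc p q x) (*-⊙ p q xs)

    1⊙ : ∀ {n} (x : Vec ℚ n) → 1ℚ ⊙ x ≡ x
    1⊙ [] = refl
    1⊙ (x ∷ xs) = cong₂ _∷_ (ℚP.*-identityˡ x) (1⊙ xs)

    0⊙≡ : ∀ {n} (x : Vec ℚ n) → 0ℚ ⊙ x ≡ 0v
    0⊙≡ [] = refl
    0⊙≡ (x ∷ xs) = cong₂ _∷_ (ℚP.*-zeroˡ x) (0⊙≡ xs)

    ⊙0 : ∀ {n} q → q ⊙ 0v {n} ≡ 0v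
    ⊙0 {zero} q = refl
    ⊙0 {suc n} q = cong₂ _∷_ (ℚP.*-zeroʳ q) (⊙0 q)

    ⊕-swap : ∀ {n} (x y z w : Vec ℚ n) → (x ⊕ y) ⊕ (z ⊕ w) ≡ (x ⊕ z) ⊕ (y ⊕ w)
    ⊕-swap [] [] [] [] = refl
    ⊕-swap (x ∷ xs) (y ∷ ys) (z ∷ zs) (w ∷ ws) = cong₂ _∷_
      (solve 4 (λ x y z w → (x :+ y) :+ (z :+ w) := (x :+ z) :+ (y :+ w)) refl x y z w) (⊕-swap xs ys zs ws)

    -- multiplication by θ, for an arbitrary value T of θ⁶
    sh : Vec ℚ 6 → Vec ℚ 6 → Vec ℚ 6
    sh T (c0 ∷ c1 ∷ c2 ∷ c3 ∷ c4 ∷ c5 ∷ []) = (0ℚ ∷ c0 ∷ c1 ∷ c2 ∷ c3 ∷ c4 ∷ []) ⊕ (c5 ⊙ T)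

    sh-⊕ : ∀ T x y → sh T (x ⊕ y) ≡ sh T x ⊕ sh T y
    sh-⊕ T x@(a0 ∷ a1 ∷ a2 ∷ a3 ∷ a4 ∷ a5 ∷ []) y@(b0 ∷ b1 ∷ b2 ∷ b3 ∷ b4 ∷ b5 ∷ []) =
      trans (cong₂ _⊕_ (cong (λ z → z ∷ a0 ℚ.+ b0 ∷ a1 ℚ.+ b1 ∷ a2 ℚ.+ b2 ∷ a3 ℚ.+ b3 ∷ a4 ℚ.+ b4 ∷ []) (sym (ℚP.+-identityˡ 0ℚ))) (+-⊙ a5 b5 T))
        (⊕-swap (0ℚ ∷ a0 ∷ a1 ∷ a2 ∷ a3 ∷ a4 ∷ []) (0ℚ ∷ b0 ∷ b1 ∷ b2 ∷ b3 ∷ b4 ∷ []) (a5 ⊙ T) (b5 ⊙ T))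

    sh-⊙ : ∀ T q x → sh T (q ⊙ x) ≡ q ⊙ sh T x
    sh-⊙ T q x@(a0 ∷ a1 ∷ a2 ∷ a3 ∷ a4 ∷ a5 ∷ []) =
      trans (cong₂ _⊕_ (cong (λ z → z ∷ q ℚ.* a0 ∷ q ℚ.* a1 ∷ q ℚ.* a2 ∷ q ℚ.* a3 ∷ q ℚ.* a4 ∷ []) (sym (ℚP.*-zeroʳ q))) (*-⊙ q a5 T))
        (sym (⊙-⊕ q (0ℚ ∷ a0 ∷ a1 ∷ a2 ∷ a3 ∷ a4 ∷ []) (a5 ⊙ T)))

    e0 : Vec ℚ 6
    e0 = 1ℚ ∷ 0ℚ ∷ 0ℚ ∷ 0ℚ ∷ 0ℚ ∷ 0ℚ ∷ []

    sh-push : ∀ T q c0 c1 c2 c3 c4 → (q ⊙ e0) ⊕ sh T (c0 ∷ c1 ∷ c2 ∷ c3 ∷ c4 ∷ 0ℚ ∷ []) ≡ (q ∷ c0 ∷ c1 ∷ c2 ∷ c3 ∷ c4 ∷ [])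
    sh-push T q c0 c1 c2 c3 c4 = trans (cong (λ w → (q ⊙ e0) ⊕ ((0ℚ ∷ c0 ∷ c1 ∷ c2 ∷ c3 ∷ c4 ∷ []) ⊕ w)) (0⊙≡ T))
      (cong₂ _∷_ (trans (ℚP.+-identityʳ _) (ℚP.*-identityʳ q)) (cong₂ _∷_ (l c0) (cong₂ _∷_ (l c1) (cong₂ _∷_ (l c2) (cong₂ _∷_ (l c3) (cong₂ _∷_ (l c4) refl))))))
      where
      l : ∀ c → q ℚ.* 0ℚ ℚ.+ (c ℚ.+ 0ℚ) ≡ c
      l c = trans (cong₂ ℚ._+_ (ℚP.*-zeroʳ q) (ℚP.+-identityʳ c)) (ℚP.+-identityˡ c)

  module FieldRing (m : ℕ) (a b c : ℤ) (τ : Fin 6 → ℤ)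
    (τ-coeff : ∀ i → lookup (Field.θ⁶ m a b c) i ≡ ι (τ i)) where

    open Field m a b c

    abstract
      mulθ-⊕ : ∀ x y → mulθ (x ⊕ y) ≡ mulθ x ⊕ mulθ y
      mulθ-⊕ x@(_ ∷ _ ∷ _ ∷ _ ∷ _ ∷ _ ∷ []) y@(_ ∷ _ ∷ _ ∷ _ ∷ _ ∷ _ ∷ []) = sh-⊕ θ⁶ x y

      mulθ-⊙ : ∀ q x → mulθ (q ⊙ x) ≡ q ⊙ mulθ x
      mulθ-⊙ q x@(_ ∷ _ ∷ _ ∷ _ ∷ _ ∷ _ ∷ []) = sh-⊙ θ⁶ q x

      mulθ-0 : mulθ 0K ≡ 0K
      mulθ-0 = trans (cong mulθ (sym (0⊙≡ 0K))) (trans (mulθ-⊙ 0ℚ 0K) (0⊙≡ (mulθ 0K)))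

      mulθ-push : ∀ q c0 c1 c2 c3 c4 → (q ⊙ 1K) ⊕ mulθ (c0 ∷ c1 ∷ c2 ∷ c3 ∷ c4 ∷ 0ℚ ∷ []) ≡ (q ∷ c0 ∷ c1 ∷ c2 ∷ c3 ∷ c4 ∷ [])
      mulθ-push = sh-push θ⁶

    horner-⊕ : ∀ qs x y → horner qs (x ⊕ y) ≡ horner qs x ⊕ horner qs y
    horner-⊕ [] x y = sym (⊕-0 0K)
    horner-⊕ (q ∷ qs) x y = trans
      (cong₂ _⊕_ (⊙-⊕ q x y) (trans (cong mulθ (horner-⊕ qs x y)) (mulθ-⊕ (horner qs x) (horner qs y))))
      (⊕-swap (q ⊙ x) (q ⊙ y) (mulθ (horner qs x)) (mulθ (horner qs y)))

    horner-⊙ : ∀ qs r x → horner qs (r ⊙ x) ≡ r ⊙ horner qs x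
    horner-⊙ [] r x = sym (⊙0 r)
    horner-⊙ (q ∷ qs) r x = trans
      (cong₂ _⊕_ (trans (sym (*-⊙ q r x)) (trans (cong (_⊙ x) (ℚP.*-comm q r)) (*-⊙ r q x)))
        (trans (cong mulθ (horner-⊙ qs r x)) (mulθ-⊙ r (horner qs x))))
      (sym (⊙-⊕ r (q ⊙ x) (mulθ (horner qs x))))

    horner-mulθ : ∀ qs x → horner qs (mulθ x) ≡ mulθ (horner qs x)
    horner-mulθ [] x = sym mulθ-0
    horner-mulθ (q ∷ qs) x = trans (cong₂ _⊕_ (sym (mulθ-⊙ q x)) (cong mulθ (horner-mulθ qs x))) (sym (mulθ-⊕ (q ⊙ x) (mulθ (horner qs x))))

    horner-0 : ∀ qs → horner qs 0K ≡ 0K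
    horner-0 qs = trans (cong (horner qs) (sym (0⊙≡ 0K))) (trans (horner-⊙ qs 0ℚ 0K) (0⊙≡ (horner qs 0K)))

    -- `horner ps` is a polynomial in the linear operator `mulθ`, and two polynomials in one
    -- operator commute. Together with `horner-1` this gives commutativity and associativity of the
    -- product.
    horner-comm : ∀ ps qs x → horner ps (horner qs x) ≡ horner qs (horner ps x)
    horner-comm ps [] x = horner-0 ps
    horner-comm ps (q ∷ qs) x = trans (horner-⊕ ps (q ⊙ x) (mulθ (horner qs x)))
      (cong₂ _⊕_ (horner-⊙ ps q x) (trans (horner-mulθ ps (horner qs x)) (cong mulθ (horner-comm ps qs x))))

    horner-toList-⊕ : ∀ {n} (v w : Vec ℚ n) x → horner (toList (v ⊕ w)) x ≡ horner (toList v) x ⊕ horner (toList w) x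
    horner-toList-⊕ [] [] x = sym (⊕-0 0K)
    horner-toList-⊕ (p ∷ v) (q ∷ w) x = trans
      (cong₂ _⊕_ (+-⊙ p q x) (trans (cong mulθ (horner-toList-⊕ v w x)) (mulθ-⊕ (horner (toList v) x) (horner (toList w) x))))
      (⊕-swap (p ⊙ x) (q ⊙ x) (mulθ (horner (toList v) x)) (mulθ (horner (toList w) x)))

    -- Horner evaluation at 1 shifts the coordinates up one place at a time, and the top coordinate
    -- is still 0 at each shift, so no reduction by θ⁶ occurs.
    horner-1 : ∀ y → horner (toList y) 1K ≡ y
    horner-1 (c0 ∷ c1 ∷ c2 ∷ c3 ∷ c4 ∷ c5 ∷ []) =
      step c0 c1 c2 c3 c4 c5 (step c1 c2 c3 c4 c5 0ℚ (step c2 c3 c4 c5 0ℚ 0ℚ (step c3 c4 c5 0ℚ 0ℚ 0ℚ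
        (step c4 c5 0ℚ 0ℚ 0ℚ 0ℚ (step c5 0ℚ 0ℚ 0ℚ 0ℚ 0ℚ refl)))))
      where
      step : ∀ q {x} c0 c1 c2 c3 c4 → x ≡ (c0 ∷ c1 ∷ c2 ∷ c3 ∷ c4 ∷ 0ℚ ∷ []) → (q ⊙ 1K) ⊕ mulθ x ≡ (q ∷ c0 ∷ c1 ∷ c2 ∷ c3 ∷ c4 ∷ [])
      step q c0 c1 c2 c3 c4 refl = mulθ-push q c0 c1 c2 c3 c4

    *K-comm : ∀ x y → x *K y ≡ y *K x
    *K-comm x y = trans (cong (horner (toList y)) (sym (horner-1 x)))
      (trans (horner-comm (toList y) (toList x) 1K) (cong (horner (toList x)) (horner-1 y)))

    *K-assoc : ∀ x y z → (x *K y) *K z ≡ x *K (y *K z)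
    *K-assoc x y z = trans (cong (horner (toList z)) (*K-comm x y))
      (trans (horner-comm (toList z) (toList x) y) (*K-comm (y *K z) x))

    *K-distribˡ : ∀ x y z → x *K (y ⊕ z) ≡ (x *K y) ⊕ (x *K z)
    *K-distribˡ x y z = horner-toList-⊕ y z x

    *K-identityˡ : ∀ x → 1K *K x ≡ x
    *K-identityˡ = horner-1

    abstract
      isCommutativeRingK : IsCommutativeRing _≡_ _+K_ _*K_ (λ x → -K x) 0K 1K
      isCommutativeRingK = record
        { isRing = record
          { +-isAbelianGroup = record
            { isGroup = record
              { isMonoid = record
                { isSemigroup = record
                  { isMagma = record { isEquivalence = isEquivalence ; ∙-cong = cong₂ _+K_ }
                  ; assoc = ⊕-assoc }
                ; identity = ⊕-0 , λ x → trans (⊕-comm x 0K) (⊕-0 x) }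
              ; inverse = ⊕-inv , λ x → trans (⊕-comm x (-K x)) (⊕-inv x)
              ; ⁻¹-cong = cong (λ x → -K x) }
            ; comm = ⊕-comm }
          ; *-cong = cong₂ _*K_
          ; *-assoc = *K-assoc
          ; *-identity = *K-identityˡ , λ x → trans (*K-comm x 1K) (*K-identityˡ x)
          ; distrib = *K-distribˡ , λ x y z → trans (*K-comm (y ⊕ z) x)
              (trans (*K-distribˡ x y z) (cong₂ _⊕_ (*K-comm x y) (*K-comm x z))) }
        ; *-comm = *K-comm }

    ringK : Ring≡
    ringK = record
      { K = K ; _+_ = _+K_ ; _*_ = _*K_ ; -_ = λ x → -K x ; 0# = 0K ; 1# = 1K
      ; isCommutativeRing = isCommutativeRingK }
    open Ring≡ ringK using (IsSum; isSum; sum; *-distribˡ-sum; sum-cong-≗; _^_)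

    jK : ℚ → K
    jK q = q • 1K

    θK : K
    θK = mulθ 1K

    jK-*K : ∀ q x → jK q *K x ≡ q • x
    jK-*K q x = trans (horner-⊙ (toList x) q 1K) (cong (q ⊙_) (horner-1 x))

    θK-*K : ∀ x → θK *K x ≡ mulθ x
    θK-*K x = trans (horner-mulθ (toList x) 1K) (cong mulθ (horner-1 x))

    horner-sum : ∀ {n} (v : Vec ℚ n) → horner (toList v) 1K ≡ sum (λ i → jK (lookup v i) *K (θK ^ toℕ i))
    horner-sum [] = refl
    horner-sum (q ∷ v) = cong₂ _⊕_ (sym (trans (*K-comm (jK q) 1K) (*K-identityˡ (jK q))))
      (trans (cong mulθ (horner-sum v)) (trans (sym (θK-*K (sum (λ i → jK (lookup v i) *K (θK ^ toℕ i))))) (trans (*-distribˡ-sum θK (λ i → jK (lookup v i) *K (θK ^ toℕ i)))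
        (sum-cong-≗ λ i → trans (sym (*K-assoc θK (jK (lookup v i)) (θK ^ toℕ i)))
          (trans (cong (_*K (θK ^ toℕ i)) (*K-comm θK (jK (lookup v i)))) (*K-assoc (jK (lookup v i)) θK (θK ^ toℕ i)))))))

    horner-IsSum : ∀ {n} (v : Vec ℚ n) → IsSum (λ i → jK (lookup v i) *K (θK ^ toℕ i)) (horner (toList v) 1K)
    horner-IsSum v = isSum (horner-sum v)

    private
      -- A wrapper that keeps the conversion checker from evaluating θK ^ n.
      record Pow (n : ℕ) (v : K) : Set where
        constructor pow
        field eq : θK ^ n ≡ v

    abstract
      θK^-coef : ∀ i k → lookup (θK ^ toℕ k) i ≡ δ i k
      θK^-coef i k = subst (λ w → lookup w i ≡ δ i k) (sym (Pow.eq (pow≡ k))) (lookup∘tabulate (λ i → δ i k) i)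
        where
        unit : Fin 6 → K
        unit k = tabulate (λ i → δ i k)
        z : ∀ c0 c1 c2 c3 c4 → mulθ (c0 ∷ c1 ∷ c2 ∷ c3 ∷ c4 ∷ 0ℚ ∷ []) ≡ (0ℚ ∷ c0 ∷ c1 ∷ c2 ∷ c3 ∷ c4 ∷ [])
        z c0 c1 c2 c3 c4 = trans (sym (⊕-0 (mulθ w))) (trans (cong (_⊕ mulθ w) (sym (0⊙≡ 1K))) (mulθ-push 0ℚ c0 c1 c2 c3 c4))
          where
          w : K
          w = c0 ∷ c1 ∷ c2 ∷ c3 ∷ c4 ∷ 0ℚ ∷ []
        up : ∀ {n c0 c1 c2 c3 c4} → Pow n (c0 ∷ c1 ∷ c2 ∷ c3 ∷ c4 ∷ 0ℚ ∷ []) → Pow (suc n) (0ℚ ∷ c0 ∷ c1 ∷ c2 ∷ c3 ∷ c4 ∷ [])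
        up {n} {c0} {c1} {c2} {c3} {c4} (pow e) = pow (trans (θK-*K (θK ^ n)) (trans (cong mulθ e) (z c0 c1 c2 c3 c4)))
        p1 : Pow 1 (unit 1F)
        p1 = up (pow refl)
        p2 : Pow 2 (unit 2F)
        p2 = up p1
        p3 : Pow 3 (unit 3F)
        p3 = up p2
        p4 : Pow 4 (unit 4F)
        p4 = up p3
        p5 : Pow 5 (unit 5F)
        p5 = up p4
        pow≡ : ∀ k → Pow (toℕ k) (unit k)
        pow≡ 0F = pow refl
        pow≡ 1F = p1
        pow≡ 2F = p2
        pow≡ 3F = p3
        pow≡ 4F = p4
        pow≡ 5F = p5

      coef-mulθ-zero : ∀ x → lookup (mulθ x) zero ≡ lookup x last5 ℚ.* ι (τ zero)
      coef-mulθ-zero (c0 ∷ c1 ∷ c2 ∷ c3 ∷ c4 ∷ c5 ∷ []) = trans (ℚP.+-identityˡ _) (cong (c5 ℚ.*_) (τ-coeff zero))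

      coef-mulθ-suc : ∀ i x → lookup (mulθ x) (suc i) ≡ lookup x (inject₁ i) ℚ.+ lookup x last5 ℚ.* ι (τ (suc i))
      coef-mulθ-suc i x@(c0 ∷ c1 ∷ c2 ∷ c3 ∷ c4 ∷ c5 ∷ []) = trans (lookup-zipWith ℚ._+_ (suc i) (0ℚ ∷ c0 ∷ c1 ∷ c2 ∷ c3 ∷ c4 ∷ []) (c5 ⊙ θ⁶))
        (cong₂ ℚ._+_ (low i) (trans (lookup-map (suc i) (c5 ℚ.*_) θ⁶) (cong (c5 ℚ.*_) (τ-coeff (suc i)))))
        where
        low : ∀ i → lookup (c0 ∷ c1 ∷ c2 ∷ c3 ∷ c4 ∷ []) i ≡ lookup x (inject₁ i)
        low 0F = refl
        low 1F = refl
        low 2F = refl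
        low 3F = refl
        low 4F = refl

      comb-sum : ∀ {n} (qs : Vec ℚ n) (vs : Vec K n) → comb qs vs ≡ sum (λ i → jK (lookup qs i) *K lookup vs i)
      comb-sum [] [] = refl
      comb-sum (q ∷ qs) (v ∷ vs) = cong₂ _⊕_ (sym (jK-*K q v)) (comb-sum qs vs)

      comb-IsSum : ∀ {n} (qs : Vec ℚ n) (vs : Vec K n) → IsSum (λ i → jK (lookup qs i) *K lookup vs i) (comb qs vs)
      comb-IsSum qs vs = isSum (comb-sum qs vs)

      fromAll : ∀ {A : Set} {Q : A → Set} {n} {v : Vec A n} → All Q v → ∀ i → Q (lookup v i)
      fromAll (p ∷ ps) zero    = p
      fromAll (p ∷ ps) (suc i) = fromAll ps i

      toAll : ∀ {n} {v : Vec ℚ n} → (∀ i → Int (lookup v i)) → AllInt v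
      toAll {v = []} h = []
      toAll {v = x ∷ v} h = h zero ∷ toAll (h ∘ suc)

    abstract
      jK-+ : ∀ p q → jK (p ℚ.+ q) ≡ jK p +K jK q
      jK-+ p q = +-⊙ p q 1K

      jK-* : ∀ p q → jK (p ℚ.* q) ≡ jK p *K jK q
      jK-* p q = trans (*-⊙ p q 1K) (sym (jK-*K p (jK q)))

      jK-1 : jK 1ℚ ≡ 1K
      jK-1 = 1⊙ 1K

      coefK-+ : ∀ i x y → lookup (x +K y) i ≡ lookup x i ℚ.+ lookup y i
      coefK-+ i x y = lookup-zipWith ℚ._+_ i x y

      coefK-j : ∀ i q x → lookup (jK q *K x) i ≡ q ℚ.* lookup x i
      coefK-j i q x = trans (cong (λ w → lookup w i) (jK-*K q x)) (lookup-map i (q ℚ.*_) x)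

      expandK : ∀ x → IsSum (λ i → jK (lookup x i) *K (θK ^ toℕ i)) x
      expandK x = subst (IsSum (λ i → jK (lookup x i) *K (θK ^ toℕ i))) (horner-1 x) (horner-IsSum x)

      coef-θK*-zero : ∀ x → lookup (θK *K x) zero ≡ lookup x last5 ℚ.* ι (τ zero)
      coef-θK*-zero x = trans (cong (λ w → lookup w zero) (θK-*K x)) (coef-mulθ-zero x)

      coef-θK*-suc : ∀ i x → lookup (θK *K x) (suc i) ≡ lookup x (inject₁ i) ℚ.+ lookup x last5 ℚ.* ι (τ (suc i))
      coef-θK*-suc i x = trans (cong (λ w → lookup w (suc i)) (θK-*K x)) (coef-mulθ-suc i x)

    powerBasis : PowerBasis
    powerBasis = record
      { ring≡ = ringK
      ; j = jK
      ; j-+ = jK-+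
      ; j-* = jK-*
      ; j-1 = jK-1
      ; θ = θK
      ; coef = λ i x → lookup x i
      ; coef-+ = coefK-+
      ; coef-j = coefK-j
      ; expand = expandK
      ; coef-θ^ = θK^-coef
      ; τ = τ
      ; coef-θ*-zero = coef-θK*-zero
      ; coef-θ*-suc = coef-θK*-suc }

    setting : Setting
    setting = record
      { powerBasis = powerBasis
      ; dualBasisK = λ {M} L h → dualBasis 6 {M} (lattice L) λ B → h (dual B)
      }
      where
      module _ {M : K → Set} where
        lattice : LatticeK powerBasis M → Lattice M
        lattice L = record
          { add = L.add ; scale = λ z {x} p → subst M (jK-*K (ι z) x) (L.scale z p)
          ; int = λ p → L.int (PowerBasis.zθ (fromAll p)) ; D = L.D ; D≢0 = L.D≢0
          ; bound = λ {x} p → toAll (λ i → subst (λ w → Int (lookup w i)) (jK-*K (ιₙ L.D) x) (PowerBasis.coef-int (L.bound p) i)) }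
          where
          module L = LatticeK L
        dual : DualBasis M → DualBasisK powerBasis M
        dual B = record
          { s = λ i x → lookup (B.s x) i
          ; s-+ = λ i x y → trans (cong (λ w → lookup w i) (B.s-⊕ x y)) (lookup-zipWith ℚ._+_ i (B.s x) (B.s y))
          ; s-j = λ i q x → trans (cong (λ w → lookup w i) (trans (cong B.s (jK-*K q x)) (B.s-⊙ q x))) (lookup-map i (q ℚ.*_) (B.s x))
          ; t = lookup B.t
          ; t∈ = λ i → fromAll B.t∈ i
          ; s-expand = λ x → subst (IsSum (λ i → jK (lookup (B.s x) i) *K lookup B.t i)) (sym (B.expand x)) (comb-IsSum (B.s x) B.t)
          ; s-int = λ p i → fromAll (B.s-int p) i }
          where
          module B = DualBasis B

-- Scalars, ℤ-modules and division-free elimination.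

module Scalars (P : PowerBasis) where
  open PowerBasis P
  open CommutativeRing ring public using
    (+-assoc; +-comm; +-identityˡ; +-identityʳ; *-assoc; *-comm; *-identityˡ; *-identityʳ; distribˡ; distribʳ; zeroˡ; zeroʳ; -‿inverseˡ; -‿inverseʳ)
  open RingP (CommutativeRing.ring ring) public using (-‿distribˡ-*; -‿distribʳ-*; -‿involutive; -0#≈0#; +-cancelˡ; +-inverseˡ-unique)

  j-0 : j 0ℚ ≡ 0#
  j-0 = +-cancelˡ (j 0ℚ) (j 0ℚ) 0# (trans (sym (j-+ 0ℚ 0ℚ)) (sym (+-identityʳ (j 0ℚ))))

  j-neg : ∀ q → j (ℚ.- q) ≡ - j q
  j-neg q = +-inverseˡ-unique (j (ℚ.- q)) (j q) (trans (sym (j-+ (ℚ.- q) q)) (trans (cong j (ℚP.+-inverseˡ q)) j-0))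

  j-morphism : ℚP.+-*-rawRing -Raw-AlmostCommutative⟶ fromCommutativeRing ring
  j-morphism = record { ⟦_⟧ = j ; +-homo = j-+ ; *-homo = j-* ; -‿homo = j-neg ; 0-homo = j-0 ; 1-homo = j-1 }

  module Solver = Algebra.Solver.Ring ℚP.+-*-rawRing (fromCommutativeRing ring) j-morphism
    (λ p q → Maybe.map (cong j) (dec⇒maybe (p ℚP.≟ q)))

  infixl 6 _-_
  _-_ : K → K → K
  x - y = x + - y

  open Solver using (solve; _:=_; _:+_; _:*_; _:-_; :-_; con; _:^_)

  jz : ℤ → K
  jz z = j (ι z)

  jₙ : ℕ → K
  jₙ n = j (ιₙ n)

  jₙ-cancel : ∀ n .{{_ : NonZero n}} {x y} → jₙ n * x ≡ jₙ n * y → x ≡ y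
  jₙ-cancel n {x} {y} e = trans (back x) (trans (cong (j (recip n) *_) e) (sym (back y)))
    where
    back : ∀ x → x ≡ j (recip n) * (jₙ n * x)
    back x = trans (sym (trans (cong (_* x) (trans (sym (j-* (recip n) (ιₙ n))) (trans (cong j (recip-inverse n)) j-1))) (*-identityˡ x)))
      (*-assoc (j (recip n)) (jₙ n) x)

  jz-* : ∀ x y → jz (x Z.* y) ≡ jz x * jz y
  jz-* x y = trans (cong j (ι-* x y)) (j-* (ι x) (ι y))

  jz-+ : ∀ x y → jz (x Z.+ y) ≡ jz x + jz y
  jz-+ x y = trans (cong j (ι-+ x y)) (j-+ (ι x) (ι y))

  jz-neg : ∀ x → jz (Z.- x) ≡ - jz x
  jz-neg x = trans (cong j (ι-neg x)) (j-neg (ι x))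

  jz-1 : jz 1ℤ ≡ 1#
  jz-1 = trans (cong j (ι≡ι₀ 1ℤ)) j-1

  record IsZModule (Q : K → Set) : Set where
    field
      zero∈ : Q 0#
      add   : ∀ {x y} → Q x → Q y → Q (x + y)
      scale : ∀ z {x} → Q x → Q (jz z * x)

    neg : ∀ {x} → Q x → Q (- x)
    neg {x} q = subst Q (trans (cong (_* x) (cong j (ι≡ι₀ (Z.- 1ℤ)))) (solve 1 (λ x → con (ℚ.- 1ℚ) :* x := :- x) refl x)) (scale (Z.- 1ℤ) q)

    sub : ∀ {x y} → Q x → Q y → Q (x - y)
    sub p q = add p (neg q)

    sum∈ : ∀ {n} {f : Fin n → K} → (∀ i → Q (f i)) → Q (sum f)
    sum∈ {zero}  h = zero∈
    sum∈ {suc n} h = add (h zero) (sum∈ (h ∘ suc))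

    combination : ∀ {n} {f : Fin n → K} {q : Fin n → ℚ} {x} → IsSum (λ i → j (q i) * f i) x → (∀ i → Int (q i)) → (∀ i → Q (f i)) → Q x
    combination {f = f} {q} (isSum e) int h = subst Q (sym e) (sum∈ λ i → subst (λ w → Q (j w * f i)) (sym (proj₂ (int i))) (scale (proj₁ (int i)) (h i)))

  -- Two determinant arguments share this module. For Cayley-Hamilton, `U` and `J` are the monic
  -- polynomials in an element and those of smaller degree, and `N` is zero; for Nakayama they are
  -- the integers congruent to 1 and to 0 modulo p. The resulting `u` takes the place of the
  -- determinant.
  module Elimination (U J : ℕ → K → Set) (N : K → Set)
    (N-sub : ∀ {x y} → N x → N y → N (x - y)) (N-add : ∀ {x y} → N x → N y → N (x + y)) (N-0 : N 0#)
    (U-N : ∀ {d a x} → U d a → N x → N (a * x)) (J-N : ∀ {d a x} → J d a → N x → N (a * x))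
    (U-1 : U 0 1#) (U-* : ∀ {d e a b} → U d a → U e b → U (d ℕ.+ e) (a * b))
    (U-J : ∀ {d a b} → U d a → J d b → U d (a - b)) (J-J : ∀ {d a b} → J d a → J d b → J d (a - b))
    (UJ-* : ∀ {d e a b} → U d a → J e b → J (d ℕ.+ e) (a * b))
    (JJ-* : ∀ {d e a b} → J d a → J e b → J (d ℕ.+ e) (a * b)) where

    private
      sum-pivot : ∀ {n} a b (p q v : Fin n → K) →
        a * sum (λ i → p i * v i) - b * sum (λ i → q i * v i) ≡ sum (λ i → (a * p i - b * q i) * v i)
      sum-pivot {zero} a b p q v = trans (solve 3 (λ a b z → a :* z :- b :* z := (a :- b) :* z) refl a b 0#) (zeroʳ (a - b))
      sum-pivot {suc n} a b p q v = trans
        (solve 7 (λ a b p q v s t → a :* (p :* v :+ s) :- b :* (q :* v :+ t) := (a :* p :- b :* q) :* v :+ (a :* s :- b :* t))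
          refl a b (p zero) (q zero) (v zero) (sum (λ i → p (suc i) * v (suc i))) (sum (λ i → q (suc i) * v (suc i))))
        (cong ((a * p zero - b * q zero) * v zero +_) (sum-pivot a b (p ∘ suc) (q ∘ suc) (v ∘ suc)))

      sum∈N : ∀ {n} {f : Fin n → K} → (∀ i → N (f i)) → N (sum f)
      sum∈N {zero}  h = N-0
      sum∈N {suc n} h = N-add (h zero) (sum∈N (h ∘ suc))

    -- Gaussian elimination without division.  Column i carries a degree d i which its
    -- diagonal entry attains and its other entries do not; the pivot step preserves this.
    eliminate : ∀ n (d : Fin n → ℕ) (p : Fin n → Fin n → K) (v : Fin n → K) →
      (∀ i → U (d i) (p i i)) → (∀ i k → i ≢ k → J (d k) (p i k)) →
      (∀ i → N (sum λ k → p i k * v k)) → ∃ λ e → ∃ λ u → U e u × (∀ i → N (u * v i))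
    eliminate zero d p v diag off rel = 0 , 1# , U-1 , λ ()
    eliminate (suc n) d p v diag off rel = d 0F ℕ.+ e , p 0F 0F * u , U-* (diag 0F) u∈ , λ where
        zero    → subst N (solve 4 (λ a u v s → u :* (a :* v :+ s) :- u :* s := (a :* u) :* v) refl (p 0F 0F) u (v 0F) (sum λ k → p 0F (suc k) * v (suc k)))
                     (N-sub (U-N u∈ (rel 0F))
                       (subst N (sym (trans (*-distribˡ-sum u (λ k → p 0F (suc k) * v (suc k)))
                           (sum-cong-≗ λ k → solve 3 (λ u p v → u :* (p :* v) := p :* (u :* v)) refl u (p 0F (suc k)) (v (suc k)))))
                         (sum∈N λ k → J-N (off 0F (suc k) λ ()) (u∙ k))))
        (suc i) → subst N (sym (*-assoc (p 0F 0F) u (v (suc i)))) (U-N (diag 0F) (u∙ i))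
      where
      p′ : Fin n → Fin n → K
      p′ i k = p 0F 0F * p (suc i) (suc k) - p (suc i) 0F * p 0F (suc k)
      rec : ∃ λ e → ∃ λ u → U e u × (∀ i → N (u * v (suc i)))
      rec = eliminate n (λ i → d 0F ℕ.+ d (suc i)) p′ (v ∘ suc)
        (λ i → U-J (U-* (diag 0F) (diag (suc i))) (JJ-* (off (suc i) 0F λ ()) (off 0F (suc i) λ ())))
        (λ i k i≢k → J-J (UJ-* (diag 0F) (off (suc i) (suc k) (i≢k ∘ suc-injective))) (JJ-* (off (suc i) 0F λ ()) (off 0F (suc k) λ ())))
        (λ i → subst N (trans
           (solve 5 (λ a b v s t → a :* (b :* v :+ s) :- b :* (a :* v :+ t) := a :* s :- b :* t) refl
             (p 0F 0F) (p (suc i) 0F) (v 0F) (sum λ k → p (suc i) (suc k) * v (suc k)) (sum λ k → p 0F (suc k) * v (suc k)))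
           (sum-pivot (p 0F 0F) (p (suc i) 0F) (λ k → p (suc i) (suc k)) (λ k → p 0F (suc k)) (v ∘ suc)))
           (N-sub (U-N (diag 0F) (rel (suc i))) (J-N (off (suc i) 0F λ ()) (rel 0F))))
      e = proj₁ rec
      u = proj₁ (proj₂ rec)
      u∈ : U e u
      u∈ = proj₁ (proj₂ (proj₂ rec))
      u∙ : ∀ i → N (u * v (suc i))
      u∙ = proj₂ (proj₂ (proj₂ rec))

δ-diag : ∀ {n} (i : Fin n) → δ i i ≡ 1ℚ
δ-diag zero    = refl
δ-diag (suc i) = δ-diag i

δ-off : ∀ {n} {i k : Fin n} → i ≢ k → δ i k ≡ 0ℚ
δ-off {i = zero}  {zero}  h = contradiction refl h
δ-off {i = zero}  {suc k} h = refl
δ-off {i = suc i} {zero}  h = refl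
δ-off {i = suc i} {suc k} h = δ-off (h ∘ cong suc)

sumℚ-δ : ∀ {n} (f : Fin n → ℚ) i → sumℚ (λ k → f k ℚ.* δ i k) ≡ f i
sumℚ-δ f zero    = trans (cong₂ ℚ._+_ (ℚP.*-identityʳ (f zero)) (sum-0 (f ∘ suc))) (ℚP.+-identityʳ (f zero))
  where
  sum-0 : ∀ {n} (f : Fin n → ℚ) → sumℚ (λ k → f k ℚ.* 0ℚ) ≡ 0ℚ
  sum-0 {zero}  f = refl
  sum-0 {suc n} f = trans (cong₂ ℚ._+_ (ℚP.*-zeroʳ (f zero)) (sum-0 (f ∘ suc))) (ℚP.+-identityˡ 0ℚ)
sumℚ-δ f (suc i) = trans (cong₂ ℚ._+_ (ℚP.*-zeroʳ (f zero)) (sumℚ-δ (f ∘ suc) i)) (ℚP.+-identityˡ (f (suc i)))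

Int-sum : ∀ {n} {f : Fin n → ℚ} → (∀ i → Int (f i)) → Int (sumℚ f)
Int-sum {zero}  h = Int-0
Int-sum {suc n} h = Int-+ (h zero) (Int-sum (h ∘ suc))

ιₙ-* : ∀ m n → ιₙ (m ℕ.* n) ≡ ιₙ m ℚ.* ιₙ n
ιₙ-* m n = trans (cong ι (ℤP.pos-* m n)) (ι-* (Z.+ m) (Z.+ n))

common-denominator : ∀ {n} (f : Fin n → ℚ) → ∃ λ D → NonZero D × (∀ i → Int (ιₙ D ℚ.* f i))
common-denominator {zero}  f = 1 , _ , λ ()
common-denominator {suc n} f with common-denominator (f ∘ suc)
... | D , D≢0 , h = D′ ℕ.* D , ℕP.m*n≢0 D′ D {{_}} {{D≢0}} , λ where
    zero → subst Int (sym (trans (cong (ℚ._* f zero) (trans (ιₙ-* D′ D) (ℚP.*-comm (ιₙ D′) (ιₙ D)))) (ℚP.*-assoc (ιₙ D) (ιₙ D′) (f zero))))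
      (Int-* (Int-ι (Z.+ D)) (subst Int (sym (trans (ℚP.*-comm (ιₙ D′) (f zero)) (↥≡*↧ (f zero)))) (Int-ι (ℚ.↥ f zero))))
    (suc i) → subst Int (sym (trans (cong (ℚ._* f (suc i)) (ιₙ-* D′ D)) (ℚP.*-assoc (ιₙ D′) (ιₙ D) (f (suc i))))) (Int-* (Int-ι (Z.+ D′)) (h i))
  where D′ = ℚ.↧ₙ (f zero)

-- Integral elements and bounded denominators.

module Integrality (S : Setting) where
  open Setting S
  open Scalars powerBasis
  open Solver using (solve; _:=_; _:+_; _:*_; _:-_; :-_; con; _:^_)

  ev : List ℤ → K → K
  ev []      x = 0#
  ev (z ∷ g) x = jz z + x * ev g x

  Integral : K → Set
  Integral x = ∃ λ g → ev (g ∷ʳ 1ℤ) x ≡ 0#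

  record Linear (h : K → ℚ) : Set where
    field
      lin-+ : ∀ x y → h (x + y) ≡ h x ℚ.+ h y
      lin-j : ∀ q x → h (j q * x) ≡ q ℚ.* h x

    lin-0 : h 0# ≡ 0ℚ
    lin-0 = trans (cong h (sym (trans (cong (_* 0#) j-0) (zeroˡ 0#)))) (trans (lin-j 0ℚ 0#) (ℚP.*-zeroˡ (h 0#)))

    lin-sum : ∀ {n} (f : Fin n → K) → h (sum f) ≡ sumℚ (h ∘ f)
    lin-sum {zero}  f = lin-0
    lin-sum {suc n} f = trans (lin-+ (f zero) (sum (f ∘ suc))) (cong (h (f zero) ℚ.+_) (lin-sum (f ∘ suc)))

    lin-combination : ∀ {n} {f : Fin n → K} {q : Fin n → ℚ} {x} → IsSum (λ i → j (q i) * f i) x → h x ≡ sumℚ (λ i → q i ℚ.* h (f i))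
    lin-combination {f = f} {q} (isSum e) = trans (cong h e) (trans (lin-sum (λ i → j (q i) * f i)) (sumℚ-cong (λ i → lin-j (q i) (f i))))

    lin-neg : ∀ x → h (- x) ≡ ℚ.- h x
    lin-neg x = trans (cong h (solve 1 (λ x → :- x := con (ℚ.- 1ℚ) :* x) refl x))
      (trans (lin-j (ℚ.- 1ℚ) x) (trans (sym (ℚP.neg-distribˡ-* 1ℚ (h x))) (cong ℚ.-_ (ℚP.*-identityˡ (h x)))))

  coef-linear : ∀ i → Linear (coef i)
  coef-linear i = record { lin-+ = coef-+ i ; lin-j = coef-j i }

  after-* : ∀ {h} → Linear h → ∀ y → Linear (λ x → h (x * y))
  after-* {h} L y = record
    { lin-+ = λ u v → trans (cong h (distribʳ y u v)) (lin-+ (u * y) (v * y))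
    ; lin-j = λ q u → trans (cong h (*-assoc (j q) u y)) (lin-j q (u * y)) }
    where open Linear L

  Zθ-module : IsZModule Zθ
  Zθ-module = record
    { zero∈ = zθ λ i → subst Int (sym (Linear.lin-0 (coef-linear i))) Int-0
    ; add = λ p q → zθ λ i → subst Int (sym (coef-+ i _ _)) (Int-+ (coef-int p i) (coef-int q i))
    ; scale = λ z p → zθ λ i → subst Int (sym (coef-j i (ι z) _)) (Int-* (Int-ι z) (coef-int p i)) }
  open IsZModule Zθ-module public using () renaming (add to Zθ-+; scale to Zθ-scale; neg to Zθ-neg; sub to Zθ-sub; zero∈ to Zθ-0)

  Zθ-θ* : ∀ {x} → Zθ x → Zθ (θ * x)
  Zθ-θ* {x} (zθ p) = zθ λ where
    zero    → subst Int (sym (coef-θ*-zero x)) (Int-* (p last5) (Int-ι (τ zero)))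
    (suc i) → subst Int (sym (coef-θ*-suc i x)) (Int-+ (p (inject₁ i)) (Int-* (p last5) (Int-ι (τ (suc i)))))

  Int-δ : ∀ {n} (i k : Fin n) → Int (δ i k)
  Int-δ zero    zero    = Int-1
  Int-δ zero    (suc k) = Int-0
  Int-δ (suc i) zero    = Int-0
  Int-δ (suc i) (suc k) = Int-δ i k

  Zθ-1 : Zθ 1#
  Zθ-1 = zθ λ i → subst Int (sym (coef-θ^ i 0F)) (Int-δ i 0F)

  Zθ-θ^ : ∀ k → Zθ (θ ^ k)
  Zθ-θ^ zero    = Zθ-1
  Zθ-θ^ (suc k) = Zθ-θ* (Zθ-θ^ k)

  θ-stable⇒Zθ-stable : ∀ {Q} → IsZModule Q → (∀ {x} → Q x → Q (θ * x)) → ∀ {x y} → Zθ x → Q y → Q (x * y)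
  θ-stable⇒Zθ-stable {Q} M θQ {x} {y} x∈ y∈ = subst Q (sym e)
      (combination (isSum {f = λ i → j (coef i x) * (θ ^ toℕ i * y)} refl) (coef-int x∈) (λ i → θ^∈ (toℕ i)))
    where
    open IsZModule M
    θ^∈ : ∀ k → Q (θ ^ k * y)
    θ^∈ zero    = subst Q (sym (*-identityˡ y)) y∈
    θ^∈ (suc k) = subst Q (sym (*-assoc θ (θ ^ k) y)) (θQ (θ^∈ k))
    e : x * y ≡ sum (λ i → j (coef i x) * (θ ^ toℕ i * y))
    e = trans (cong (_* y) (sum≡ (expand x))) (trans (*-comm _ y) (trans (*-distribˡ-sum y (λ i → j (coef i x) * θ ^ toℕ i))
      (sum-cong-≗ λ i → solve 3 (λ y c t → y :* (c :* t) := c :* (t :* y)) refl y (j (coef i x)) (θ ^ toℕ i))))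

  Zθ-* : ∀ {x y} → Zθ x → Zθ y → Zθ (x * y)
  Zθ-* = θ-stable⇒Zθ-stable Zθ-module Zθ-θ*

  Zθ-jz : ∀ z → Zθ (jz z)
  Zθ-jz z = subst Zθ (trans (*-comm (jz z) 1#) (*-identityˡ (jz z))) (Zθ-scale z Zθ-1)

  Zθ-^ : ∀ {x} k → Zθ x → Zθ (x ^ k)
  Zθ-^ zero    p = Zθ-1
  Zθ-^ (suc k) p = Zθ-* p (Zθ-^ k p)

  denominator : ∀ x → ∃ λ D → NonZero D × Zθ (jₙ D * x)
  denominator x with common-denominator (λ i → coef i x)
  ... | D , D≢0 , h = D , D≢0 , zθ λ i → subst Int (sym (coef-j i (ιₙ D) x)) (h i)

  jₙ-* : ∀ m n → jₙ (m ℕ.* n) ≡ jₙ m * jₙ n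
  jₙ-* m n = trans (cong j (ιₙ-* m n)) (j-* (ιₙ m) (ιₙ n))

  module PolynomialsIn (x : K) where

    -- Values at `x` of integer polynomials of degree less than `d`; `Monic d` holds of the values
    -- of monic polynomials of degree `d`. Only values are recorded, so the degree is a bound
    -- carried by the predicate.
    Low : ℕ → K → Set
    Low zero    y = y ≡ 0#
    Low (suc d) y = ∃ λ z → ∃ λ y′ → Low d y′ × y ≡ jz z + x * y′

    Monic : ℕ → K → Set
    Monic d y = ∃ λ l → Low d l × y ≡ x ^ d + l

    private
      jz0 : jz 0ℤ ≡ 0#
      jz0 = trans (cong j (ι≡ι₀ 0ℤ)) j-0

    low-0 : ∀ d → Low d 0#
    low-0 zero    = refl
    low-0 (suc d) = 0ℤ , 0# , low-0 d , sym (trans (cong₂ _+_ jz0 (zeroʳ x)) (+-identityˡ 0#))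

    low-+ : ∀ {d a b} → Low d a → Low d b → Low d (a + b)
    low-+ {zero}  refl refl = +-identityˡ 0#
    low-+ {suc d} (z , a , p , refl) (w , b , q , refl) = z Z.+ w , a + b , low-+ p q ,
      trans (solve 5 (λ z w a b x → (z :+ x :* a) :+ (w :+ x :* b) := (z :+ w) :+ x :* (a :+ b)) refl (jz z) (jz w) a b x)
        (cong (_+ x * (a + b)) (sym (jz-+ z w)))

    low-scale : ∀ {d} z {a} → Low d a → Low d (jz z * a)
    low-scale {zero}  z refl = zeroʳ (jz z)
    low-scale {suc d} z (w , a , p , refl) = z Z.* w , jz z * a , low-scale z p ,
      trans (solve 4 (λ z w a x → z :* (w :+ x :* a) := z :* w :+ x :* (z :* a)) refl (jz z) (jz w) a x)
        (cong (_+ x * (jz z * a)) (sym (jz-* z w)))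

    low-module : ∀ d → IsZModule (Low d)
    low-module d = record { zero∈ = low-0 d ; add = low-+ {d} ; scale = low-scale {d} }

    low-x* : ∀ {d a} → Low d a → Low (suc d) (x * a)
    low-x* {a = a} p = 0ℤ , a , p , sym (trans (cong (_+ x * a) jz0) (+-identityˡ (x * a)))

    low-suc : ∀ {d a} → Low d a → Low (suc d) a
    low-suc {zero}  refl = low-0 1
    low-suc {suc d} (z , a , p , refl) = z , a , low-suc {d} p , refl

    low-weaken : ∀ k {d a} → Low d a → Low (k ℕ.+ d) a
    low-weaken zero    p = p
    low-weaken (suc k) {d} p = low-suc {k ℕ.+ d} (low-weaken k p)

    low-jz : ∀ {d} z → Low (suc d) (jz z)
    low-jz {d} z = z , 0# , low-0 d , sym (trans (cong (jz z +_) (zeroʳ x)) (+-identityʳ (jz z)))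

    low-* : ∀ {d e a b} → Low d a → Low e b → Low (d ℕ.+ e) (a * b)
    low-* {zero}  {e} {b = b} refl q = subst (Low e) (sym (zeroˡ b)) (low-0 e)
    low-* {suc d} {e} {b = b} (z , a , p , refl) q =
      subst (Low (suc d ℕ.+ e)) (solve 4 (λ z a b x → z :* b :+ x :* (a :* b) := (z :+ x :* a) :* b) refl (jz z) a b x)
        (low-+ {suc d ℕ.+ e} (low-weaken (suc d) {e} (low-scale {e} z q)) (low-x* {d ℕ.+ e} (low-* {d} {e} p q)))

    low-x^* : ∀ d {e b} → Low e b → Low (d ℕ.+ e) (x ^ d * b)
    low-x^* zero    {e} {b} q = subst (Low e) (sym (*-identityˡ b)) q
    low-x^* (suc d) {e} {b} q = subst (Low (suc d ℕ.+ e)) (sym (*-assoc x (x ^ d) b)) (low-x* {d ℕ.+ e} (low-x^* d {e} q))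

    ^-+ : ∀ d e → x ^ (d ℕ.+ e) ≡ x ^ d * x ^ e
    ^-+ zero    e = sym (*-identityˡ (x ^ e))
    ^-+ (suc d) e = trans (cong (x *_) (^-+ d e)) (sym (*-assoc x (x ^ d) (x ^ e)))

    monic-* : ∀ {d e a b} → Monic d a → Monic e b → Monic (d ℕ.+ e) (a * b)
    monic-* {d} {e} (l , p , refl) (m , q , refl) = x ^ d * m + x ^ e * l + l * m ,
      low-+ {d ℕ.+ e} (low-+ {d ℕ.+ e} (low-x^* d {e} q) (subst (λ k → Low k (x ^ e * l)) (ℕP.+-comm e d) (low-x^* e {d} p))) (low-* {d} {e} p q) ,
      trans (solve 4 (λ X Y l m → (X :+ l) :* (Y :+ m) := X :* Y :+ (X :* m :+ Y :* l :+ l :* m)) refl (x ^ d) (x ^ e) l m)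
        (cong (_+ (x ^ d * m + x ^ e * l + l * m)) (sym (^-+ d e)))

    monic-low : ∀ {d a b} → Monic d a → Low d b → Monic d (a - b)
    monic-low {d} {b = b} (l , p , refl) q = l - b , IsZModule.sub (low-module d) p q , +-assoc (x ^ d) l (- b)

    monic-*-low : ∀ {d e a b} → Monic d a → Low e b → Low (d ℕ.+ e) (a * b)
    monic-*-low {d} {e} {b = b} (l , p , refl) q = subst (Low (d ℕ.+ e)) (sym (distribʳ b (x ^ d) l))
      (low-+ {d ℕ.+ e} (low-x^* d {e} q) (low-* {d} {e} p q))

    low⇒ev : ∀ d {y} → Low d y → ∃ λ g → length g ≡ d × y ≡ ev g x
    low⇒ev zero    refl = [] , refl , refl
    low⇒ev (suc d) (z , y , p , refl) with low⇒ev d p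
    ... | g , refl , refl = z ∷ g , refl , refl

    ev⇒low : ∀ g → Low (length g) (ev g x)
    ev⇒low []      = refl
    ev⇒low (z ∷ g) = z , ev g x , ev⇒low g , refl

    ev-∷ʳ-1 : ∀ g → ev (g ∷ʳ 1ℤ) x ≡ x ^ length g + ev g x
    ev-∷ʳ-1 []      = cong₂ _+_ jz-1 (zeroʳ x)
    ev-∷ʳ-1 (z ∷ g) = trans (cong (λ w → jz z + x * w) (ev-∷ʳ-1 g))
      (solve 4 (λ z x X e → z :+ x :* (X :+ e) := x :* X :+ (z :+ x :* e)) refl (jz z) x (x ^ length g) (ev g x))

    monic-0⇒integral : ∀ {d} → Monic d 0# → Integral x
    monic-0⇒integral {d} (l , p , e) with low⇒ev d p
    ... | g , refl , refl = g , trans (ev-∷ʳ-1 g) (sym e)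

    low-top : ∀ {d y} → Low (suc d) y → ∃ λ z → ∃ λ l → Low d l × y ≡ jz z * x ^ d + l
    low-top {zero}  (z , _ , refl , refl) = z , 0# , refl ,
      trans (cong (jz z +_) (zeroʳ x)) (cong (_+ 0#) (sym (trans (*-comm (jz z) 1#) (*-identityˡ (jz z)))))
    low-top {suc d} (c , y , p , refl) with low-top {d} p
    ... | z , l , q , refl = z , jz c + x * l , (c , l , q , refl) ,
      solve 5 (λ c x z X l → c :+ x :* (z :* X :+ l) := z :* (x :* X) :+ (c :+ x :* l)) refl (jz c) x (jz z) (x ^ d) l

    -- The elements w, wx, ..., wx^(d-1) have a common denominator. The weight `w` absorbs the
    -- factor x that is split off in each recursive step.
    low-bounded : ∀ d w → ∃ λ D → NonZero D × (∀ {y} → Low d y → Zθ (jₙ D * (w * y)))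
    low-bounded zero    w = 1 , _ , λ { refl → subst Zθ (sym (trans (cong (jₙ 1 *_) (zeroʳ w)) (zeroʳ (jₙ 1)))) Zθ-0 }
    low-bounded (suc d) w with denominator w | low-bounded d (w * x)
    ... | A , A≢0 , p | B , B≢0 , h = A ℕ.* B , ℕP.m*n≢0 A B {{A≢0}} {{B≢0}} , λ { (z , y , l , refl) → subst Zθ
      (sym (trans (cong (_* (w * (jz z + x * y))) (jₙ-* A B))
        (solve 6 (λ A B w z x y → (A :* B) :* (w :* (z :+ x :* y)) := z :* (B :* (A :* w)) :+ A :* (B :* ((w :* x) :* y))) refl (jₙ A) (jₙ B) w (jz z) x y)))
      (Zθ-+ (Zθ-scale z (Zθ-scale (Z.+ B) p)) (Zθ-scale (Z.+ A) (h l))) }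

  -- Bounded denominators: equivalent to integrality up to a double negation, and stable under
  -- the ring operations by inspection.
  O : K → Set
  O x = ∃ λ D → NonZero D × (∀ k → Zθ (jₙ D * x ^ k))

  -- The monic relation puts every power of x into the span of 1, x, ..., x^(d-1), whose elements
  -- have a common denominator.
  integral⇒O : ∀ {x} → Integral x → O x
  integral⇒O {x} (g , e) with PolynomialsIn.low-bounded x (length g) 1#
  ... | D , D≢0 , h = D , D≢0 , λ k → subst (λ w → Zθ (jₙ D * w)) (*-identityˡ (x ^ k)) (h (low-^ k))
    where
    open PolynomialsIn x
    d = length g
    x^d : Low d (x ^ d)
    x^d = subst (Low d) (sym (+-inverseˡ-unique (x ^ d) (ev g x) (trans (sym (ev-∷ʳ-1 g)) e))) (IsZModule.neg (low-module d) (ev⇒low g))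
    -- For d = 0 the relation reads 1 = 0, which is just what `Low 0 1#` asks.
    low-1 : ∀ d → Low d (x ^ d) → Low d 1#
    low-1 zero    p = p
    low-1 (suc d) p = subst (Low (suc d)) jz-1 (low-jz {d} 1ℤ)
    low-^ : ∀ k → Low d (x ^ k)
    low-^ zero    = low-1 d x^d
    low-^ (suc k) with low-top {d} (low-x* {d} (low-^ k))
    ... | z , l , p , q = subst (Low d) (sym q) (low-+ {d} (low-scale {d} z x^d) p)

  Zθ⇒O : ∀ {x} → Zθ x → O x
  Zθ⇒O p = 1 , _ , λ k → Zθ-* (Zθ-jz (Z.+ 1)) (Zθ-^ k p)

  private
    -- A B is a denominator of every x^k y^l. `step` says that multiplication by w turns such
    -- monomials into combinations of such monomials; so, with k and l left free, induction on n
    -- makes A B a denominator of every w^n x^k y^l.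
    O-polynomial : ∀ {x y w} → O x → O y →
      (∀ {Q : K → Set} → IsZModule Q → ∀ {v} → (∀ k l → Q (v * (x ^ k * y ^ l))) → ∀ k l → Q ((w * v) * (x ^ k * y ^ l))) → O w
    O-polynomial {x} {y} {w} (A , A≢0 , p) (B , B≢0 , q) step = A ℕ.* B , ℕP.m*n≢0 A B {{A≢0}} {{B≢0}} , λ n →
        subst (λ v → Zθ (jₙ (A ℕ.* B) * v)) (trans (cong (w ^ n *_) (*-identityˡ 1#)) (trans (*-comm (w ^ n) 1#) (*-identityˡ (w ^ n)))) (go n 0 0)
      where
      Q : K → Set
      Q v = Zθ (jₙ (A ℕ.* B) * v)
      QM : IsZModule Q
      QM = record
        { zero∈ = subst Zθ (sym (zeroʳ (jₙ (A ℕ.* B)))) Zθ-0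
        ; add = λ {a} {b} p q → subst Zθ (sym (distribˡ (jₙ (A ℕ.* B)) a b)) (Zθ-+ p q)
        ; scale = λ z {a} p → subst Zθ (solve 3 (λ z d a → z :* (d :* a) := d :* (z :* a)) refl (jz z) (jₙ (A ℕ.* B)) a) (Zθ-scale z p) }
      go : ∀ n k l → Q (w ^ n * (x ^ k * y ^ l))
      go zero k l = subst Zθ (sym (trans (cong₂ _*_ (jₙ-* A B) (*-identityˡ (x ^ k * y ^ l)))
        (solve 4 (λ A B X Y → (A :* B) :* (X :* Y) := (A :* X) :* (B :* Y)) refl (jₙ A) (jₙ B) (x ^ k) (y ^ l)))) (Zθ-* (p k) (q l))
      go (suc n) k l = step QM (go n) k l

  O-+ : ∀ {x y} → O x → O y → O (x + y)
  O-+ {x} {y} p q = O-polynomial p q λ {Q} M {v} h k l → subst Q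
    (solve 5 (λ x y v X Y → v :* ((x :* X) :* Y) :+ v :* (X :* (y :* Y)) := ((x :+ y) :* v) :* (X :* Y)) refl x y v (x ^ k) (y ^ l))
    (IsZModule.add M (h (suc k) l) (h k (suc l)))

  O-* : ∀ {x y} → O x → O y → O (x * y)
  O-* {x} {y} p q = O-polynomial p q λ {Q} M {v} h k l → subst Q
    (solve 5 (λ x y v X Y → v :* ((x :* X) :* (y :* Y)) := ((x :* y) :* v) :* (X :* Y)) refl x y v (x ^ k) (y ^ l))
    (h (suc k) (suc l))

  O-module : IsZModule O
  O-module = record { zero∈ = Zθ⇒O Zθ-0 ; add = O-+ ; scale = λ z p → O-* (Zθ⇒O (Zθ-jz z)) p }

  O-^ : ∀ {x} k → O x → O (x ^ k)
  O-^ zero    p = Zθ⇒O Zθ-1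
  O-^ (suc k) p = O-* p (O-^ k p)

  module _ {x : K} (x∈ : O x) where
    private
      D = proj₁ x∈

    -- A lattice that contains ℤ[θ] and is preserved by x and θ. It serves twice: for the
    -- integrality of x and for the integrality of traces.
    Stable : K → Set
    Stable z = ∀ k → Zθ (jₙ D * (z * x ^ k))

    stable-lattice : LatticeK powerBasis Stable
    stable-lattice = record
      { add = λ {a} {b} p q k → subst Zθ (solve 4 (λ D a b X → D :* (a :* X) :+ D :* (b :* X) := D :* ((a :+ b) :* X)) refl (jₙ D) a b (x ^ k)) (Zθ-+ (p k) (q k))
      ; scale = λ z {a} p k → subst Zθ (solve 4 (λ D a z X → z :* (D :* (a :* X)) := D :* ((z :* a) :* X)) refl (jₙ D) a (jz z) (x ^ k)) (Zθ-scale z (p k))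
      ; int = λ {a} p k → subst Zθ (solve 3 (λ D a X → a :* (D :* X) := D :* (a :* X)) refl (jₙ D) a (x ^ k)) (Zθ-* p (proj₂ (proj₂ x∈) k))
      ; D = D ; D≢0 = proj₁ (proj₂ x∈)
      ; bound = λ {a} p → subst (λ w → Zθ (jₙ D * w)) (trans (*-comm a 1#) (*-identityˡ a)) (p 0) }

    stable-x* : ∀ {z} → Stable z → Stable (x * z)
    stable-x* {z} p k = subst (λ w → Zθ (jₙ D * w)) (solve 3 (λ z x X → z :* (x :* X) := (x :* z) :* X) refl z x (x ^ k)) (p (suc k))

    stable-Zθ* : ∀ {y z} → Zθ y → Stable z → Stable (y * z)
    stable-Zθ* {y} {z} q p k = subst Zθ (solve 4 (λ y z D X → y :* (D :* (z :* X)) := D :* ((y :* z) :* X)) refl y z (jₙ D) (x ^ k)) (Zθ-* q (p k))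

  -- Cayley-Hamilton on a basis `t` of `Stable`. The matrix of x minus its coordinates annihilates
  -- `t`; elimination turns it into one monic polynomial u in x with u tᵢ = 0 for all i. As 1 is a
  -- combination of the tᵢ, u = 0, and this is the monic relation sought.
  O⇒¬¬integral : ∀ {x} → O x → ¬ ¬ Integral x
  O⇒¬¬integral {x} x∈ h = dualBasisK (stable-lattice x∈) λ B → h (from B)
    where
    open PolynomialsIn x
    from : DualBasisK powerBasis (Stable x∈) → Integral x
    from B = monic-0⇒integral {e} (subst (Monic e) u≡0 u∈)
      where
      open DualBasisK B
      p : Fin 6 → Fin 6 → K
      p i k = j (δ i k) * x - j (s k (x * t i))
      a∈ : ∀ i k → Low 1 (j (s k (x * t i)))
      a∈ i k = low-Int (s-int (stable-x* x∈ (t∈ i)) k)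
        where
        low-Int : ∀ {q} → Int q → Low 1 (j q)
        low-Int (z , e) = subst (λ q → Low 1 (j q)) (sym e) (low-jz {0} z)
      diag : ∀ i → Monic 1 (p i i)
      diag i = - j (s i (x * t i)) , IsZModule.neg (low-module 1) (a∈ i i) ,
        cong (_- j (s i (x * t i))) (trans (cong (λ w → w * x) (trans (cong j (δ-diag i)) j-1)) (*-comm 1# x))
      off : ∀ i k → i ≢ k → Low 1 (p i k)
      off i k i≢k = subst (Low 1) (sym (trans (cong (λ w → w * x - j (s k (x * t i))) (trans (cong j (δ-off i≢k)) j-0))
        (trans (cong (_- j (s k (x * t i))) (zeroˡ x)) (+-identityˡ (- j (s k (x * t i))))))) (IsZModule.neg (low-module 1) (a∈ i k))
      rel : ∀ i → sum (λ k → p i k * t k) ≡ 0#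
      rel i = trans (sum-sub (λ k → j (δ i k) * x) (λ k → j (s k (x * t i))) t)
        (trans (cong₂ _-_ (sum-δ i t) (sym (sum≡ (s-expand (x * t i))))) (-‿inverseʳ (x * t i)))
        where
        sum-sub : ∀ {n} (f g v : Fin n → K) → sum (λ k → (f k - g k) * v k) ≡ sum (λ k → f k * v k) - sum (λ k → g k * v k)
        sum-sub {zero}  f g v = sym (-‿inverseʳ 0#)
        sum-sub {suc n} f g v = trans (cong ((f zero - g zero) * v zero +_) (sum-sub (f ∘ suc) (g ∘ suc) (v ∘ suc)))
          (solve 5 (λ f g v s t → (f :- g) :* v :+ (s :- t) := (f :* v :+ s) :- (g :* v :+ t)) refl (f zero) (g zero) (v zero)
            (sum (λ k → f (suc k) * v (suc k))) (sum (λ k → g (suc k) * v (suc k))))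
        sum-0 : ∀ {n} (v : Fin n → K) → sum (λ k → j 0ℚ * x * v k) ≡ 0#
        sum-0 {zero}  v = refl
        sum-0 {suc n} v = trans (cong₂ _+_ (solve 2 (λ x v → con 0ℚ :* x :* v := con 0ℚ) refl x (v zero)) (sum-0 (v ∘ suc))) (trans (+-identityʳ (j 0ℚ)) j-0)
        sum-δ : ∀ {n} (i : Fin n) (v : Fin n → K) → sum (λ k → j (δ i k) * x * v k) ≡ x * v i
        sum-δ zero    v = trans (cong₂ _+_ (cong (λ w → w * x * v zero) j-1) (sum-0 (v ∘ suc)))
          (trans (+-identityʳ (1# * x * v zero)) (cong (_* v zero) (*-identityˡ x)))
        sum-δ (suc i) v = trans (cong₂ _+_ (solve 2 (λ x v → con 0ℚ :* x :* v := con 0ℚ) refl x (v zero)) (sum-δ i (v ∘ suc)))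
          (trans (cong (_+ x * v (suc i)) j-0) (+-identityˡ (x * v (suc i))))
      *-0 : ∀ {a y} → y ≡ 0# → a * y ≡ 0#
      *-0 {a} refl = zeroʳ a
      IsZero : K → Set
      IsZero y = y ≡ 0#
      zero-add : ∀ {x y} → IsZero x → IsZero y → IsZero (x + y)
      zero-add refl refl = +-identityˡ 0#
      zero-sub : ∀ {x y} → IsZero x → IsZero y → IsZero (x - y)
      zero-sub refl refl = -‿inverseʳ 0#
      open Elimination Monic Low IsZero zero-sub zero-add refl (λ _ → *-0) (λ _ → *-0)
        (0# , refl , sym (+-identityʳ 1#)) (λ {d} {e} → monic-* {d} {e}) (λ {d} → monic-low {d}) (λ {d} → IsZModule.sub (low-module d))
        (λ {d} {e} → monic-*-low {d} {e}) (λ {d} {e} → low-* {d} {e})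
      -- Every column has degree 1: the diagonal entries are x - a, the others integers.
      elim = eliminate 6 (λ _ → 1) p t diag off rel
      e = proj₁ elim
      u = proj₁ (proj₂ elim)
      u∈ : Monic e u
      u∈ = proj₁ (proj₂ (proj₂ elim))
      ut : ∀ i → u * t i ≡ 0#
      ut = proj₂ (proj₂ (proj₂ elim))
      u≡0 : u ≡ 0#
      u≡0 = trans (sym (trans (*-comm u 1#) (*-identityˡ u))) (trans (cong (u *_) (sum≡ (s-expand 1#)))
        (trans (*-distribˡ-sum u (λ i → j (s i 1#) * t i)) (sum-all-0 λ i →
          trans (solve 3 (λ u s t → u :* (s :* t) := s :* (u :* t)) refl u (j (s i 1#)) (t i)) (*-0 (ut i)))))
        where
        sum-all-0 : ∀ {n} {f : Fin n → K} → (∀ i → f i ≡ 0#) → sum f ≡ 0#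
        sum-all-0 {zero}  h = refl
        sum-all-0 {suc n} h = trans (cong₂ _+_ (h zero) (sum-all-0 (h ∘ suc))) (+-identityˡ 0#)

-- Traces, the different, and denominators at p.

ℚ-cancel : ∀ a b t → a ℚ.+ b ℚ.* t ℚ.+ ℚ.- (t ℚ.* b) ≡ a
ℚ-cancel a b t = ℚR.solve 3 (λ a b t → a ℚR.:+ b ℚR.:* t ℚR.:+ ℚR.:- (t ℚR.:* b) ℚR.:= a) refl a b t

-- f ≡ x⁶ − 1 modulo p², hence f′(θ) ≡ 6θ⁵; the conditions on ε make f′(θ)/p a unit modulo p.
record Congruence (S : Setting) : Set where
  open Setting S using (τ)
  field
    p      : ℕ
    p≢0    : NonZero p
    ε ε⁻¹ k : ℤ
    pε≡6   : (Z.+ p) Z.* ε ≡ Z.+ 6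
    εε⁻¹   : ε Z.* ε⁻¹ ≡ 1ℤ Z.+ (Z.+ p) Z.* k
    σ      : Fin 6 → ℤ
    τ-zero : τ zero ≡ 1ℤ Z.+ (Z.+ p) Z.* ((Z.+ p) Z.* σ zero)
    τ-suc  : ∀ i → τ (suc i) ≡ (Z.+ p) Z.* ((Z.+ p) Z.* σ (suc i))

module Local (S : Setting) (C : Congruence S) where
  open Setting S
  open Scalars powerBasis
  open Integrality S
  open Congruence C
  open Solver using (solve; _:=_; _:+_; _:*_; _:-_; :-_; con; _:^_)

  P : K
  P = jₙ p

  λ₅ : K → ℚ
  λ₅ = coef last5

  -- bᵢ is the dual basis of θⁱ for the form (x , y) ↦ λ₅ (x y); Euler: Σ bᵢ θⁱ = f′(θ).
  Dual : Fin 6 → Set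
  Dual i = ∃ λ b → (∀ z → coef i z ≡ λ₅ (b * z)) × ∃ λ l → Zθ l × b * θ ^ toℕ i ≡ θ ^ 5 + P * (P * l)

  abstract
    -- Descending recursion b₅ = 1, bᵢ = θ bᵢ₊₁ - τᵢ₊₁: these are the coefficients of f(x)/(x - θ).
    -- A step changes bᵢ θⁱ only by a multiple of p², so all six products stay congruent to θ⁵.
    dual : ∀ i → Dual i
    dual = >-weakInduction Dual top step
      where
      top : Dual last5
      top = 1# , (λ z → cong λ₅ (sym (*-identityˡ z))) , 0# , Zθ-0 ,
        trans (*-identityˡ (θ ^ 5)) (sym (trans (cong (θ ^ 5 +_) (trans (cong (P *_) (zeroʳ P)) (zeroʳ P))) (+-identityʳ (θ ^ 5))))
      step : ∀ i → Dual (suc i) → Dual (inject₁ i)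
      step i (b , euler , l , l∈ , e) = θ * b - jz (τ (suc i)) , euler′ , l - jz (σ (suc i)) * θ ^ toℕ i ,
          Zθ-sub l∈ (Zθ-scale (σ (suc i)) (Zθ-θ^ (toℕ i))) , e′
        where
        open ≡-Reasoning
        T : ℚ
        T = ι (τ (suc i))
        euler′ : ∀ z → coef (inject₁ i) z ≡ λ₅ ((θ * b - j T) * z)
        euler′ z = sym (trans (cong λ₅ (solve 4 (λ t b w z → (t :* b :- w) :* z := b :* (t :* z) :+ (:- (w :* z))) refl θ b (j T) z))
          (trans (coef-+ last5 (b * (θ * z)) (- (j T * z)))
          (trans (cong₂ ℚ._+_ (trans (sym (euler (θ * z))) (coef-θ*-suc i z)) (trans (Linear.lin-neg (coef-linear last5) (j T * z)) (cong ℚ.-_ (coef-j last5 T z))))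
            (ℚ-cancel (coef (inject₁ i) z) (λ₅ z) T))))
        e′ : (θ * b - jz (τ (suc i))) * θ ^ toℕ (inject₁ i) ≡ θ ^ 5 + P * (P * (l - jz (σ (suc i)) * θ ^ toℕ i))
        e′ = begin
          (θ * b - jz (τ (suc i))) * θ ^ toℕ (inject₁ i) ≡⟨ cong₂ (λ w n → (θ * b - w) * θ ^ n) τ≡ (toℕ-inject₁ i) ⟩
          (θ * b - P * (P * jz (σ (suc i)))) * θ ^ toℕ i ≡⟨ solve 5 (λ t b p s x → (t :* b :- p :* (p :* s)) :* x := b :* (t :* x) :- p :* (p :* (s :* x))) refl θ b P (jz (σ (suc i))) (θ ^ toℕ i) ⟩
          b * (θ * θ ^ toℕ i) - P * (P * (jz (σ (suc i)) * θ ^ toℕ i)) ≡⟨ cong (_- P * (P * (jz (σ (suc i)) * θ ^ toℕ i))) e ⟩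
          θ ^ 5 + P * (P * l) - P * (P * (jz (σ (suc i)) * θ ^ toℕ i)) ≡⟨ solve 4 (λ t p l s → t :+ p :* (p :* l) :- p :* (p :* s) := t :+ p :* (p :* (l :- s))) refl (θ ^ 5) P l (jz (σ (suc i)) * θ ^ toℕ i) ⟩
          θ ^ 5 + P * (P * (l - jz (σ (suc i)) * θ ^ toℕ i)) ∎
          where
          τ≡ : jz (τ (suc i)) ≡ P * (P * jz (σ (suc i)))
          τ≡ = trans (cong jz (τ-suc i)) (trans (jz-* (Z.+ p) _) (cong (P *_) (jz-* (Z.+ p) (σ (suc i)))))

    F : K
    F = sum (λ i → proj₁ (dual i) * θ ^ toℕ i)

    F≡ : ∃ λ l → Zθ l × F ≡ jₙ 6 * θ ^ 5 + P * (P * l)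
    F≡ = go (λ i → proj₁ (dual i) * θ ^ toℕ i) (λ i → proj₂ (proj₂ (dual i)))
      where
      go : ∀ {n} (f : Fin n → K) → (∀ i → ∃ λ l → Zθ l × f i ≡ θ ^ 5 + P * (P * l)) → ∃ λ l → Zθ l × sum f ≡ jₙ n * θ ^ 5 + P * (P * l)
      go {zero}  f h = 0# , Zθ-0 , sym (trans (cong₂ _+_ (trans (cong (_* θ ^ 5) (trans (cong j (ι≡ι₀ 0ℤ)) j-0)) (zeroˡ (θ ^ 5))) (trans (cong (P *_) (zeroʳ P)) (zeroʳ P))) (+-identityˡ 0#))
      go {suc n} f h with h zero | go (f ∘ suc) (h ∘ suc)
      ... | l , l∈ , e | m , m∈ , e′ = l + m , Zθ-+ l∈ m∈ , trans (cong₂ _+_ e e′)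
        (trans (solve 5 (λ t p l m n → (t :+ p :* (p :* l)) :+ (n :* t :+ p :* (p :* m)) := (con 1ℚ :+ n) :* t :+ p :* (p :* (l :+ m))) refl (θ ^ 5) P l m (jₙ n))
          (cong (λ w → w * θ ^ 5 + P * (P * (l + m))) (trans (cong (_+ jₙ n) (trans j-1 (sym jz-1))) (sym (jz-+ 1ℤ (Z.+ n))))))

    -- The right-hand side is the trace of multiplication by `y`, read off the diagonal in the power
    -- basis.
    λ₅-F : ∀ y → λ₅ (F * y) ≡ sumℚ (λ i → coef i (θ ^ toℕ i * y))
    λ₅-F y = trans (Linear.lin-sum (after-* (coef-linear last5) y) (λ i → proj₁ (dual i) * θ ^ toℕ i))
      (sumℚ-cong λ i → trans (cong λ₅ (*-assoc (proj₁ (dual i)) (θ ^ toℕ i) y)) (sym (proj₁ (proj₂ (dual i)) (θ ^ toℕ i * y))))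

  -- The trace of y, computed in the basis t of a lattice stable under y.
  trace-int : ∀ {M} → DualBasisK powerBasis M → ∀ y → (∀ {z} → M z → M (z * y)) → Int (λ₅ (F * y))
  trace-int {M} B y stable = subst Int (sym e) (Int-sum λ k → s-int (stable (t∈ k)) k)
    where
    open DualBasisK B
    open ≡-Reasoning
    s-linear : ∀ k → Linear (s k)
    s-linear k = record { lin-+ = s-+ k ; lin-j = s-j k }
    e : λ₅ (F * y) ≡ sumℚ (λ k → s k (t k * y))
    e = begin
      λ₅ (F * y) ≡⟨ λ₅-F y ⟩
      sumℚ (λ i → coef i (θ ^ toℕ i * y))
        ≡⟨ sumℚ-cong (λ i → Linear.lin-combination (after-* (coef-linear i) y) (s-expand (θ ^ toℕ i))) ⟩
      sumℚ (λ i → sumℚ (λ k → s k (θ ^ toℕ i) ℚ.* coef i (t k * y)))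
        ≡⟨ sumℚ-comm (λ i k → s k (θ ^ toℕ i) ℚ.* coef i (t k * y)) ⟩
      sumℚ (λ k → sumℚ (λ i → s k (θ ^ toℕ i) ℚ.* coef i (t k * y)))
        ≡⟨ sumℚ-cong (λ k → trans (sumℚ-cong (λ i → ℚP.*-comm (s k (θ ^ toℕ i)) (coef i (t k * y)))) (sym (Linear.lin-combination (s-linear k) (expand (t k * y))))) ⟩
      sumℚ (λ k → s k (t k * y)) ∎

  -- The form (x , y) ↦ λ₅ (x y) is unimodular on ℤ[θ]: by `coef-θ*-suc`, coordinate i of w is
  -- coordinate i + 1 of θ w minus an integer multiple of λ₅ w, so descending induction recovers
  -- every coordinate.
  unimodular : ∀ z → (∀ k → Int (λ₅ (θ ^ k * z))) → Zθ z
  unimodular z h = zθ λ i → subst Int (cong (coef i) (*-identityˡ z)) (all i 0)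
    where
    all : ∀ i k → Int (coef i (θ ^ k * z))
    all = >-weakInduction (λ i → ∀ k → Int (coef i (θ ^ k * z))) h λ i rec k →
      subst Int (trans (cong (ℚ._+ ℚ.- (ι (τ (suc i)) ℚ.* λ₅ (θ ^ k * z))) (trans (cong (coef (suc i)) (*-assoc θ (θ ^ k) z)) (coef-θ*-suc i (θ ^ k * z))))
              (ℚ-cancel (coef (inject₁ i) (θ ^ k * z)) (λ₅ (θ ^ k * z)) (ι (τ (suc i)))))
          (Int-+ (rec (suc k)) (Int-neg (Int-* (Int-ι (τ (suc i))) (h k))))

  -- Both x and θ preserve the lattice `Stable x∈`, so every x θ^k has an integral trace. A basis of
  -- that lattice exists only up to double negation, which the decidability of `Int` removes.
  F*O⊆Zθ : ∀ {x} → O x → Zθ (F * x)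
  F*O⊆Zθ {x} x∈ = unimodular (F * x) λ k → subst Int (cong λ₅ (solve 3 (λ F x t → F :* (x :* t) := t :* (F :* x)) refl F x (θ ^ k)))
    (decidable-stable (Int? _) λ h → dualBasisK (stable-lattice x∈) λ B →
      h (trace-int B (x * θ ^ k) λ {z} z∈ → subst (Stable x∈) (solve 3 (λ z x t → x :* (t :* z) := z :* (x :* t)) refl z x (θ ^ k))
        (stable-x* x∈ (stable-Zθ* x∈ (Zθ-θ^ k) z∈))))

  coef-ext : ∀ {x y} → (∀ i → coef i x ≡ coef i y) → x ≡ y
  coef-ext {x} {y} h = trans (sum≡ (expand x)) (trans (sum-cong-≗ λ i → cong (λ q → j q * θ ^ toℕ i) (h i)) (sym (sum≡ (expand y))))

  coef-θ⁶ : ∀ i → coef i (θ ^ 6) ≡ ι (τ i)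
  coef-θ⁶ zero    = trans (coef-θ*-zero (θ ^ 5)) (trans (cong (ℚ._* ι (τ zero)) (coef-θ^ last5 last5)) (ℚP.*-identityˡ (ι (τ zero))))
  coef-θ⁶ (suc i) = trans (coef-θ*-suc i (θ ^ 5)) (trans (cong₂ ℚ._+_ (trans (coef-θ^ (inject₁ i) last5) (low i)) (trans (cong (ℚ._* ι (τ (suc i))) (coef-θ^ last5 last5)) (ℚP.*-identityˡ (ι (τ (suc i)))))) (ℚP.+-identityˡ (ι (τ (suc i)))))
    where
    low : (i : Fin 5) → δ (inject₁ i) last5 ≡ 0ℚ
    low 0F = refl
    low 1F = refl
    low 2F = refl
    low 3F = refl
    low 4F = refl

  abstract
    θ⁶≡ : ∃ λ s → Zθ s × θ ^ 6 ≡ 1# + P * (P * s)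
    θ⁶≡ = s , s∈ , coef-ext e
      where
      s : K
      s = sum (λ i → jz (σ i) * θ ^ toℕ i)
      coef-s : ∀ i → coef i s ≡ ι (σ i)
      coef-s i = trans (Linear.lin-sum (coef-linear i) (λ k → jz (σ k) * θ ^ toℕ k))
        (trans (sumℚ-cong (λ k → trans (coef-j i (ι (σ k)) (θ ^ toℕ k)) (cong (ι (σ k) ℚ.*_) (coef-θ^ i k)))) (sumℚ-δ (λ k → ι (σ k)) i))
      s∈ : Zθ s
      s∈ = zθ λ i → σ i , coef-s i
      ppσ : ∀ i → coef i (P * (P * s)) ≡ ι ((Z.+ p) Z.* ((Z.+ p) Z.* σ i))
      ppσ i = trans (coef-j i (ιₙ p) (P * s)) (trans (cong (ιₙ p ℚ.*_) (trans (coef-j i (ιₙ p) s) (trans (cong (ιₙ p ℚ.*_) (coef-s i)) (sym (ι-* (Z.+ p) (σ i)))))) (sym (ι-* (Z.+ p) _)))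
      e : ∀ i → coef i (θ ^ 6) ≡ coef i (1# + P * (P * s))
      e i = trans (coef-θ⁶ i) (sym (trans (coef-+ i 1# (P * (P * s))) (trans (cong₂ ℚ._+_ (coef-θ^ i 0F) (ppσ i)) (rhs i))))
        where
        rhs : ∀ i → δ i (zero {5}) ℚ.+ ι ((Z.+ p) Z.* ((Z.+ p) Z.* σ i)) ≡ ι (τ i)
        rhs zero    = trans (cong (ℚ._+ ι ((Z.+ p) Z.* ((Z.+ p) Z.* σ zero))) (sym (ι≡ι₀ 1ℤ))) (trans (sym (ι-+ 1ℤ _)) (cong ι (sym τ-zero)))
        rhs (suc i) = trans (ℚP.+-identityˡ (ι ((Z.+ p) Z.* ((Z.+ p) Z.* σ (suc i))))) (cong ι (sym (τ-suc i)))

  -- Modulo p the element f′(θ)/p is (6/p) θ⁵; θ inverts θ⁵ because θ⁶ ≡ 1, and `ε⁻¹` inverts 6/p.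
  G-exists : ∃ λ z → Zθ z × F * (θ * jz ε⁻¹) ≡ P * (1# + P * z)
  G-exists = jz k + jₙ 6 * (jz ε⁻¹ * s) + l * (θ * jz ε⁻¹) ,
      Zθ-+ {jz k + jₙ 6 * (jz ε⁻¹ * s)} {l * (θ * jz ε⁻¹)} (Zθ-+ {jz k} {jₙ 6 * (jz ε⁻¹ * s)} (Zθ-jz k) (Zθ-scale (Z.+ 6) {jz ε⁻¹ * s} (Zθ-scale ε⁻¹ {s} s∈)))
        (Zθ-* {l} {θ * jz ε⁻¹} l∈ (Zθ-θ* {jz ε⁻¹} (Zθ-jz ε⁻¹))) , e
    where
    l = proj₁ F≡
    l∈ : Zθ l
    l∈ = proj₁ (proj₂ F≡)
    F≡′ : F ≡ jₙ 6 * θ ^ 5 + P * (P * l)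
    F≡′ = proj₂ (proj₂ F≡)
    s = proj₁ θ⁶≡
    s∈ : Zθ s
    s∈ = proj₁ (proj₂ θ⁶≡)
    θ⁶ : θ ^ 6 ≡ 1# + P * (P * s)
    θ⁶ = proj₂ (proj₂ θ⁶≡)
    open ≡-Reasoning
    E = jz ε⁻¹
    6E : jₙ 6 * E ≡ P * (1# + P * jz k)
    6E = begin
      jₙ 6 * E                  ≡⟨ cong (λ w → jz w * E) (sym pε≡6) ⟩
      jz ((Z.+ p) Z.* ε) * E    ≡⟨ cong (_* E) (jz-* (Z.+ p) ε) ⟩
      P * jz ε * E              ≡⟨ *-assoc P (jz ε) E ⟩
      P * (jz ε * E)            ≡⟨ cong (P *_) (sym (jz-* ε ε⁻¹)) ⟩
      P * jz (ε Z.* ε⁻¹)        ≡⟨ cong (λ w → P * jz w) εε⁻¹ ⟩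
      P * jz (1ℤ Z.+ (Z.+ p) Z.* k) ≡⟨ cong (P *_) (trans (jz-+ 1ℤ _) (cong₂ _+_ jz-1 (jz-* (Z.+ p) k))) ⟩
      P * (1# + P * jz k) ∎
    e : F * (θ * E) ≡ P * (1# + P * (jz k + jₙ 6 * (E * s) + l * (θ * E)))
    e = begin
      F * (θ * E) ≡⟨ cong (_* (θ * E)) F≡′ ⟩
      (jₙ 6 * θ ^ 5 + P * (P * l)) * (θ * E)
        ≡⟨ solve 6 (λ c T p l t E → (c :* T :+ p :* (p :* l)) :* (t :* E) := (c :* E) :* (t :* T) :+ p :* (p :* (l :* (t :* E)))) refl (jₙ 6) (θ ^ 5) P l θ E ⟩
      jₙ 6 * E * θ ^ 6 + P * (P * (l * (θ * E)))
        ≡⟨ cong (λ w → jₙ 6 * E * w + P * (P * (l * (θ * E)))) θ⁶ ⟩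
      jₙ 6 * E * (1# + P * (P * s)) + P * (P * (l * (θ * E)))
        ≡⟨ solve 6 (λ c E p s w o → c :* E :* (o :+ p :* (p :* s)) :+ p :* (p :* w) := c :* E :* o :+ p :* (p :* (c :* (E :* s) :+ w))) refl (jₙ 6) E P s (l * (θ * E)) 1# ⟩
      jₙ 6 * E * 1# + P * (P * (jₙ 6 * (E * s) + l * (θ * E)))
        ≡⟨ cong (_+ P * (P * (jₙ 6 * (E * s) + l * (θ * E)))) (trans (*-comm (jₙ 6 * E) 1#) (trans (*-identityˡ (jₙ 6 * E)) 6E)) ⟩
      P * (1# + P * jz k) + P * (P * (jₙ 6 * (E * s) + l * (θ * E)))
        ≡⟨ solve 5 (λ p o k a b → p :* (o :+ p :* k) :+ p :* (p :* (a :+ b)) := p :* (o :+ p :* (k :+ a :+ b))) refl P 1# (jz k) (jₙ 6 * (E * s)) (l * (θ * E)) ⟩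
      P * (1# + P * (jz k + jₙ 6 * (E * s) + l * (θ * E))) ∎

  -- The coefficients for `Elimination` over ℤ modulo p: pivots congruent to 1, other entries
  -- divisible by p.
  Unit Mult : ℕ → K → Set
  Unit _ a = ∃ λ n → a ≡ 1# + P * jz n
  Mult _ a = ∃ λ n → a ≡ P * jz n

  module ElimModP (N : K → Set) (N-module : IsZModule N) where
    private
      open IsZModule N-module
      P-N : ∀ n {x} → N x → N (P * jz n * x)
      P-N n {x} q = subst N (sym (*-assoc P (jz n) x)) (scale (Z.+ p) (scale n q))
      U-N : ∀ {d a x} → Unit d a → N x → N (a * x)
      U-N {x = x} (n , refl) q = subst N (sym (trans (distribʳ x 1# (P * jz n)) (cong (_+ P * jz n * x) (*-identityˡ x)))) (add q (P-N n q))
      J-N : ∀ {d a x} → Mult d a → N x → N (a * x)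
      J-N (n , refl) q = P-N n q
      1+0 : 1# ≡ 1# + P * jz 0ℤ
      1+0 = sym (trans (cong (λ w → 1# + P * w) (trans (cong j (ι≡ι₀ 0ℤ)) j-0)) (trans (cong (1# +_) (zeroʳ P)) (+-identityʳ 1#)))
      U-* : ∀ {d e a b} → Unit d a → Unit e b → Unit (d ℕ.+ e) (a * b)
      U-* (n , refl) (m , refl) = n Z.+ m Z.+ ((Z.+ p) Z.* n) Z.* m ,
        trans (cong (λ o → (o + P * jz n) * (o + P * jz m)) (sym j-1)) (trans
         (solve 3 (λ p n m → (con 1ℚ :+ p :* n) :* (con 1ℚ :+ p :* m) := con 1ℚ :+ p :* (n :+ m :+ (p :* n) :* m)) refl P (jz n) (jz m))
         (cong₂ (λ o w → o + P * w) j-1 (sym (trans (jz-+ (n Z.+ m) _) (cong₂ _+_ (jz-+ n m) (trans (jz-* ((Z.+ p) Z.* n) m) (cong (_* jz m) (jz-* (Z.+ p) n))))))))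
      sub≡ : ∀ n m → jz (n Z.+ Z.- m) ≡ jz n - jz m
      sub≡ n m = trans (jz-+ n (Z.- m)) (cong (jz n +_) (jz-neg m))
      U-J : ∀ {d a b} → Unit d a → Mult d b → Unit d (a - b)
      U-J (n , refl) (m , refl) = n Z.+ Z.- m , trans (solve 4 (λ o p n m → (o :+ p :* n) :- p :* m := o :+ p :* (n :- m)) refl 1# P (jz n) (jz m)) (cong (λ w → 1# + P * w) (sym (sub≡ n m)))
      J-J : ∀ {d a b} → Mult d a → Mult d b → Mult d (a - b)
      J-J (n , refl) (m , refl) = n Z.+ Z.- m , trans (solve 3 (λ p n m → p :* n :- p :* m := p :* (n :- m)) refl P (jz n) (jz m)) (cong (P *_) (sym (sub≡ n m)))
      JJ-* : ∀ {d e a b} → Mult d a → Mult e b → Mult (d ℕ.+ e) (a * b)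
      JJ-* (n , refl) (m , refl) = n Z.* ((Z.+ p) Z.* m) , trans (*-assoc P (jz n) (P * jz m)) (cong (P *_) (sym (trans (jz-* n _) (cong (jz n *_) (jz-* (Z.+ p) m)))))
      UJ-* : ∀ {d e a b} → Unit d a → Mult e b → Mult (d ℕ.+ e) (a * b)
      UJ-* (n , refl) (m , refl) = m Z.+ n Z.* ((Z.+ p) Z.* m) , trans (distribʳ (P * jz m) 1# (P * jz n))
        (trans (cong₂ _+_ (*-identityˡ (P * jz m)) (*-assoc P (jz n) (P * jz m))) (trans (sym (distribˡ P (jz m) (jz n * (P * jz m))))
          (cong (P *_) (sym (trans (jz-+ m _) (cong (jz m +_) (trans (jz-* n _) (cong (jz n *_) (jz-* (Z.+ p) m)))))))))
    open Elimination Unit Mult N sub add zero∈ (λ {d} → U-N {d}) (λ {d} → J-N {d}) (0ℤ , 1+0)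
      (λ {d} {e} → U-* {d} {e}) (λ {d} → U-J {d}) (λ {d} → J-J {d}) (λ {d} {e} → UJ-* {d} {e}) (λ {d} {e} → JJ-* {d} {e})

    -- Nakayama: if every vᵢ is congruent to an element of N modulo the p-multiples of the span of v.
    nakayama : ∀ n (v : Fin n → K) (a : Fin n → Fin n → ℤ) → (∀ i → N (v i + P * sum (λ k → jz (a i k) * v k))) →
      ∃ λ m → ∀ i → N (jz (1ℤ Z.+ (Z.+ p) Z.* m) * v i)
    nakayama n v a rel with eliminate n (λ _ → 0) (λ i k → j (δ i k) + P * jz (a i k)) v
      (λ i → a i i , cong (_+ P * jz (a i i)) (trans (cong j (δ-diag i)) j-1))
      (λ i k i≢k → a i k , trans (cong (_+ P * jz (a i k)) (trans (cong j (δ-off i≢k)) j-0)) (+-identityˡ _))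
      (λ i → subst N (sym (sumδ i (a i) v)) (rel i))
      where
      sum0 : ∀ {n} (a : Fin n → ℤ) (v : Fin n → K) → sum (λ k → (j 0ℚ + P * jz (a k)) * v k) ≡ P * sum (λ k → jz (a k) * v k)
      sum0 {zero}  a v = sym (zeroʳ P)
      sum0 {suc n} a v = trans (cong ((j 0ℚ + P * jz (a zero)) * v zero +_) (sum0 (a ∘ suc) (v ∘ suc)))
        (solve 4 (λ p a v s → (con 0ℚ :+ p :* a) :* v :+ p :* s := p :* (a :* v :+ s)) refl P (jz (a zero)) (v zero) (sum (λ k → jz (a (suc k)) * v (suc k))))
      sumδ : ∀ {n} (i : Fin n) (a : Fin n → ℤ) (v : Fin n → K) → sum (λ k → (j (δ i k) + P * jz (a k)) * v k) ≡ v i + P * sum (λ k → jz (a k) * v k)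
      sumδ zero a v = trans (cong ((j 1ℚ + P * jz (a zero)) * v zero +_) (sum0 (a ∘ suc) (v ∘ suc)))
        (trans (solve 4 (λ p a v s → (con 1ℚ :+ p :* a) :* v :+ p :* s := con 1ℚ :* v :+ p :* (a :* v :+ s)) refl P (jz (a zero)) (v zero) (sum (λ k → jz (a (suc k)) * v (suc k))))
          (cong (_+ P * (jz (a zero) * v zero + sum (λ k → jz (a (suc k)) * v (suc k)))) (trans (cong (_* v zero) j-1) (*-identityˡ (v zero)))))
      sumδ (suc i) a v = trans (cong ((j 0ℚ + P * jz (a zero)) * v zero +_) (sumδ i (a ∘ suc) (v ∘ suc)))
        (solve 5 (λ p a v w s → (con 0ℚ :+ p :* a) :* v :+ (w :+ p :* s) := w :+ p :* (a :* v :+ s)) refl P (jz (a zero)) (v zero) (v (suc i)) (sum (λ k → jz (a (suc k)) * v (suc k))))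
    ... | _ , _ , (m , refl) , h = m , λ i → subst N (cong (λ w → w * v i) (sym (trans (jz-+ 1ℤ _) (cong₂ _+_ jz-1 (jz-* (Z.+ p) m))))) (h i)

  abstract
    -- Let G = 1 + p z be as in `G-exists`. Modulo G ℤ[θ] every θⁱ equals -p z θⁱ, so Nakayama
    -- yields an integer u = 1 + p m with u = G t and t in ℤ[θ]. Then p u x = θ ε⁻¹ t · f′(θ) x lies
    -- in ℤ[θ].
    local-denominator : ∃ λ m → ∀ {x} → O x → Zθ (P * (jz (1ℤ Z.+ (Z.+ p) Z.* m) * x))
    local-denominator = m , λ {x} x∈ → subst Zθ (conclude x) (Zθ-* (Zθ-* (Zθ-θ* (Zθ-jz ε⁻¹)) t∈) (F*O⊆Zθ x∈))
      where
      open ≡-Reasoning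
      z : K
      z = proj₁ G-exists
      z∈ : Zθ z
      z∈ = proj₁ (proj₂ G-exists)
      G : K
      G = 1# + P * z
      FθE : F * (θ * jz ε⁻¹) ≡ P * G
      FθE = proj₂ (proj₂ G-exists)
      N : K → Set
      N x = ∃ λ t → Zθ t × x ≡ G * t
      N-module : IsZModule N
      N-module = record
        { zero∈ = 0# , Zθ-0 , sym (zeroʳ G)
        ; add = λ { (a , a∈ , refl) (b , b∈ , refl) → a + b , Zθ-+ a∈ b∈ , sym (distribˡ G a b) }
        ; scale = λ { n (a , a∈ , refl) → jz n * a , Zθ-scale n a∈ , solve 3 (λ n G a → n :* (G :* a) := G :* (n :* a)) refl (jz n) G a } }
      open ElimModP N N-module
      a : Fin 6 → Fin 6 → ℤ
      a i k = proj₁ (coef-int (Zθ-* z∈ (Zθ-θ^ (toℕ i))) k)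
      rel : ∀ i → N (θ ^ toℕ i + P * sum (λ k → jz (a i k) * θ ^ toℕ k))
      rel i = θ ^ toℕ i , Zθ-θ^ (toℕ i) , (begin
        θ ^ toℕ i + P * sum (λ k → jz (a i k) * θ ^ toℕ k)
          ≡⟨ cong (λ w → θ ^ toℕ i + P * w) (trans (sum-cong-≗ λ k → cong (λ q → j q * θ ^ toℕ k) (sym (proj₂ (coef-int (Zθ-* z∈ (Zθ-θ^ (toℕ i))) k)))) (sym (sum≡ (expand (z * θ ^ toℕ i))))) ⟩
        θ ^ toℕ i + P * (z * θ ^ toℕ i) ≡⟨ cong₂ _+_ (sym (*-identityˡ (θ ^ toℕ i))) (sym (*-assoc P z (θ ^ toℕ i))) ⟩
        1# * θ ^ toℕ i + P * z * θ ^ toℕ i ≡⟨ sym (distribʳ (θ ^ toℕ i) 1# (P * z)) ⟩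
        G * θ ^ toℕ i ∎)
      nak : ∃ λ m → ∀ (i : Fin 6) → N (jz (1ℤ Z.+ (Z.+ p) Z.* m) * θ ^ toℕ i)
      nak = nakayama 6 (λ i → θ ^ toℕ i) a rel
      m : ℤ
      m = proj₁ nak
      t : K
      t = proj₁ (proj₂ nak 0F)
      t∈ : Zθ t
      t∈ = proj₁ (proj₂ (proj₂ nak 0F))
      U : K
      U = jz (1ℤ Z.+ (Z.+ p) Z.* m)
      U≡Gt : U ≡ G * t
      U≡Gt = trans (sym (trans (*-comm U 1#) (*-identityˡ U))) (proj₂ (proj₂ (proj₂ nak 0F)))
      conclude : ∀ x → θ * jz ε⁻¹ * t * (F * x) ≡ P * (U * x)
      conclude x = begin
        θ * jz ε⁻¹ * t * (F * x) ≡⟨ solve 5 (λ t E s F x → t :* E :* s :* (F :* x) := F :* (t :* E) :* (s :* x)) refl θ (jz ε⁻¹) t F x ⟩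
        F * (θ * jz ε⁻¹) * (t * x) ≡⟨ cong (_* (t * x)) FθE ⟩
        P * G * (t * x) ≡⟨ solve 4 (λ P G t x → P :* G :* (t :* x) := P :* ((G :* t) :* x)) refl P G t x ⟩
        P * (G * t * x) ≡⟨ cong (λ w → P * (w * x)) (sym U≡Gt) ⟩
        P * (U * x) ∎

-- Functionals modulo p and the counting of fibres.

¬¬-Fin : ∀ {n} {A : Fin n → Set} → (∀ i → ¬ ¬ A i) → ¬ ¬ (∀ i → A i)
¬¬-Fin {zero}  h k = k λ ()
¬¬-Fin {suc n} h k = h zero λ a → ¬¬-Fin (h ∘ suc) λ f → k λ { zero → a ; (suc i) → f i }

funToFin-cong : ∀ {m n} {g h : Fin m → Fin n} → g ≗ h → funToFin g ≡ funToFin h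
funToFin-cong {zero}  e = refl
funToFin-cong {suc m} e = cong₂ Fin.combine (e zero) (funToFin-cong (e ∘ suc))

dot : ∀ {r} → (Fin r → ℤ) → (Fin r → ℤ) → ℤ
dot f g = sumℤ (λ i → f i Z.* g i)

module _ where
  open ℤR

  dot-sub : ∀ {r} c (f g h : Fin r → ℤ) → dot (λ i → f i Z.- c Z.* g i) h ≡ dot f h Z.- c Z.* dot g h
  dot-sub {zero}  c f g h = solve 1 (λ c → con 0ℤ := con 0ℤ :- c :* con 0ℤ) refl c
  dot-sub {suc r} c f g h = trans (cong (λ z → (f zero Z.- c Z.* g zero) Z.* h zero Z.+ z) (dot-sub c (f ∘ suc) (g ∘ suc) (h ∘ suc)))
    (solve 6 (λ c f g h s t → (f :- c :* g) :* h :+ (s :- c :* t) := (f :* h :+ s) :- c :* (g :* h :+ t)) refl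
      c (f zero) (g zero) (h zero) (dot (f ∘ suc) (h ∘ suc)) (dot (g ∘ suc) (h ∘ suc)))

  dot-+ : ∀ {r} c (f g h : Fin r → ℤ) → dot f (λ i → g i Z.+ c Z.* h i) ≡ dot f g Z.+ c Z.* dot f h
  dot-+ {zero}  c f g h = solve 1 (λ c → con 0ℤ := con 0ℤ :+ c :* con 0ℤ) refl c
  dot-+ {suc r} c f g h = trans (cong (λ z → f zero Z.* (g zero Z.+ c Z.* h zero) Z.+ z) (dot-+ c (f ∘ suc) (g ∘ suc) (h ∘ suc)))
    (solve 6 (λ c f g h s t → f :* (g :+ c :* h) :+ (s :+ c :* t) := (f :* g :+ s) :+ c :* (f :* h :+ t)) refl
      c (f zero) (g zero) (h zero) (dot (f ∘ suc) (g ∘ suc)) (dot (f ∘ suc) (h ∘ suc)))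

kronecker : ∀ {n} → Fin n → Fin n → ℤ
kronecker zero    zero    = 1ℤ
kronecker zero    (suc j) = 0ℤ
kronecker (suc i) zero    = 0ℤ
kronecker (suc i) (suc j) = kronecker i j

dot-unit : ∀ {r} (f : Fin r → ℤ) c i → dot f (λ k → c Z.* kronecker i k) ≡ f i Z.* c
dot-unit {suc r} f c zero = trans (cong₂ Z._+_ (cong (f zero Z.*_) (ℤP.*-identityʳ c)) (zeros (f ∘ suc))) (ℤP.+-identityʳ _)
  where
  zeros : ∀ {r} (f : Fin r → ℤ) → dot f (λ k → c Z.* 0ℤ) ≡ 0ℤ
  zeros {zero}  f = refl
  zeros {suc r} f = trans (cong₂ Z._+_ (trans (cong (f zero Z.*_) (ℤP.*-zeroʳ c)) (ℤP.*-zeroʳ (f zero))) (zeros (f ∘ suc))) refl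
dot-unit {suc r} f c (suc i) = trans (cong₂ Z._+_ (trans (cong (f zero Z.*_) (ℤP.*-zeroʳ c)) (ℤP.*-zeroʳ (f zero))) (dot-unit (f ∘ suc) c i)) (ℤP.+-identityˡ _)

module Mod (p : ℕ) .{{_ : NonZero p}} where
  infix 4 _≡ₚ_
  _≡ₚ_ : ℤ → ℤ → Set
  x ≡ₚ y = Z.+ p ∣ℤ (x Z.- y)

  private
    small-≤ : ∀ {a b} → a ℕ.≤ b → b ℕ.< p → Z.+ a ≡ₚ Z.+ b → a ≡ b
    small-≤ {a} {b} a≤b b<p h with b ℕ.∸ a in e
    ... | zero  = ℕP.≤-antisym a≤b (ℕP.m∸n≡0⇒m≤n e)
    ... | suc c = contradiction (subst (p ℕD.∣_) (trans (cong Z.∣_∣ (ℤP.m-n≡m⊖n a b)) (trans (ℤP.∣⊖∣-≤ a≤b) e)) (ℤD.∣⇒∣ᵤ h))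
      (ℕD.>⇒∤ (ℕP.≤-<-trans (subst (ℕ._≤ b) e (ℕP.m∸n≤m b a)) b<p))

  ≡ₚ-sym : ∀ {x y} → x ≡ₚ y → y ≡ₚ x
  ≡ₚ-sym {x} {y} h = subst (Z.+ p ∣ℤ_) (solve 2 (λ x y → :- (x :- y) := y :- x) refl x y) (ℤD.∣m⇒∣-m h)
    where open ℤR

  small-≡ : ∀ {a b} → a ℕ.< p → b ℕ.< p → Z.+ a ≡ₚ Z.+ b → a ≡ b
  small-≡ {a} {b} a<p b<p h with ℕP.≤-total a b
  ... | inj₁ a≤b = small-≤ a≤b b<p h
  ... | inj₂ b≤a = sym (small-≤ b≤a a<p (≡ₚ-sym {Z.+ a} {Z.+ b} h))

  residue : ℤ → Fin p
  residue x = fromℕ< (ℤDM.n%ℕd<d x p)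

  residue-split : ∀ x → x ≡ Z.+ toℕ (residue x) Z.+ (x ℤDM./ℕ p) Z.* Z.+ p
  residue-split x = trans (ℤDM.a≡a%ℕn+[a/ℕn]*n x p) (cong (λ r → Z.+ r Z.+ (x ℤDM./ℕ p) Z.* Z.+ p) (sym (FinP.toℕ-fromℕ< (ℤDM.n%ℕd<d x p))))

  open ℤR

  ≡ₚ-residue : ∀ x → x ≡ₚ Z.+ toℕ (residue x)
  ≡ₚ-residue x = divides (x ℤDM./ℕ p) (trans (cong (Z._- Z.+ toℕ (residue x)) (residue-split x))
    (solve 2 (λ r q → r :+ q :- r := q) refl (Z.+ toℕ (residue x)) ((x ℤDM./ℕ p) Z.* Z.+ p)))

  ≡ₚ-trans : ∀ {x y z} → x ≡ₚ y → y ≡ₚ z → x ≡ₚ z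
  ≡ₚ-trans {x} {y} {z} h k = subst (Z.+ p ∣ℤ_) (solve 3 (λ x y z → (x :- y) :+ (y :- z) := x :- z) refl x y z) (ℤD.∣m∣n⇒∣m+n h k)

  residue-cong : ∀ {x y} → x ≡ₚ y → residue x ≡ residue y
  residue-cong {x} {y} h = FinP.toℕ-injective (small-≡ (FinP.toℕ<n (residue x)) (FinP.toℕ<n (residue y))
    (≡ₚ-trans {Z.+ toℕ (residue x)} {x} {Z.+ toℕ (residue y)} (≡ₚ-sym {x} (≡ₚ-residue x)) (≡ₚ-trans {x} {y} {Z.+ toℕ (residue y)} h (≡ₚ-residue y))))

  residue-injective : ∀ {x y} → residue x ≡ residue y → x ≡ₚ y
  residue-injective {x} {y} e = ≡ₚ-trans {x} {Z.+ toℕ (residue x)} {y} (≡ₚ-residue x)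
    (subst (λ r → Z.+ toℕ r ≡ₚ y) (sym e) (≡ₚ-sym {y} (≡ₚ-residue y)))

  -- Pigeonhole in place of elimination: of the p^r digit vectors, two have the same c products with
  -- the rows modulo p. Their difference vanishes on all rows, and it is nonzero modulo p because
  -- digits are smaller than p.
  kernel-vector : ∀ {c r} → c ℕ.< r → 1 ℕ.< p → (a : Fin c → Fin r → ℤ) →
    ∃ λ φ → (∃ λ i → ¬ (Z.+ p ∣ℤ φ i)) × (∀ l → Z.+ p ∣ℤ dot φ (a l))
  kernel-vector {c} {r} c<r 1<p a = φ , pivot , λ l → subst (Z.+ p ∣ℤ_) (sym (φ·a l))
      (residue-injective {dot (digits x) (a l)} {dot (digits y) (a l)} (trans (sym (FinP.finToFun-funToFin (f x) l))
        (trans (cong (λ w → finToFun w l) fx≡fy) (FinP.finToFun-funToFin (f y) l))))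
    where
    digits : Fin (p ℕ.^ r) → Fin r → ℤ
    digits x i = Z.+ toℕ (finToFun x i)
    f : Fin (p ℕ.^ r) → Fin c → Fin p
    f x l = residue (dot (digits x) (a l))
    collision : ∃ λ x → ∃ λ y → x Fin.< y × funToFin (f x) ≡ funToFin (f y)
    collision = FinP.pigeonhole (ℕP.^-monoʳ-< p 1<p c<r) (λ x → funToFin (f x))
    x = proj₁ collision
    y = proj₁ (proj₂ collision)
    fx≡fy = proj₂ (proj₂ (proj₂ collision))
    φ : Fin r → ℤ
    φ i = digits x i Z.- 1ℤ Z.* digits y i
    φ·a : ∀ l → dot φ (a l) ≡ dot (digits x) (a l) Z.- dot (digits y) (a l)
    φ·a l = trans (dot-sub 1ℤ (digits x) (digits y) (a l)) (cong (λ z → dot (digits x) (a l) Z.- z) (ℤP.*-identityˡ _))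
    pivot : ∃ λ i → ¬ (Z.+ p ∣ℤ φ i)
    pivot with FinP.any? (λ i → ¬? (Z.+ p ∣ℤ? φ i))
    ... | yes q = q
    ... | no  q = contradiction (proj₁ (proj₂ (proj₂ collision))) (FinP.<-irrefl
      (trans (sym (FinP.funToFin-finToFin {r} {p} x)) (trans (funToFin-cong same) (FinP.funToFin-finToFin {r} {p} y))))
      where
      same : finToFun x ≗ finToFun y
      same i = FinP.toℕ-injective (small-≡ (FinP.toℕ<n (finToFun x i)) (FinP.toℕ<n (finToFun y i))
        (subst (λ w → Z.+ p ∣ℤ (digits x i Z.- w)) (ℤP.*-identityˡ (digits y i)) (decidable-stable (_ ∣ℤ? _) (λ h → q (i , h)))))

  -- `onto` is linear independence of the functionals modulo p, in the form that lets prescribed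
  -- residues be realised.
  record IndependentFunctionals {c r} (v : ℕ) (a : Fin c → Fin r → ℤ) : Set where
    field
      φ     : Fin v → Fin r → ℤ
      φ·a   : ∀ k l → Z.+ p ∣ℤ dot (φ k) (a l)
      onto  : ∀ (s : Fin v → ℤ) → ∃ λ (w : Fin r → ℤ) → ∀ k → dot (φ k) w ≡ₚ s k

  -- Adding w₀, on which the first functional is 1, to the rows makes all later functionals vanish
  -- there. The system becomes triangular: the first value is corrected by a multiple of w₀ without
  -- disturbing the others.
  independentFunctionals : (∀ x → ¬ (Z.+ p ∣ℤ x) → ∃ λ y → x Z.* y ≡ₚ 1ℤ) → 1 ℕ.< p →
    ∀ {c r} v → c ℕ.+ v ℕ.≤ r → (a : Fin c → Fin r → ℤ) → IndependentFunctionals v a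
  independentFunctionals inv 1<p zero h a = record { φ = λ () ; φ·a = λ () ; onto = λ s → (λ _ → 0ℤ) , λ () }
  independentFunctionals inv 1<p {c} {r} (suc v) c+v≤r a = record { φ = φ′ ; φ·a = φ·a′ ; onto = onto′ }
    where
    c<r : c ℕ.< r
    c<r = ℕP.≤-trans (ℕP.m≤m+n (suc c) v) (subst (ℕ._≤ r) (ℕP.+-suc c v) c+v≤r)
    κ : ∃ λ φ → (∃ λ i → ¬ (Z.+ p ∣ℤ φ i)) × (∀ l → Z.+ p ∣ℤ dot φ (a l))
    κ = kernel-vector c<r 1<p a
    φ₀ : Fin r → ℤ
    φ₀ = proj₁ κ
    i₀ : Fin r
    i₀ = proj₁ (proj₁ (proj₂ κ))
    y : ℤ
    y = proj₁ (inv (φ₀ i₀) (proj₂ (proj₁ (proj₂ κ))))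
    w₀ : Fin r → ℤ
    w₀ k = y Z.* kronecker i₀ k
    φ₀·w₀ : dot φ₀ w₀ ≡ₚ 1ℤ
    φ₀·w₀ = subst (_≡ₚ 1ℤ) (sym (dot-unit φ₀ y i₀)) (proj₂ (inv (φ₀ i₀) (proj₂ (proj₁ (proj₂ κ)))))
    a′ : Fin (suc c) → Fin r → ℤ
    a′ zero    = w₀
    a′ (suc l) = a l
    open IndependentFunctionals (independentFunctionals inv 1<p v (subst (ℕ._≤ r) (ℕP.+-suc c v) c+v≤r) a′)
    φ′ : Fin (suc v) → Fin r → ℤ
    φ′ zero    = φ₀
    φ′ (suc k) = φ k
    φ·a′ : ∀ k l → Z.+ p ∣ℤ dot (φ′ k) (a l)
    φ·a′ zero    l = proj₂ (proj₂ κ) l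
    φ·a′ (suc k) l = φ·a k (suc l)
    onto′ : ∀ s → ∃ λ w → ∀ k → dot (φ′ k) w ≡ₚ s k
    onto′ s = (λ i → w i Z.+ t Z.* w₀ i) , λ where
        zero    → subst (λ z → Z.+ p ∣ℤ (z Z.- s zero)) (sym (dot-+ t φ₀ w w₀))
          (subst (Z.+ p ∣ℤ_) (solve 3 (λ a b s → (s :- a) :* (b :- con 1ℤ) := (a :+ (s :- a) :* b) :- s) refl (dot φ₀ w) (dot φ₀ w₀) (s zero)) (ℤD.∣n⇒∣m*n t φ₀·w₀))
        (suc k) → subst (λ z → Z.+ p ∣ℤ (z Z.- s (suc k))) (sym (dot-+ t (φ k) w w₀))
          (subst (Z.+ p ∣ℤ_) (solve 3 (λ a b s → (a :- s) :+ b := (a :+ b) :- s) refl (dot (φ k) w) (t Z.* dot (φ k) w₀) (s (suc k)))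
            (ℤD.∣m∣n⇒∣m+n (proj₂ (onto (s ∘ suc)) k) (ℤD.∣n⇒∣m*n t (φ·a k zero))))
      where
      w : Fin r → ℤ
      w = proj₁ (onto (s ∘ suc))
      t : ℤ
      t = s zero Z.- dot φ₀ w

  ∣-dot : ∀ {r} (f g : Fin r → ℤ) → (∀ i → Z.+ p ∣ℤ g i) → Z.+ p ∣ℤ dot f g
  ∣-dot {zero}  f g h = divides 0ℤ refl
  ∣-dot {suc r} f g h = ℤD.∣m∣n⇒∣m+n (ℤD.∣n⇒∣m*n (f zero) (h zero)) (∣-dot (f ∘ suc) (g ∘ suc) (h ∘ suc))

module Counting where
  indicator : ∀ {N} → Fin N → Fin N → ℕ
  indicator zero    zero    = 1
  indicator zero    (suc s) = 0
  indicator (suc x) zero    = 0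
  indicator (suc x) (suc s) = indicator x s

  indicator-refl : ∀ {N} (x : Fin N) → indicator x x ≡ 1
  indicator-refl zero    = refl
  indicator-refl (suc x) = indicator-refl x

  indicator-≢ : ∀ {N} {x s : Fin N} → x ≢ s → indicator x s ≡ 0
  indicator-≢ {x = zero}  {zero}  h = contradiction refl h
  indicator-≢ {x = zero}  {suc s} h = refl
  indicator-≢ {x = suc x} {zero}  h = refl
  indicator-≢ {x = suc x} {suc s} h = indicator-≢ (h ∘ cong suc)

  indicator-cong : ∀ {N} {x s y t : Fin N} → (x ≡ s → y ≡ t) → (y ≡ t → x ≡ s) → indicator x s ≡ indicator y t
  indicator-cong {x = x} {s} {y} {t} f g with x Fin.≟ s | y Fin.≟ t
  ... | yes refl | yes refl = trans (indicator-refl x) (sym (indicator-refl y))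
  ... | yes p    | no q     = contradiction (f p) q
  ... | no p     | yes q    = contradiction (g q) p
  ... | no p     | no q     = trans (indicator-≢ p) (sym (indicator-≢ q))

  sum-indicator : ∀ {N} (x : Fin N) → sumℕ (indicator x) ≡ 1
  sum-indicator {suc N} zero = cong suc (sum-0 N)
    where
    sum-0 : ∀ n → sumℕ {n} (λ _ → 0) ≡ 0
    sum-0 zero    = refl
    sum-0 (suc n) = sum-0 n
  sum-indicator (suc x) = sum-indicator x

  sum-const : ∀ n c → sumℕ {n} (λ _ → c) ≡ n ℕ.* c
  sum-const zero    c = refl
  sum-const (suc n) c = cong (c ℕ.+_) (sum-const n c)

  -- The fibres of L are translates of the fibre over o, so they have equal size.
  equal-fibres : ∀ {n N} (L : Fin n → Fin N) o (π : Fin N → Permutation n n) →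
    (∀ s i → L (π s ⟨$⟩ʳ i) ≡ s → L i ≡ o) → (∀ s i → L i ≡ o → L (π s ⟨$⟩ʳ i) ≡ s) → N ℕD.∣ n
  equal-fibres {n} {N} L o π to from = ℕD.divides (sumℕ (λ i → indicator (L i) o)) (begin
    n                                            ≡⟨ sym (ℕP.*-identityʳ n) ⟩
    n ℕ.* 1                                      ≡⟨ sym (sum-const n 1) ⟩
    sumℕ {n} (λ _ → 1)                           ≡⟨ sumℕ-cong (λ i → sym (sum-indicator (L i))) ⟩
    sumℕ (λ i → sumℕ (indicator (L i)))          ≡⟨ sumℕ-comm (λ i s → indicator (L i) s) ⟩
    sumℕ (λ s → sumℕ (λ i → indicator (L i) s))  ≡⟨ sumℕ-cong (λ s → trans (sumℕ-permute (λ i → indicator (L i) s) (π s)) (sumℕ-cong (λ i → indicator-cong (to s i) (from s i)))) ⟩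
    sumℕ {N} (λ s → sumℕ (λ i → indicator (L i) o)) ≡⟨ sum-const N _ ⟩
    N ℕ.* sumℕ (λ i → indicator (L i) o)         ≡⟨ ℕP.*-comm N _ ⟩
    sumℕ (λ i → indicator (L i) o) ℕ.* N         ∎)
    where open ≡-Reasoning

-- The orders ℤ[α] and indices along chains of modules.

module Lattices (S : Setting) where
  open Setting S
  open Scalars powerBasis
  open Integrality S
  open Solver using (solve; _:=_; _:+_; _:*_; _:-_; :-_; con; _:^_)

  InZ[_] : K → K → Set
  InZ[ α ] y = ∃ λ g → ev g α ≡ y

  module _ (α : K) where
    open PolynomialsIn α

    InZ-low : ∀ {y} → InZ[ α ] y → ∃ λ d → Low d y
    InZ-low (g , refl) = length g , ev⇒low g

    low-InZ : ∀ {d y} → Low d y → InZ[ α ] y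
    low-InZ {d} p = proj₁ (low⇒ev d p) , sym (proj₂ (proj₂ (low⇒ev d p)))

    InZ-* : ∀ {x y} → InZ[ α ] x → InZ[ α ] y → InZ[ α ] (x * y)
    InZ-* p q = low-InZ {proj₁ (InZ-low p) ℕ.+ proj₁ (InZ-low q)} (low-* {proj₁ (InZ-low p)} {proj₁ (InZ-low q)} (proj₂ (InZ-low p)) (proj₂ (InZ-low q)))

    InZ-module : IsZModule InZ[ α ]
    InZ-module = record
      { zero∈ = [] , refl
      ; add = λ {x} {y} p q → let d = proj₁ (InZ-low p) ; e = proj₁ (InZ-low q) in
          low-InZ {e ℕ.+ d} (low-+ {e ℕ.+ d} (low-weaken e {d} (proj₂ (InZ-low p))) (subst (λ k → Low k y) (ℕP.+-comm d e) (low-weaken d {e} (proj₂ (InZ-low q)))))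
      ; scale = λ z p → low-InZ {proj₁ (InZ-low p)} (low-scale {proj₁ (InZ-low p)} z (proj₂ (InZ-low p))) }

    InZ-α : InZ[ α ] α
    InZ-α = 0ℤ ∷ 1ℤ ∷ [] , trans (cong₂ _+_ (trans (cong j (ι≡ι₀ 0ℤ)) j-0) (cong (α *_) (trans (cong₂ _+_ jz-1 (zeroʳ α)) (+-identityʳ 1#))))
      (trans (+-identityˡ _) (trans (*-comm α 1#) (*-identityˡ α)))

    InZ-jz : ∀ z → InZ[ α ] (jz z)
    InZ-jz z = z ∷ [] , trans (cong (jz z +_) (zeroʳ α)) (+-identityʳ (jz z))

    InZ-1 : InZ[ α ] 1#
    InZ-1 = subst InZ[ α ] jz-1 (InZ-jz 1ℤ)

    InZ⇒O : O α → ∀ {y} → InZ[ α ] y → O y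
    InZ⇒O α∈ ([] , refl)    = IsZModule.zero∈ O-module
    InZ⇒O α∈ (z ∷ g , refl) = O-+ (Zθ⇒O (Zθ-jz z)) (O-* α∈ (InZ⇒O α∈ (g , refl)))

  jₙ-+ : ∀ m n → jₙ (m ℕ.+ n) ≡ jₙ m + jₙ n
  jₙ-+ m n = jz-+ (Z.+ m) (Z.+ n)

  record HasIndex (A B : K → Set) (n : ℕ) : Set where
    field
      rep   : Fin n → K
      rep∈  : ∀ i → B (rep i)
      cover : ∀ {x} → B x → ∃ λ i → A (x - rep i)
      uniq  : ∀ x {i k} → A (x - rep i) → A (x - rep k) → i ≡ k

  record adjoin (B : K → Set) (g x : K) : Set where
    constructor _,_
    field
      multiple  : ℤ
      remainder : B (x - jz multiple * g)

  adjoin-module : ∀ {B} → IsZModule B → ∀ g → IsZModule (adjoin B g)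
  adjoin-module {B} M g = record
    { zero∈ = 0ℤ , subst B (sym (trans (cong (λ w → 0# - w * g) (trans (cong j (ι≡ι₀ 0ℤ)) j-0)) (trans (cong (λ w → 0# - w) (zeroˡ g)) (-‿inverseʳ 0#)))) zero∈
    ; add = λ { {x} {y} (k , p) (l , q) → k Z.+ l , subst B (trans (solve 5 (λ x y k l g → (x :- k :* g) :+ (y :- l :* g) := (x :+ y) :- (k :+ l) :* g) refl x y (jz k) (jz l) g) (cong (λ w → x + y - w * g) (sym (jz-+ k l)))) (add p q) }
    ; scale = λ { z {x} (k , p) → z Z.* k , subst B (trans (solve 4 (λ z x k g → z :* (x :- k :* g) := z :* x :- (z :* k) :* g) refl (jz z) x (jz k) g) (cong (λ w → jz z * x - w * g) (sym (jz-* z k)))) (scale z p) } }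
    where open IsZModule M

  ⊆adjoin : ∀ {B} g {x} → B x → adjoin B g x
  ⊆adjoin {B} g {x} p = 0ℤ , subst B (sym (trans (cong (λ w → x - w * g) (cong j (ι≡ι₀ 0ℤ))) (solve 2 (λ x g → x :- con 0ℚ :* g := x) refl x g))) p

  ∈adjoin : ∀ {B} → IsZModule B → ∀ g → adjoin B g g
  ∈adjoin {B} M g = 1ℤ , subst B (sym (trans (cong (λ w → g - w * g) jz-1) (trans (cong (λ w → g - w) (*-identityˡ g)) (-‿inverseʳ g)))) (IsZModule.zero∈ M)

  adjoinAll : ∀ {k} → (K → Set) → (Fin k → K) → K → Set
  adjoinAll {zero}  B t = B
  adjoinAll {suc k} B t = adjoinAll (adjoin B (t zero)) (t ∘ suc)

  adjoinAll-module : ∀ {k B} → IsZModule B → (t : Fin k → K) → IsZModule (adjoinAll B t)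
  adjoinAll-module {zero}  M t = M
  adjoinAll-module {suc k} M t = adjoinAll-module (adjoin-module M (t zero)) (t ∘ suc)

  ⊆adjoinAll : ∀ {k B} (t : Fin k → K) {x} → B x → adjoinAll B t x
  ⊆adjoinAll {zero}  t p = p
  ⊆adjoinAll {suc k} t p = ⊆adjoinAll (t ∘ suc) (⊆adjoin (t zero) p)

  ∈adjoinAll : ∀ {k B} → IsZModule B → (t : Fin k → K) → ∀ i → adjoinAll B t (t i)
  ∈adjoinAll M t zero    = ⊆adjoinAll (t ∘ suc) (∈adjoin M (t zero))
  ∈adjoinAll M t (suc i) = ∈adjoinAll (adjoin-module M (t zero)) (t ∘ suc) i

  adjoinAll-elim : ∀ {k B} {Q : K → Set} → IsZModule Q → (∀ {x} → B x → Q x) → (t : Fin k → K) → (∀ i → Q (t i)) → ∀ {x} → adjoinAll B t x → Q x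
  adjoinAll-elim {zero}  M B⊆Q t t∈ p = B⊆Q p
  adjoinAll-elim {suc k} {B} {Q} M B⊆Q t t∈ p = adjoinAll-elim {k} {adjoin B (t zero)} {Q} M
    (λ { {x} (l , b) → subst Q (solve 3 (λ x l g → (x :- l :* g) :+ l :* g := x) refl x (jz l) (t zero)) (add (B⊆Q b) (scale l (t∈ zero))) })
    (t ∘ suc) (t∈ ∘ suc) p
    where open IsZModule M

  -- The index of B in B + ℤg is the order q of g modulo B, and q divides m because (m mod q) g
  -- again lies in B. Membership in B is not decided, so this least q is found only up to double
  -- negation.
  index-step : ∀ {A B n} → IsZModule A → IsZModule B → (∀ {x} → A x → B x) → HasIndex A B n →
    ∀ g m → NonZero m → B (jₙ m * g) → ¬ ¬ ∃ λ q → q ℕD.∣ m × HasIndex A (adjoin B g) (q ℕ.* n)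
  index-step {A} {B} {n} MA MB A⊆B H g m m≢0 mg h =
      least Multiple m (is m m≢0 mg) λ { (_ , (q , refl , qg) , min) → h (suc q , divides-m q qg min , index q qg min) }
    where
    open HasIndex H
    module MA = IsZModule MA
    module MB = IsZModule MB
    Multiple : ℕ → Set
    Multiple c = ∃ λ k → c ≡ suc k × B (jₙ (suc k) * g)
    is : ∀ m → NonZero m → B (jₙ m * g) → Multiple m
    is (suc m) _ b = m , refl , b
    module _ (q : ℕ) (qg : B (jₙ (suc q) * g)) (min : ∀ c → c ℕ.< suc q → ¬ Multiple c) where
      vanishes : ∀ r → r ℕ.< suc q → B (jₙ r * g) → r ≡ 0
      vanishes zero    _   _ = refl
      vanishes (suc r) r<q b = contradiction (r , refl , b) (min (suc r) r<q)
      divides-m : suc q ℕD.∣ m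
      divides-m = ℕD.m%n≡0⇒n∣m m (suc q) (vanishes (m ℕDM.% suc q) (ℕDM.m%n<n m (suc q))
        (subst B (trans (cong (λ w → w * g - jₙ (m ℕDM./ suc q) * (jₙ (suc q) * g))
             (trans (cong jₙ (ℕDM.m≡m%n+[m/n]*n m (suc q))) (trans (jₙ-+ (m ℕDM.% suc q) _) (cong (jₙ (m ℕDM.% suc q) +_) (jₙ-* (m ℕDM./ suc q) (suc q))))))
           (solve 4 (λ r c q g → (r :+ c :* q) :* g :- c :* (q :* g) := r :* g) refl (jₙ (m ℕDM.% suc q)) (jₙ (m ℕDM./ suc q)) (jₙ (suc q)) g))
          (MB.sub mg (MB.scale (Z.+ (m ℕDM./ suc q)) qg))))
      rep′ : Fin (suc q) × Fin n → K
      rep′ (a , b) = rep b + jₙ (toℕ a) * g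
      multiples-distinct : ∀ a a′ → a ℕ.≤ a′ → a′ ℕ.< suc q → B (jₙ a′ * g - jₙ a * g) → a ≡ a′
      multiples-distinct a a′ a≤a′ a′<q b = ℕP.≤-antisym a≤a′ (ℕP.m∸n≡0⇒m≤n (vanishes (a′ ℕ.∸ a) (ℕP.≤-<-trans (ℕP.m∸n≤m a′ a) a′<q)
        (subst B (trans (cong (λ w → w * g - jₙ a * g) (trans (cong jₙ (sym (ℕP.m+[n∸m]≡n a≤a′))) (jₙ-+ a (a′ ℕ.∸ a))))
          (solve 3 (λ a c g → (a :+ c) :* g :- a :* g := c :* g) refl (jₙ a) (jₙ (a′ ℕ.∸ a)) g)) b)))
      uniq′ : ∀ x {y z} → A (x - rep′ y) → A (x - rep′ z) → y ≡ z
      uniq′ x {a , b} {a′ , b′} p p′ = cong₂ _,_ a≡a′ (uniq (x - jₙ (toℕ a′) * g) {b} {b′}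
          (subst A (trans (cong (λ c → x - (rep b + jₙ (toℕ c) * g)) a≡a′) (move b)) p) (subst A (move b′) p′))
        where
        move : ∀ b → x - (rep b + jₙ (toℕ a′) * g) ≡ x - jₙ (toℕ a′) * g - rep b
        move b = solve 4 (λ x r c g → x :- (r :+ c :* g) := x :- c :* g :- r) refl x (rep b) (jₙ (toℕ a′)) g
        difference : ∀ {a b a′ b′} → A (x - rep′ (a , b)) → A (x - rep′ (a′ , b′)) → B (jₙ (toℕ a′) * g - jₙ (toℕ a) * g)
        difference {a} {b} {a′} {b′} p p′ = subst B
          (solve 6 (λ x r r′ a a′ g → (x :- (r :+ a :* g)) :- (x :- (r′ :+ a′ :* g)) :+ (r :- r′) := a′ :* g :- a :* g) refl x (rep b) (rep b′) (jₙ (toℕ a)) (jₙ (toℕ a′)) g)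
          (MB.add (A⊆B (MA.sub p p′)) (MB.sub (rep∈ b) (rep∈ b′)))
        a≡a′ : a ≡ a′
        a≡a′ with ℕP.≤-total (toℕ a) (toℕ a′)
        ... | inj₁ le = FinP.toℕ-injective (multiples-distinct (toℕ a) (toℕ a′) le (FinP.toℕ<n a′) (difference {a} {b} {a′} {b′} p p′))
        ... | inj₂ le = sym (FinP.toℕ-injective (multiples-distinct (toℕ a′) (toℕ a) le (FinP.toℕ<n a) (difference {a′} {b′} {a} {b} p′ p)))
      cover′ : ∀ {x} → adjoin B g x → ∃ λ y → A (x - rep′ y)
      cover′ {x} (k , b) = (a , proj₁ c) , subst A (sym (trans (cong (λ w → x - (rep (proj₁ c) + jₙ w * g)) (FinP.toℕ-fromℕ< (ℤDM.n%ℕd<d k (suc q))))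
          (solve 4 (λ x r c g → x :- (r :+ c :* g) := x :- c :* g :- r) refl x (rep (proj₁ c)) (jₙ r) g))) (proj₂ c)
        where
        r : ℕ
        r = k ℤDM.%ℕ suc q
        d : ℤ
        d = k ℤDM./ℕ suc q
        a : Fin (suc q)
        a = fromℕ< (ℤDM.n%ℕd<d k (suc q))
        k≡ : jz k ≡ jₙ r + jz d * jₙ (suc q)
        k≡ = trans (cong jz (ℤDM.a≡a%ℕn+[a/ℕn]*n k (suc q))) (trans (jz-+ (Z.+ r) _) (cong (jₙ r +_) (jz-* d (Z.+ suc q))))
        c : ∃ λ i → A (x - jₙ r * g - rep i)
        c = cover (subst B (trans (cong (λ w → x - w * g + jz d * (jₙ (suc q) * g)) k≡)
          (solve 5 (λ x r d q g → x :- (r :+ d :* q) :* g :+ d :* (q :* g) := x :- r :* g) refl x (jₙ r) (jz d) (jₙ (suc q)) g))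
          (MB.add b (MB.scale d qg)))
      index : HasIndex A (adjoin B g) (suc q ℕ.* n)
      index = record
        { rep = rep′ ∘ remQuot n
        ; rep∈ = λ i → IsZModule.add (adjoin-module MB g) (⊆adjoin g (rep∈ (proj₂ (remQuot {suc q} n i))))
            (IsZModule.scale (adjoin-module MB g) (Z.+ toℕ (proj₁ (remQuot {suc q} n i))) (∈adjoin MB g))
        ; cover = λ {x} p → let y = proj₁ (cover′ p) in combine (proj₁ y) (proj₂ y) ,
            subst (λ w → A (x - rep′ w)) (sym (FinP.remQuot-combine (proj₁ y) (proj₂ y))) (proj₂ (cover′ p))
        ; uniq = λ x {i} {k} p p′ → trans (sym (FinP.combine-remQuot {suc q} n i)) (trans (cong (uncurry combine) (uniq′ x p p′)) (FinP.combine-remQuot {suc q} n k)) }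

  -- Each new generator contributes an index that divides `m`. Divisibility is enough, since the
  -- result serves to bound a p-adic valuation.
  index-adjoinAll : ∀ k {A B n} → IsZModule A → IsZModule B → (∀ {x} → A x → B x) → HasIndex A B n →
    (t : Fin k → K) → ∀ m → NonZero m → (∀ i → B (jₙ m * t i)) → ¬ ¬ ∃ λ n′ → n′ ℕD.∣ m ℕ.^ k ℕ.* n × HasIndex A (adjoinAll B t) n′
  index-adjoinAll zero {n = n} MA MB A⊆B H t m m≢0 mt h = h (n , ℕD.∣-reflexive (sym (ℕP.*-identityˡ n)) , H)
  index-adjoinAll (suc k) {n = n} MA MB A⊆B H t m m≢0 mt h = index-step MA MB A⊆B H (t zero) m m≢0 (mt zero) λ { (q , q∣m , H′) →
    index-adjoinAll k MA (adjoin-module MB (t zero)) (⊆adjoin (t zero) ∘ A⊆B) H′ (t ∘ suc) m m≢0 (λ i → ⊆adjoin (t zero) (mt (suc i))) λ { (n′ , n′∣ , H″) →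
    h (n′ , ℕD.∣-trans n′∣ (subst (m ℕ.^ k ℕ.* (q ℕ.* n) ℕD.∣_) (rearrange (m ℕ.^ k) m n) (ℕD.*-monoʳ-∣ (m ℕ.^ k) (ℕD.*-monoˡ-∣ n q∣m))) , H″) } }
    where
    rearrange : ∀ a m n → a ℕ.* (m ℕ.* n) ≡ m ℕ.* a ℕ.* n
    rearrange a m n = trans (sym (ℕP.*-assoc a m n)) (cong (ℕ._* n) (ℕP.*-comm a m))

  trivial-index : ∀ {A} → IsZModule A → HasIndex A A 1
  trivial-index {A} M = record
    { rep = λ _ → 0# ; rep∈ = λ _ → IsZModule.zero∈ M
    ; cover = λ {x} p → zero , IsZModule.sub M p (IsZModule.zero∈ M)
    ; uniq = λ { x {zero} {zero} _ _ → refl } }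

-- Index bounds from a p-maximal order.

∣-cong : ∀ {d x y : ℤ} → x ≡ y → d ∣ℤ x → d ∣ℤ y
∣-cong {d} e = subst (d ∣ℤ_) e

module Orders (S : Setting) (C : Congruence S) where
  open Setting S
  open Scalars powerBasis
  open Integrality S
  open Lattices S
  open Congruence C
  open Local S C
  open Solver using (solve; _:=_; _:+_; _:*_; _:-_; :-_; con; _:^_)

  instance
    private
      p-nonzero : NonZero p
      p-nonzero = p≢0

  open Mod p

  record Basis : Set where
    field
      ξ        : Fin 6 → K → ℚ
      ξ-linear : ∀ i → Linear (ξ i)
      gen      : Fin 6 → K
      ξ-expand : ∀ x → IsSum (λ i → j (ξ i x) * gen i) x
      ξ-gen    : ∀ i k → ξ i (gen k) ≡ δ i k

    record Λ (x : K) : Set where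
      constructor λλ
      field ξ-int : ∀ i → Int (ξ i x)
    open Λ public

    Λ-module : IsZModule Λ
    Λ-module = record
      { zero∈ = λλ λ i → subst Int (sym (Linear.lin-0 (ξ-linear i))) Int-0
      ; add = λ p q → λλ λ i → subst Int (sym (Linear.lin-+ (ξ-linear i) _ _)) (Int-+ (ξ-int p i) (ξ-int q i))
      ; scale = λ z p → λλ λ i → subst Int (sym (Linear.lin-j (ξ-linear i) (ι z) _)) (Int-* (Int-ι z) (ξ-int p i)) }

    open IsZModule Λ-module public using () renaming (zero∈ to Λ-0; scale to Λ-scale; neg to Λ-neg; sub to Λ-sub)

    gen∈Λ : ∀ k → Λ (gen k)
    gen∈Λ k = λλ λ i → subst Int (sym (ξ-gen i k)) (Int-δ i k)

    -- Membership in Λ is the integrality of six rationals, hence decidable; choices made on the way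
    -- to it may be forgotten.
    Λ-stable : ∀ {x} → ¬ ¬ Λ x → Λ x
    Λ-stable h = λλ λ i → decidable-stable (Int? _) λ k → h λ p → k (ξ-int p i)

  -- A p-maximal order Λ, with r functionals on Λ / J modulo p, where J ⊇ pΛ is an ideal such that
  -- every element of Λ / J satisfies z^q = z.
  record MaximalOrder : Set₁ where
    field
      basis : Basis
    open Basis basis public
    field
      Λ-*     : ∀ {x y} → Λ x → Λ y → Λ (x * y)
      Zθ⇒Λ    : ∀ {x} → Zθ x → Λ x
      pΛ⊆Zθ   : ∀ {x} → Λ x → Zθ (P * x)
      maximal : ∀ {x} → Integral x → Λ (P * x) → ¬ ¬ Λ x
      q v r   : ℕ
      1<q     : 1 ℕ.< q
      q+v≤r   : q ℕ.+ v ℕ.≤ r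
      1<p     : 1 ℕ.< p
      prime   : Prime p
      inverse : ∀ x → ¬ (Z.+ p ∣ℤ x) → ∃ λ y → x Z.* y ≡ₚ 1ℤ
      ρ       : Fin r → Fin 6
      ρ-δ     : ∀ i k → δ (ρ i) (ρ k) ≡ δ i k
      J       : K → Set
      Λ*J     : ∀ {x y} → Λ x → J y → J (x * y)
      J-ξ     : ∀ {x} → J x → ∀ i → ∃ λ z → ξ (ρ i) x ≡ ιₙ p ℚ.* ι z
      power   : ∀ {z} → Λ z → J (z ^ q - z)

  module MaximalOrderTheory (M : MaximalOrder) where
    open MaximalOrder M

    m : ℤ
    m = proj₁ local-denominator

    u : ℤ
    u = 1ℤ Z.+ (Z.+ p) Z.* m

    U : K
    U = jz u

    U≡ : U ≡ 1# + P * jz m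
    U≡ = trans (jz-+ 1ℤ _) (cong₂ _+_ jz-1 (jz-* (Z.+ p) m))

    Λ-1 : Λ 1#
    Λ-1 = Zθ⇒Λ Zθ-1

    Λ-^ : ∀ {x} k → Λ x → Λ (x ^ k)
    Λ-^ zero    x∈ = Λ-1
    Λ-^ (suc k) x∈ = Λ-* x∈ (Λ-^ k x∈)

    Λ⇒O : ∀ {x} → Λ x → O x
    Λ⇒O x∈ = p , p≢0 , λ k → pΛ⊆Zθ (Λ-^ k x∈)

    abstract
      -- `local-denominator` places p u x in ℤ[θ], hence in Λ, and maximality removes the p. One
      -- multiplier u ≡ 1 modulo p serves all of O.
      O⇒UΛ : ∀ {x} → O x → Λ (U * x)
      O⇒UΛ {x} x∈ = Λ-stable λ h → O⇒¬¬integral Ux∈ λ i →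
          maximal i (Zθ⇒Λ (proj₂ local-denominator x∈)) h
        where
        Ux∈ : O (U * x)
        Ux∈ = O-* (Zθ⇒O (Zθ-jz u)) x∈

    vec : ∀ {x} → Λ x → Fin r → ℤ
    vec x∈ i = proj₁ (ξ-int x∈ (ρ i))

    vec-ξ : ∀ {x} (x∈ : Λ x) i → ξ (ρ i) x ≡ ι (vec x∈ i)
    vec-ξ x∈ i = proj₂ (ξ-int x∈ (ρ i))

    -- `vec` depends on a membership proof. This linearity, and its case c = 0 in `dot-cong-vec`,
    -- compares vectors taken from different proofs.
    dot-vec : ∀ f {x y z} (x∈ : Λ x) (y∈ : Λ y) (z∈ : Λ z) c → x ≡ y + jz c * z →
      dot f (vec x∈) ≡ dot f (vec y∈) Z.+ c Z.* dot f (vec z∈)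
    dot-vec f {x} {y} {z} x∈ y∈ z∈ c e = trans (dot-cong λ i → ι-injective (trans (sym (vec-ξ x∈ i)) (trans (cong (ξ (ρ i)) e)
        (trans (Linear.lin-+ (ξ-linear (ρ i)) y (jz c * z)) (trans (cong₂ ℚ._+_ (vec-ξ y∈ i) (trans (Linear.lin-j (ξ-linear (ρ i)) (ι c) z) (cong (ι c ℚ.*_) (vec-ξ z∈ i))))
        (sym (trans (ι-+ (vec y∈ i) _) (cong (ι (vec y∈ i) ℚ.+_) (ι-* c (vec z∈ i)))))))))) (dot-+ c f (vec y∈) (vec z∈))
      where
      dot-cong : ∀ {g h : Fin r → ℤ} → (∀ i → g i ≡ h i) → dot f g ≡ dot f h
      dot-cong e = sumℤ-cong (λ i → cong (f i Z.*_) (e i))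

    dot-cong-vec : ∀ f {x y} (x∈ : Λ x) (y∈ : Λ y) → x ≡ y → dot f (vec x∈) ≡ dot f (vec y∈)
    dot-cong-vec f {x} {y} x∈ y∈ e = trans (dot-vec f x∈ y∈ y∈ 0ℤ (trans e (sym (trans (cong (λ w → y + w * y) (trans (cong j (ι≡ι₀ 0ℤ)) j-0)) (trans (cong (y +_) (zeroˡ y)) (+-identityʳ y))))))
      (trans (cong (λ w → dot f (vec y∈) Z.+ w) (ℤP.*-zeroˡ (dot f (vec y∈)))) (ℤP.+-identityʳ (dot f (vec y∈))))

    J-dot : ∀ f {x} → J x → (x∈ : Λ x) → Z.+ p ∣ℤ dot f (vec x∈)
    J-dot f x∈J x∈ = ∣-dot f (vec x∈) λ i → divides (proj₁ (J-ξ x∈J i))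
      (ι-injective (trans (sym (vec-ξ x∈ i)) (trans (proj₂ (J-ξ x∈J i)) (trans (sym (ι-* (Z.+ p) _)) (cong ι (ℤP.*-comm (Z.+ p) _))))))

    unit-cancel : ∀ t a {b} → a Z.+ ((Z.+ p) Z.* t) Z.* a ≡ b → Z.+ p ∣ℤ b → Z.+ p ∣ℤ a
    unit-cancel t a {b} e h = ∣-cong (trans (cong (Z._- ((Z.+ p) Z.* t) Z.* a) (sym e))
        (ℤR.solve 2 (λ a c → (a ℤR.:+ c) ℤR.:- c ℤR.:= a) refl a (((Z.+ p) Z.* t) Z.* a)))
      (ℤD.∣m∣n⇒∣m-n h (ℤD.∣m⇒∣m*n a (ℤD.∣m⇒∣m*n t ℤD.∣-refl)))

    U-split : ∀ x → U * x ≡ x + jz ((Z.+ p) Z.* m) * x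
    U-split x = trans (cong (_* x) U≡) (trans (distribʳ x 1# (P * jz m)) (cong₂ _+_ (*-identityˡ x) (cong (_* x) (sym (jz-* (Z.+ p) m)))))

    module _ {α : K} (α∈ : O α) where
      private
        β : K
        β = U * α
        β∈ : Λ β
        β∈ = O⇒UΛ α∈
        -- The powers 1, β, ..., β^(q-1) span the image of ℤ[β] in Λ/J, since β^q ≡ β there.
        rows : Fin q → Fin r → ℤ
        rows l = vec (Λ-^ (toℕ l) β∈)
        abstract
          functionals : IndependentFunctionals v rows
          functionals = independentFunctionals inverse 1<p v q+v≤r rows
      open IndependentFunctionals functionals

      -- An element of O need not lie in Λ. Multiplication by u ≡ 1 modulo p carries it there, and
      -- on Λ itself this changes the functional only by a multiple of p.
      χ : Fin v → ∀ {x} → O x → ℤ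
      χ k x∈ = dot (φ k) (vec (O⇒UΛ x∈))

      private
        -- From exponent q on, β^l ≡ β^(l-q+1) modulo J, and the exponent has dropped because q > 1.
        χβ^ : ∀ k l → Z.+ p ∣ℤ dot (φ k) (vec (Λ-^ l β∈))
        χβ^ k = <-rec (λ l → Z.+ p ∣ℤ dot (φ k) (vec (Λ-^ l β∈))) step
          where
          step : ∀ l → (∀ {l′} → l′ ℕ.< l → Z.+ p ∣ℤ dot (φ k) (vec (Λ-^ l′ β∈))) → Z.+ p ∣ℤ dot (φ k) (vec (Λ-^ l β∈))
          step l rec = by-cases (l ℕ.<? q)
            where
            by-cases : Dec (l ℕ.< q) → Z.+ p ∣ℤ dot (φ k) (vec (Λ-^ l β∈))
            by-cases (yes l<q) = subst (λ i → Z.+ p ∣ℤ dot (φ k) (vec (Λ-^ i β∈))) (FinP.toℕ-fromℕ< l<q) (φ·a k (fromℕ< l<q))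
            by-cases (no l≮q) = ∣-cong (sym (dot-vec (φ k) (Λ-^ l β∈) (Λ-^ (suc t) β∈) diff∈ 1ℤ e))
                (ℤD.∣m∣n⇒∣m+n (rec (ℕP.<-≤-trans (ℕP.+-monoˡ-< t 1<q) (ℕP.≤-reflexive l≡))) (ℤD.∣n⇒∣m*n 1ℤ (J-dot (φ k) (Λ*J (Λ-^ t β∈) (power β∈)) diff∈)))
              where
              t : ℕ
              t = l ℕ.∸ q
              l≡ : q ℕ.+ t ≡ l
              l≡ = ℕP.m+[n∸m]≡n (ℕP.≮⇒≥ l≮q)
              diff∈ : Λ (β ^ t * (β ^ q - β))
              diff∈ = Λ-* (Λ-^ t β∈) (Λ-sub (Λ-^ q β∈) β∈)
              e : β ^ l ≡ β ^ suc t + jz 1ℤ * (β ^ t * (β ^ q - β))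
              e = trans (trans (cong (β ^_) (sym l≡)) (PolynomialsIn.^-+ β q t)) (trans
                (solve 3 (λ b B T → B :* T := b :* T :+ con 1ℚ :* (T :* (B :- b))) refl β (β ^ q) (β ^ t))
                (cong (λ w → β ^ suc t + w * (β ^ t * (β ^ q - β))) (trans j-1 (sym jz-1))))

        β^≡ : ∀ l → ∃ λ t → β ^ l ≡ α ^ l + jz ((Z.+ p) Z.* t) * α ^ l
        β^≡ zero    = 0ℤ , sym (trans (cong (λ w → 1# + w * 1#) (trans (cong jz (ℤP.*-zeroʳ (Z.+ p))) (trans (cong j (ι≡ι₀ 0ℤ)) j-0))) (trans (cong (1# +_) (zeroˡ 1#)) (+-identityʳ 1#)))
        β^≡ (suc l) = t′ , trans (cong₂ _*_ (U-split α) (proj₂ (β^≡ l))) (trans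
            (solve 4 (λ a A c d → (a :+ c :* a) :* (A :+ d :* A) := a :* A :+ (c :+ d :+ c :* d) :* (a :* A)) refl α (α ^ l) (jz ((Z.+ p) Z.* m)) (jz ((Z.+ p) Z.* t)))
            (cong (λ w → α * α ^ l + w * (α * α ^ l)) (sym jz-t′)))
          where
          t : ℤ
          t = proj₁ (β^≡ l)
          t′ : ℤ
          t′ = m Z.+ t Z.+ m Z.* ((Z.+ p) Z.* t)
          jz-t′ : jz ((Z.+ p) Z.* t′) ≡ jz ((Z.+ p) Z.* m) + jz ((Z.+ p) Z.* t) + jz ((Z.+ p) Z.* m) * jz ((Z.+ p) Z.* t)
          jz-t′ = trans (cong jz (ℤR.solve 3 (λ p m t → p ℤR.:* (m ℤR.:+ t ℤR.:+ m ℤR.:* (p ℤR.:* t)) ℤR.:= p ℤR.:* m ℤR.:+ p ℤR.:* t ℤR.:+ (p ℤR.:* m) ℤR.:* (p ℤR.:* t)) refl (Z.+ p) m t))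
            (trans (jz-+ ((Z.+ p) Z.* m Z.+ (Z.+ p) Z.* t) _) (cong₂ _+_ (jz-+ ((Z.+ p) Z.* m) _) (jz-* ((Z.+ p) Z.* m) _)))

        -- The powers of α need not lie in Λ, only their multiples by u. So u β^l is evaluated in
        -- two ways: as (1 + p m) β^l, to which `χβ^` applies, and as (1 + p t) times u α^l.
        χα^ : ∀ k l (h : O (α ^ l)) → Z.+ p ∣ℤ χ k h
        χα^ k l h = unit-cancel t (χ k h)
            (trans (sym (dot-vec (φ k) W∈ (O⇒UΛ h) (O⇒UΛ h) ((Z.+ p) Z.* t) W≡₁)) (dot-vec (φ k) W∈ (Λ-^ l β∈) (Λ-^ l β∈) ((Z.+ p) Z.* m) (U-split (β ^ l))))
            (ℤD.∣m∣n⇒∣m+n (χβ^ k l) (ℤD.∣n⇒∣m*n ((Z.+ p) Z.* m) (χβ^ k l)))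
          where
          t : ℤ
          t = proj₁ (β^≡ l)
          W∈ : Λ (U * β ^ l)
          W∈ = Λ-scale u (Λ-^ l β∈)
          W≡₁ : U * β ^ l ≡ U * α ^ l + jz ((Z.+ p) Z.* t) * (U * α ^ l)
          W≡₁ = trans (cong (U *_) (proj₂ (β^≡ l))) (solve 3 (λ u c A → u :* (A :+ c :* A) := u :* A :+ c :* (u :* A)) refl U (jz ((Z.+ p) Z.* t)) (α ^ l))

      χ-lin : ∀ k {x y z} (x∈ : O x) (y∈ : O y) (z∈ : O z) c → x ≡ y + jz c * z → χ k x∈ ≡ χ k y∈ Z.+ c Z.* χ k z∈
      χ-lin k {x} {y} {z} x∈ y∈ z∈ c e = dot-vec (φ k) (O⇒UΛ x∈) (O⇒UΛ y∈) (O⇒UΛ z∈) c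
        (trans (cong (U *_) e) (solve 4 (λ u y c z → u :* (y :+ c :* z) := u :* y :+ c :* (u :* z)) refl U y (jz c) z))

      -- The induction carries a factor α^l in front, which absorbs the α of each Horner step, so
      -- that only powers of α are evaluated. The empty polynomial is settled by χ 0 = χ 0 + χ 0.
      χ-InZ : ∀ k {x} → InZ[ α ] x → (x∈ : O x) → Z.+ p ∣ℤ χ k x∈
      χ-InZ k (g , refl) x∈ = ∣-cong (dot-cong-vec (φ k) (O⇒UΛ (x∈′ g 0)) (O⇒UΛ x∈) (cong (U *_) (*-identityˡ _))) (go g 0 (x∈′ g 0))
        where
        ev∈ : ∀ g → O (ev g α)
        ev∈ g = InZ⇒O α α∈ (g , refl)
        x∈′ : ∀ g l → O (α ^ l * ev g α)
        x∈′ g l = O-* (O-^ l α∈) (ev∈ g)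
        go : ∀ g l (h : O (α ^ l * ev g α)) → Z.+ p ∣ℤ χ k h
        go [] l h = zero-case
          where
          zero-case : Z.+ p ∣ℤ χ k h
          zero-case = divides 0ℤ (double (χ k h) (trans (χ-lin k h h h 1ℤ (trans (zeroʳ (α ^ l)) (sym (trans (cong₂ (λ a b → a + jz 1ℤ * b) (zeroʳ (α ^ l)) (zeroʳ (α ^ l))) (trans (+-identityˡ (jz 1ℤ * 0#)) (zeroʳ (jz 1ℤ))))))) (cong (λ w → χ k h Z.+ w) (ℤP.*-identityˡ (χ k h)))))
            where
            double : ∀ a → a ≡ a Z.+ a → a ≡ 0ℤ Z.* Z.+ p
            double a e = sym (trans (ℤP.*-zeroˡ (Z.+ p)) (trans (sym (ℤP.+-inverseʳ a)) (trans (cong (Z._- a) e) (ℤR.solve 1 (λ a → (a ℤR.:+ a) ℤR.:- a ℤR.:= a) refl a))))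
        go (z ∷ g) l h = ∣-cong (sym (χ-lin k h (x∈′ g (suc l)) (O-^ l α∈) z
          (solve 4 (λ A z a E → A :* (z :+ a :* E) := (a :* A) :* E :+ z :* A) refl (α ^ l) (jz z) α (ev g α))))
          (ℤD.∣m∣n⇒∣m+n (go g (suc l) (x∈′ g (suc l))) (ℤD.∣n⇒∣m*n z (χα^ k l (O-^ l α∈))))

      χ-onto : ∀ (s : Fin v → ℤ) → ∃ λ b → Σ (O b) λ b∈ → ∀ k → χ k b∈ ≡ₚ s k
      χ-onto s = b , Λ⇒O b∈ , λ k → ∣-cong (sym (cong (Z._- s k) (trans (dot-vec (φ k) (O⇒UΛ (Λ⇒O b∈)) b∈ b∈ ((Z.+ p) Z.* m) (U-split b)) (cong (λ w → w Z.+ ((Z.+ p) Z.* m) Z.* w) (dot-b k)))))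
          (∣-cong (ℤR.solve 3 (λ a c s → (a ℤR.:- s) ℤR.:+ c ℤR.:= (a ℤR.:+ c) ℤR.:- s) refl (dot (φ k) w) (((Z.+ p) Z.* m) Z.* dot (φ k) w) (s k))
            (ℤD.∣m∣n⇒∣m+n (proj₂ (onto s) k) (ℤD.∣m⇒∣m*n (dot (φ k) w) (ℤD.∣m⇒∣m*n m ℤD.∣-refl))))
        where
        w : Fin r → ℤ
        w = proj₁ (onto s)
        b : K
        b = sum (λ i → jz (w i) * gen (ρ i))
        b∈ : Λ b
        b∈ = IsZModule.sum∈ Λ-module (λ i → Λ-scale (w i) (gen∈Λ (ρ i)))
        vec-b : ∀ k → vec b∈ k ≡ w k
        vec-b k = ι-injective (trans (sym (vec-ξ b∈ k)) (trans (Linear.lin-sum (ξ-linear (ρ k)) (λ i → jz (w i) * gen (ρ i)))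
          (trans (sumℚ-cong (λ i → trans (Linear.lin-j (ξ-linear (ρ k)) (ι (w i)) (gen (ρ i))) (cong (ι (w i) ℚ.*_) (trans (ξ-gen (ρ k) (ρ i)) (ρ-δ k i))))) (sumℚ-δ (λ i → ι (w i)) k))))
        dot-b : ∀ k → dot (φ k) (vec b∈) ≡ dot (φ k) w
        dot-b k = sumℤ-cong (λ i → cong (φ k i Z.*_) (vec-b i))

      -- The χ k induce a surjection of O/ℤ[α] onto 𝔽_p^v. Translation by a preimage of s permutes
      -- the n representatives and carries the fibre over 0 to the fibre over s, so the p^v fibres
      -- have equal size. Divisibility is decidable, so the finitely many translates may be chosen
      -- under double negation.
      p^v∣index : ∀ {n} (rep : Fin n → K) → (∀ i → O (rep i)) → (∀ {x} → O x → ¬ ¬ ∃ λ i → InZ[ α ] (x - rep i)) →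
        (∀ x {i k} → InZ[ α ] (x - rep i) → InZ[ α ] (x - rep k) → i ≡ k) → p ℕ.^ v ℕD.∣ n
      p^v∣index {n} rep rep∈ cover uniq = decidable-stable (_ ℕD.∣? _) λ h →
          ¬¬-Fin {A = λ s → ∀ i → Shifts s i} (λ s → ¬¬-Fin (λ i k → cover (O-+ (rep∈ i) (b∈ s)) λ c → cover (IsZModule.sub O-module (rep∈ i) (b∈ s)) λ d → k (c , d)))
            λ f → h (Counting.equal-fibres label origin (λ s → shift s (f s)) (λ s i → to s (f s) i) (λ s i → from s (f s) i))
        where
        module A = IsZModule (InZ-module α)
        label : Fin n → Fin (p ℕ.^ v)
        label i = funToFin (λ k → residue (χ k (rep∈ i)))
        origin : Fin (p ℕ.^ v)
        origin = funToFin {v} (λ k → residue 0ℤ)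
        digits : Fin (p ℕ.^ v) → Fin v → ℤ
        digits s k = Z.+ toℕ (finToFun {p} {v} s k)
        b : Fin (p ℕ.^ v) → K
        b s = proj₁ (χ-onto (digits s))
        b∈ : ∀ s → O (b s)
        b∈ s = proj₁ (proj₂ (χ-onto (digits s)))
        Shifts : Fin (p ℕ.^ v) → Fin n → Set
        Shifts s i = (∃ λ k → InZ[ α ] (rep i + b s - rep k)) × (∃ λ k → InZ[ α ] (rep i - b s - rep k))
        shift : ∀ s → (∀ i → Shifts s i) → Permutation n n
        shift s f = permutation up down up-down down-up
          where
          up down : Fin n → Fin n
          up i = proj₁ (proj₁ (f i))
          down i = proj₁ (proj₂ (f i))
          self : ∀ x → InZ[ α ] (x - x)
          self x = subst InZ[ α ] (sym (-‿inverseʳ x)) A.zero∈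
          up-down : ∀ i → up (down i) ≡ i
          up-down i = uniq (rep i) (subst InZ[ α ] (solve 4 (λ r b d u → (r :- b :- d) :+ (d :+ b :- u) := r :- u) refl (rep i) (b s) (rep (down i)) (rep (up (down i))))
            (A.add (proj₂ (proj₂ (f i))) (proj₂ (proj₁ (f (down i)))))) (self (rep i))
          down-up : ∀ i → down (up i) ≡ i
          down-up i = uniq (rep i) (subst InZ[ α ] (solve 4 (λ r b d u → (r :+ b :- d) :+ (d :- b :- u) := r :- u) refl (rep i) (b s) (rep (up i)) (rep (down (up i))))
            (A.add (proj₂ (proj₁ (f i))) (proj₂ (proj₂ (f (up i)))))) (self (rep i))
        label-shift : ∀ s f k i → χ k (rep∈ (shift s f ⟨$⟩ʳ i)) ≡ₚ χ k (rep∈ i) Z.+ digits s k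
        label-shift s f k i = ∣-cong (algebra (χ k (rep∈ i)) (χ k (b∈ s)) (digits s k) (χ k (rep∈ i′)) (χ k y∈)
            (trans (sym (χ-lin k z∈ (rep∈ i) (b∈ s) 1ℤ (one (rep i) (b s)))) (χ-lin k z∈ y∈ (rep∈ i′) 1ℤ
              (trans (solve 3 (λ r b d → r :+ b := (r :+ b :- d) :+ d) refl (rep i) (b s) (rep i′)) (one (rep i + b s - rep i′) (rep i′))))))
            (ℤD.∣m∣n⇒∣m-n (proj₂ (proj₂ (χ-onto (digits s))) k) (χ-InZ k (proj₂ (proj₁ (f i))) y∈))
          where
          i′ : Fin n
          i′ = proj₁ (proj₁ (f i))
          z∈ : O (rep i + b s)
          z∈ = O-+ (rep∈ i) (b∈ s)
          y∈ : O (rep i + b s - rep i′)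
          y∈ = IsZModule.sub O-module z∈ (rep∈ i′)
          one : ∀ x y → x + y ≡ x + jz 1ℤ * y
          one x y = cong (x +_) (sym (trans (cong (_* y) jz-1) (*-identityˡ y)))
          algebra : ∀ r b s r′ y → r Z.+ 1ℤ Z.* b ≡ y Z.+ 1ℤ Z.* r′ → (b Z.- s) Z.- y ≡ r′ Z.- (r Z.+ s)
          algebra r b s r′ y e = trans (ℤR.solve 4 (λ r b s y → (b ℤR.:- s) ℤR.:- y ℤR.:= (r ℤR.:+ ℤR.con 1ℤ ℤR.:* b) ℤR.:- r ℤR.:- s ℤR.:- y) refl r b s y)
            (trans (cong (λ w → w Z.- r Z.- s Z.- y) e) (ℤR.solve 4 (λ r r′ s y → (y ℤR.:+ ℤR.con 1ℤ ℤR.:* r′) ℤR.:- r ℤR.:- s ℤR.:- y ℤR.:= r′ ℤR.:- (r ℤR.:+ s)) refl r r′ s y))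
        residue-digit : ∀ s k → residue (digits s k) ≡ finToFun {p} {v} s k
        residue-digit s k = FinP.toℕ-injective (small-≡ (FinP.toℕ<n (residue (digits s k))) (FinP.toℕ<n (finToFun {p} {v} s k))
          (≡ₚ-sym {digits s k} {Z.+ toℕ (residue (digits s k))} (≡ₚ-residue (digits s k))))
        to : ∀ s f i → label (shift s f ⟨$⟩ʳ i) ≡ s → label i ≡ origin
        to s f i e = funToFin-cong λ k → residue-cong {χ k (rep∈ i)} {0ℤ} (∣-cong
            (ℤR.solve 3 (λ a b c → (b ℤR.:- c) ℤR.:- (b ℤR.:- (a ℤR.:+ c)) ℤR.:= a ℤR.:- ℤR.con 0ℤ) refl (χ k (rep∈ i)) (χ k (rep∈ i′)) (digits s k))
            (ℤD.∣m∣n⇒∣m-n (residue-injective {χ k (rep∈ i′)} {digits s k}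
              (trans (sym (FinP.finToFun-funToFin (λ k → residue (χ k (rep∈ i′))) k)) (trans (cong (λ w → finToFun {p} {v} w k) e) (sym (residue-digit s k)))))
              (label-shift s f k i)))
          where
          i′ : Fin n
          i′ = shift s f ⟨$⟩ʳ i
        from : ∀ s f i → label i ≡ origin → label (shift s f ⟨$⟩ʳ i) ≡ s
        from s f i e = trans (funToFin-cong λ k → trans (residue-cong {χ k (rep∈ i′)} {digits s k} (∣-cong
            (ℤR.solve 3 (λ a b c → (b ℤR.:- (a ℤR.:+ c)) ℤR.:+ (a ℤR.:- ℤR.con 0ℤ) ℤR.:= b ℤR.:- c) refl (χ k (rep∈ i)) (χ k (rep∈ i′)) (digits s k))
            (ℤD.∣m∣n⇒∣m+n (label-shift s f k i) (residue-injective {χ k (rep∈ i)} {0ℤ}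
              (trans (sym (FinP.finToFun-funToFin (λ k → residue (χ k (rep∈ i))) k)) (trans (cong (λ w → finToFun {p} {v} w k) e) (FinP.finToFun-funToFin {v} {p} (λ _ → residue 0ℤ) k)))))))
            (residue-digit s k)) (FinP.funToFin-finToFin {v} {p} s)
          where
          i′ : Fin n
          i′ = shift s f ⟨$⟩ʳ i

    abs-scale : ∀ {Q} → IsZModule Q → ∀ z {x} → Q (jz z * x) → Q (jₙ Z.∣ z ∣ * x)
    abs-scale {Q} MQ z {x} q with ℤP.+∣i∣≡i⊎+∣i∣≡-i z
    ... | inj₁ e = subst Q (cong (λ w → jz w * x) (sym e)) q
    ... | inj₂ e = subst Q (trans (-‿distribˡ-* (jz z) x) (cong (_* x) (trans (sym (jz-neg z)) (cong jz (sym e))))) (IsZModule.neg MQ q)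

    -- With B = ℤ[α] + Σ ℤ wₖ, the last hypothesis says Λ ⊆ B + pΛ. Nakayama then gives u′ Λ ⊆ B
    -- with u′ ≡ 1 modulo p, so the index of B in O is prime to p, while p wₖ ∈ ℤ[α] makes the index
    -- of ℤ[α] in B divide p^v.
    module UpperBound (α : K) (α∈ : Λ α) (w : Fin v → K) (w∈ : ∀ k → O (w k)) (Pw∈ : ∀ k → InZ[ α ] (P * w k))
      (generates-mod-p : ∀ i → ∃ λ l → Λ l × adjoinAll InZ[ α ] w (gen i - P * l)) where

      B : K → Set
      B = adjoinAll InZ[ α ] w

      private
        MA : IsZModule InZ[ α ]
        MA = InZ-module α
        MB : IsZModule B
        MB = adjoinAll-module MA w
        α∈O : O α
        α∈O = Λ⇒O α∈

      abstract
        nak : ∃ λ m′ → ∀ (i : Fin 6) → B (jz (1ℤ Z.+ (Z.+ p) Z.* m′) * gen i)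
        nak = ElimModP.nakayama B MB 6 gen a λ i → subst B (cong (gen i +_) (trans (-‿distribʳ-* P (l i)) (cong (P *_) (neg-l i)))) (proj₂ (proj₂ (generates-mod-p i)))
          where
          l : Fin 6 → K
          l i = proj₁ (generates-mod-p i)
          l∈ : ∀ i → Λ (l i)
          l∈ i = proj₁ (proj₂ (generates-mod-p i))
          a : Fin 6 → Fin 6 → ℤ
          a i k = proj₁ (ξ-int (Λ-neg (l∈ i)) k)
          neg-l : ∀ i → - l i ≡ sum (λ k → jz (a i k) * gen k)
          neg-l i = trans (sum≡ (ξ-expand (- l i))) (sum-cong-≗ λ k → cong (λ q → j q * gen k) (proj₂ (ξ-int (Λ-neg (l∈ i)) k)))

      u′ : ℤ
      u′ = 1ℤ Z.+ (Z.+ p) Z.* proj₁ nak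

      Λ⇒B : ∀ {x} → Λ x → B (jz u′ * x)
      Λ⇒B {x} x∈ = IsZModule.combination {Q = λ y → B (jz u′ * y)} Q (ξ-expand x) (ξ-int x∈) (proj₂ nak)
        where
        Q : IsZModule (λ y → B (jz u′ * y))
        Q = record
          { zero∈ = subst B (sym (zeroʳ (jz u′))) (IsZModule.zero∈ MB)
          ; add = λ {x} {y} p q → subst B (sym (distribˡ (jz u′) x y)) (IsZModule.add MB p q)
          ; scale = λ z {x} p → subst B (solve 3 (λ z u x → z :* (u :* x) := u :* (z :* x)) refl (jz z) (jz u′) x) (IsZModule.scale MB z p) }

      -- An annihilator of O/B that is congruent to 1 or -1 modulo p.
      d : ℕ
      d = Z.∣ u′ Z.* u ∣

      p∤d : ¬ (p ℕD.∣ d)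
      p∤d h = contradiction (ℕD.∣1⇒≡1 (ℤD.∣⇒∣ᵤ {Z.+ p} {1ℤ} (∣-cong {y = 1ℤ} (expand-u (Z.+ p) (proj₁ nak) m)
          (ℤD.∣m∣n⇒∣m-n (ℤD.∣ᵤ⇒∣ {Z.+ p} {u′ Z.* u} h) (ℤD.∣m⇒∣m*n (proj₁ nak Z.+ m Z.+ (proj₁ nak Z.* (Z.+ p)) Z.* m) ℤD.∣-refl))))) (ℕP.>⇒≢ 1<p)
        where
        expand-u : ∀ p a b → (1ℤ Z.+ p Z.* a) Z.* (1ℤ Z.+ p Z.* b) Z.- p Z.* (a Z.+ b Z.+ (a Z.* p) Z.* b) ≡ 1ℤ
        expand-u = ℤR.solve 3 (λ p a b → (ℤR.con 1ℤ ℤR.:+ p ℤR.:* a) ℤR.:* (ℤR.con 1ℤ ℤR.:+ p ℤR.:* b) ℤR.:- p ℤR.:* (a ℤR.:+ b ℤR.:+ (a ℤR.:* p) ℤR.:* b) ℤR.:= ℤR.con 1ℤ) refl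

      p∤d^ : ∀ k → ¬ (p ℕD.∣ d ℕ.^ k)
      p∤d^ zero    h = contradiction (ℕD.∣1⇒≡1 h) (ℕP.>⇒≢ 1<p)
      p∤d^ (suc k) h with euclidsLemma d (d ℕ.^ k) prime h
      ... | inj₁ h′ = p∤d h′
      ... | inj₂ h′ = p∤d^ k h′

      d≢0 : NonZero d
      d≢0 = ℕ.≢-nonZero λ e → p∤d (subst (p ℕD.∣_) (sym e) (p ℕD.∣0))

      O⇒B : ∀ {x} → O x → B (jₙ d * x)
      O⇒B {x} x∈ = abs-scale MB (u′ Z.* u) (subst B (trans (sym (*-assoc (jz u′) U x)) (cong (_* x) (sym (jz-* u′ u)))) (Λ⇒B (O⇒UΛ x∈)))

      -- As d p O ⊆ ℤ[θ], the module O has a basis, and so arises from B by adjoining six elements.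
      O-lattice : LatticeK powerBasis O
      O-lattice = record
        { add = O-+ ; scale = IsZModule.scale O-module ; int = Zθ⇒O
        ; D = d ℕ.* p ; D≢0 = ℕP.m*n≢0 d p {{d≢0}}
        ; bound = λ {x} x∈ → subst Zθ (trans (sym (*-assoc (jₙ d) P x)) (cong (_* x) (sym (jₙ-* d p)))) (abs-scale Zθ-module (u′ Z.* u)
            (subst Zθ (trans (solve 4 (λ u′ P u x → u′ :* (P :* (u :* x)) := (u′ :* u) :* (P :* x)) refl (jz u′) P U x) (cong (_* (P * x)) (sym (jz-* u′ u)))) (Zθ-scale u′ (proj₂ local-denominator x∈)))) }

      -- The chain ℤ[α] ⊆ B ⊆ O: B adjoins v elements of order dividing p, and O adjoins to B a
      -- basis of O, whose members have order dividing d.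
      finite-index : ¬ ¬ ∃ λ n → n ℕD.∣ d ℕ.^ 6 ℕ.* p ℕ.^ v × HasIndex InZ[ α ] O n
      finite-index h = index-adjoinAll v MA MA (λ a → a) (trivial-index MA) w p p≢0 Pw∈ λ { (n₁ , n₁∣ , H₁) →
        dualBasisK O-lattice λ D → index-adjoinAll 6 MA MB (⊆adjoinAll w) H₁ (DualBasisK.t D) d d≢0 (λ i → O⇒B (DualBasisK.t∈ D i)) λ { (n₂ , n₂∣ , H₂) →
        h (n₂ , ℕD.∣-trans n₂∣ (ℕD.*-monoʳ-∣ (d ℕ.^ 6) (subst (n₁ ℕD.∣_) (ℕP.*-identityʳ (p ℕ.^ v)) n₁∣)) , record
          { rep = HasIndex.rep H₂
          ; rep∈ = λ i → adjoinAll-elim O-module (adjoinAll-elim O-module (InZ⇒O α α∈O) w w∈) (DualBasisK.t D) (DualBasisK.t∈ D) (HasIndex.rep∈ H₂ i)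
          ; cover = λ x∈ → HasIndex.cover H₂ (IsZModule.combination (adjoinAll-module MB (DualBasisK.t D)) (DualBasisK.s-expand D _) (DualBasisK.s-int D x∈) (∈adjoinAll MB (DualBasisK.t D)))
          ; uniq = HasIndex.uniq H₂ }) } }

      p^[1+v]∤ : ∀ {n} → n ℕD.∣ d ℕ.^ 6 ℕ.* p ℕ.^ v → ¬ (p ℕ.^ suc v ℕD.∣ n)
      p^[1+v]∤ n∣ h = p∤d^ 6 (ℕD.*-cancelʳ-∣ (p ℕ.^ v) {{ℕP.m^n≢0 p v}} (ℕD.∣-trans h n∣))

      -- This amounts to K = ℚ(α): D clears the denominators of x, d takes O into B, and p takes B
      -- into ℤ[α].
      denominator-InZ : ∀ x → ∃ λ D → NonZero D × InZ[ α ] (jₙ D * x)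
      denominator-InZ x = p ℕ.* (d ℕ.* D) , ℕP.m*n≢0 p (d ℕ.* D) {{p≢0}} {{ℕP.m*n≢0 d D {{d≢0}} {{proj₁ (proj₂ (denominator x))}}}} ,
          subst InZ[ α ] (trans (cong (λ w → P * w) (sym (*-assoc (jₙ d) (jₙ D) x))) (trans (sym (*-assoc P (jₙ d * jₙ D) x)) (cong (_* x) (sym (trans (jₙ-* p (d ℕ.* D)) (cong (P *_) (jₙ-* d D)))))))
            (adjoinAll-elim PQ (IsZModule.scale MA (Z.+ p)) w Pw∈ (O⇒B (Zθ⇒O (proj₂ (proj₂ (denominator x))))))
        where
        D : ℕ
        D = proj₁ (denominator x)
        PQ : IsZModule (λ y → InZ[ α ] (P * y))
        PQ = record
          { zero∈ = subst InZ[ α ] (sym (zeroʳ P)) (IsZModule.zero∈ MA)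
          ; add = λ {x} {y} p q → subst InZ[ α ] (sym (distribˡ P x y)) (IsZModule.add MA p q)
          ; scale = λ z {x} p → subst InZ[ α ] (solve 3 (λ z u x → z :* (u :* x) := u :* (z :* x)) refl (jz z) P x) (IsZModule.scale MA z p) }

-- Tools for the two maximal orders.

-- gen = Y · (1, θ, …, θ⁵), and X is the inverse of Y.
module MatrixBasis (S : Setting) (C : Congruence S) (X : Fin 6 → Fin 6 → ℚ) (Y : Fin 6 → Fin 6 → ℚ)
  (XY : ∀ i k → sumℚ (λ l → Y k l ℚ.* X i l) ≡ δ i k) (YX : ∀ l k → sumℚ (λ i → X i k ℚ.* Y i l) ≡ δ l k)
  (X-int : ∀ i k → Int (X i k)) where
  open Setting S
  open Scalars powerBasis
  open Integrality S
  open Local S C using (coef-ext)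
  open Orders S C
  open Solver using (_:+_; _:*_; con; _:^_; Polynomial)

  private
    ξ′ : Fin 6 → K → ℚ
    ξ′ i x = sumℚ (λ k → X i k ℚ.* coef k x)

    gen′ : Fin 6 → K
    gen′ k = sum (λ l → j (Y k l) * θ ^ toℕ l)

    ξ′-linear : ∀ i → Linear (ξ′ i)
    ξ′-linear i = record
      { lin-+ = λ x y → trans (sumℚ-cong λ k → trans (cong (X i k ℚ.*_) (coef-+ k x y)) (ℚP.*-distribˡ-+ (X i k) (coef k x) (coef k y))) (sumℚ-+ (λ k → X i k ℚ.* coef k x) (λ k → X i k ℚ.* coef k y))
      ; lin-j = λ q x → trans (sumℚ-cong λ k → trans (cong (X i k ℚ.*_) (coef-j k q x)) (swap (X i k) q (coef k x))) (sym (*-sumℚ q (λ k → X i k ℚ.* coef k x))) }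
      where
      swap : ∀ a b c → a ℚ.* (b ℚ.* c) ≡ b ℚ.* (a ℚ.* c)
      swap a b c = trans (sym (ℚP.*-assoc a b c)) (trans (cong (ℚ._* c) (ℚP.*-comm a b)) (ℚP.*-assoc b a c))

    coef-gen : ∀ l k → coef l (gen′ k) ≡ Y k l
    coef-gen l k = trans (Linear.lin-sum (coef-linear l) (λ i → j (Y k i) * θ ^ toℕ i))
      (trans (sumℚ-cong λ i → trans (coef-j l (Y k i) (θ ^ toℕ i)) (cong (Y k i ℚ.*_) (coef-θ^ l i))) (sumℚ-δ (Y k) l))

    coef-expansion : ∀ x l → coef l x ≡ coef l (sum (λ i → j (ξ′ i x) * gen′ i))
    coef-expansion x l = sym (trans (Linear.lin-sum (coef-linear l) (λ i → j (ξ′ i x) * gen′ i)) (trans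
      (sumℚ-cong λ i → trans (coef-j l (ξ′ i x) (gen′ i)) (trans (cong (ξ′ i x ℚ.*_) (coef-gen l i)) (sumℚ-* (Y i l) (λ k → X i k ℚ.* coef k x))))
      (trans (sumℚ-comm (λ i k → X i k ℚ.* coef k x ℚ.* Y i l)) (trans
        (sumℚ-cong λ k → trans (sumℚ-cong λ i → rotate (X i k) (coef k x) (Y i l)) (trans (sym (*-sumℚ (coef k x) (λ i → X i k ℚ.* Y i l))) (cong (coef k x ℚ.*_) (YX l k))))
        (sumℚ-δ (λ k → coef k x) l)))))
      where
      rotate : ∀ a b c → a ℚ.* b ℚ.* c ≡ b ℚ.* (a ℚ.* c)
      rotate a b c = trans (cong (ℚ._* c) (ℚP.*-comm a b)) (ℚP.*-assoc b a c)

  abstract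
    basis : Basis
    basis = record
      { ξ = ξ′
      ; ξ-linear = ξ′-linear
      ; gen = gen′
      ; ξ-expand = λ x → isSum (coef-ext (coef-expansion x))
      ; ξ-gen = λ i k → trans (sumℚ-cong λ l → trans (ℚP.*-comm (X i l) (coef l (gen′ k))) (cong (ℚ._* X i l) (coef-gen l k))) (XY i k) }

  open Basis basis

  abstract
    gen-row : ∀ k {x} → sum (λ l → j (Y k l) * θ ^ toℕ l) ≡ x + 0# → gen k ≡ x
    gen-row k {x} e = trans e (+-identityʳ x)

    Zθ⇒Λ : ∀ {x} → Zθ x → Λ x
    Zθ⇒Λ x∈ = λλ λ i → Int-sum λ k → Int-* (X-int i k) (coef-int x∈ k)

  -- The solver's copy of the sum that defines `gen k`. The variable o stands for the closing `0#`,
  -- because the solver's constant 0 denotes `j 0ℚ`; for the same reason t^0 is what denotes `1#`.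
  row : ∀ {n} → Fin 6 → Polynomial n → Polynomial n → Polynomial n
  row k t o = con (Y k 0F) :* t :^ 0 :+ (con (Y k 1F) :* t :^ 1 :+ (con (Y k 2F) :* t :^ 2 :+
    (con (Y k 3F) :* t :^ 3 :+ (con (Y k 4F) :* t :^ 4 :+ (con (Y k 5F) :* t :^ 5 :+ o)))))

  Λ-combination : ∀ {Q : K → Set} → IsZModule Q → (∀ k → Q (gen k)) → ∀ {x} → Λ x → Q x
  Λ-combination {Q} MQ h {x} x∈ = IsZModule.combination {Q = Q} MQ (ξ-expand x) (ξ-int x∈) h

module RingTools (S : Setting) where
  open Setting S
  open Scalars powerBasis
  open Integrality S
  open Solver using (solve; _:=_; _:+_; _:*_; _:-_; :-_; con; _:^_)

  -- Integers in the form in which the ring solver evaluates them.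
  cₙ : ℕ → K
  cₙ k = j (ι₀ (Z.+ k))

  Zθ-c : ∀ k → Zθ (cₙ k)
  Zθ-c k = subst Zθ (cong j (ι≡ι₀ (Z.+ k))) (Zθ-jz (Z.+ k))

  Zθ-θ : Zθ θ
  Zθ-θ = subst Zθ (trans (*-comm θ 1#) (*-identityˡ θ)) (Zθ-θ^ 1)

  scaled-module : ∀ {Q} → IsZModule Q → ∀ c → IsZModule (λ y → Q (c * y))
  scaled-module {Q} M c = record
    { zero∈ = subst Q (sym (zeroʳ c)) zero∈
    ; add = λ {x} {y} p q → subst Q (sym (distribˡ c x y)) (add p q)
    ; scale = λ z {x} p → subst Q (solve 3 (λ z u x → z :* (u :* x) := u :* (z :* x)) refl (jz z) c x) (scale z p) }
    where open IsZModule M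

  subgroup⇒module : ∀ {Q : K → Set} → Q 0# → (∀ {x y} → Q x → Q y → Q (x + y)) → (∀ {x} → Q x → Q (- x)) → IsZModule Q
  subgroup⇒module {Q} q0 q+ q- = record { zero∈ = q0 ; add = q+ ; scale = scale }
    where
    natural : ∀ n {x} → Q x → Q (jₙ n * x)
    natural zero {x} p = subst Q (sym (trans (cong (_* x) (trans (cong j (ι≡ι₀ 0ℤ)) j-0)) (zeroˡ x))) q0
    natural (suc n) {x} p = subst Q (sym (trans (cong (_* x) (trans (jz-+ 1ℤ (Z.+ n)) (cong (_+ jₙ n) jz-1))) (trans (distribʳ x 1# (jₙ n)) (cong (_+ jₙ n * x) (*-identityˡ x))))) (q+ p (natural n p))
    scale : ∀ z {x} → Q x → Q (jz z * x)
    scale (Z.+ n) p = natural n p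
    scale Z.-[1+ n ] {x} p = subst Q (trans (-‿distribˡ-* (jₙ (suc n)) x) (cong (_* x) (sym (jz-neg (Z.+ suc n))))) (q- (natural (suc n) p))

  *-^ : ∀ x y n → (x * y) ^ n ≡ x ^ n * y ^ n
  *-^ x y zero    = sym (*-identityˡ 1#)
  *-^ x y (suc n) = trans (cong (x * y *_) (*-^ x y n)) (solve 4 (λ x y X Y → x :* y :* (X :* Y) := x :* X :* (y :* Y)) refl x y (x ^ n) (y ^ n))

  -- If x is integral then a power of P x lies in P Λ; when z^q ≡ z modulo J this forces P x ∈ J.
  module Nilpotent (Λ J : K → Set) (Λ-module : IsZModule Λ) (Λ-1 : Λ 1#) (Λ-* : ∀ {x y} → Λ x → Λ y → Λ (x * y))
    (J-module : IsZModule J) (Λ*J : ∀ {x y} → Λ x → J y → J (x * y))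
    (P : K) (P∈ : Λ P) (PΛ⊆J : ∀ {x} → Λ x → J (P * x)) (q : ℕ) (power : ∀ {z} → Λ z → J (z ^ suc (suc q) - z)) where

    private
      Λ-^ : ∀ {x} k → Λ x → Λ (x ^ k)
      Λ-^ zero    x∈ = Λ-1
      Λ-^ (suc k) x∈ = Λ-* x∈ (Λ-^ k x∈)

      Λ-jz : ∀ z → Λ (jz z)
      Λ-jz z = subst Λ (trans (*-comm (jz z) 1#) (*-identityˡ (jz z))) (IsZModule.scale Λ-module z Λ-1)

    module _ {x : K} (Px∈ : Λ (P * x)) where
      open PolynomialsIn x using (ev-∷ʳ-1)
      private
        z : K
        z = P * x

        -- Homogenisation: P^d x^i = P · P^(d-1-i) (P x)^i for i < d, so every term keeps a spare
        -- factor P.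
        scaled-ev : ∀ g → ∃ λ l → Λ l × P ^ length g * ev g x ≡ P * l
        scaled-ev [] = 0# , IsZModule.zero∈ Λ-module , trans (zeroʳ 1#) (sym (zeroʳ P))
        scaled-ev (c ∷ g) = P ^ length g * jz c + z * l , IsZModule.add Λ-module (Λ-* (Λ-^ (length g) P∈) (Λ-jz c)) (Λ-* Px∈ l∈) , (begin
          P * P ^ length g * (jz c + x * ev g x)
            ≡⟨ solve 5 (λ p n c x e → p :* n :* (c :+ x :* e) := p :* (n :* c) :+ p :* x :* (n :* e)) refl P (P ^ length g) (jz c) x (ev g x) ⟩
          P * (P ^ length g * jz c) + z * (P ^ length g * ev g x)  ≡⟨ cong (λ w → P * (P ^ length g * jz c) + z * w) e ⟩
          P * (P ^ length g * jz c) + z * (P * l)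
            ≡⟨ solve 4 (λ p n z l → p :* n :+ z :* (p :* l) := p :* (n :+ z :* l)) refl P (P ^ length g * jz c) z l ⟩
          P * (P ^ length g * jz c + z * l) ∎)
          where
          open ≡-Reasoning
          l : K
          l = proj₁ (scaled-ev g)
          l∈ : Λ l
          l∈ = proj₁ (proj₂ (scaled-ev g))
          e : P ^ length g * ev g x ≡ P * l
          e = proj₂ (proj₂ (scaled-ev g))

        reduce : ∀ k → J (z ^ suc (k ℕ.* suc q) - z)
        reduce zero = subst J (sym (trans (cong (_- z) (trans (*-comm z 1#) (*-identityˡ z))) (-‿inverseʳ z))) (IsZModule.zero∈ J-module)
        reduce (suc k) = subst J (trans
            (solve 4 (λ z Z Q o → Q :* (z :* Z :- z) :+ (z :* Q :- z) := z :* (Z :* Q) :- z) refl z (z ^ suc q) (z ^ (k ℕ.* suc q)) 1#)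
            (cong (λ w → z * w - z) (sym (PolynomialsIn.^-+ z (suc q) (k ℕ.* suc q)))))
          (IsZModule.add J-module (Λ*J (Λ-^ (k ℕ.* suc q) Px∈) (power Px∈)) (reduce k))

      integral⇒J : Integral x → J (P * x)
      integral⇒J (g , e) = subst J (solve 2 (λ a z → a :- (a :- z) := z) refl (z ^ suc (d ℕ.* suc q)) z)
          (IsZModule.sub J-module big (reduce d))
        where
        d : ℕ
        d = length g
        l : K
        l = proj₁ (scaled-ev g)
        z^d : z ^ d ≡ P * - l
        z^d = trans (*-^ P x d) (trans (cong (P ^ d *_) (+-inverseˡ-unique (x ^ d) (ev g x) (trans (sym (ev-∷ʳ-1 g)) e)))
          (trans (sym (-‿distribʳ-* (P ^ d) (ev g x))) (trans (cong -_ (proj₂ (proj₂ (scaled-ev g)))) (-‿distribʳ-* P l))))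
        -- As 1 + d (q + 1) = 1 + d q + d, this power contains z^d, which the monic relation puts
        -- into P Λ ⊆ J.
        big : J (z ^ suc (d ℕ.* suc q))
        big = Λ*J Px∈ (subst J (trans (trans (*-comm (z ^ (d ℕ.* q)) (z ^ d)) (sym (PolynomialsIn.^-+ z d (d ℕ.* q)))) (cong (z ^_) (sym (ℕP.*-suc d q))))
          (Λ*J (Λ-^ (d ℕ.* q) Px∈) (subst J (sym z^d) (PΛ⊆J (IsZModule.neg Λ-module (proj₁ (proj₂ (scaled-ev g))))))))

module ModuloP (S : Setting) (C : Congruence S) (𝔅 : Orders.Basis S C) (B : Setting.K S → Set) (B-module : Scalars.IsZModule (Setting.powerBasis S) B) where
  open Setting S
  open Scalars powerBasis
  open Local S C using (P)
  open Orders S C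
  open Basis 𝔅
  open Solver using (solve; _:=_; _:+_; _:*_; _:-_; :-_; con; _:^_)

  B+PΛ : K → Set
  B+PΛ x = ∃ λ l → Λ l × B (x - P * l)

  B⊆ : ∀ {x} → B x → B+PΛ x
  B⊆ {x} p = 0# , IsZModule.zero∈ Λ-module , subst B (sym (trans (cong (λ w → x - w) (zeroʳ P)) (trans (cong (x +_) -0#≈0#) (+-identityʳ x)))) p

  B+PΛ-module : IsZModule B+PΛ
  B+PΛ-module = record
    { zero∈ = B⊆ (IsZModule.zero∈ B-module)
    ; add = λ { {x} {y} (l , l∈ , p) (k , k∈ , q) → l + k , IsZModule.add Λ-module l∈ k∈ , subst B
        (solve 5 (λ x y P l k → (x :- P :* l) :+ (y :- P :* k) := (x :+ y) :- P :* (l :+ k)) refl x y P l k) (IsZModule.add B-module p q) }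
    ; scale = λ { z {x} (l , l∈ , p) → jz z * l , IsZModule.scale Λ-module z l∈ , subst B
        (solve 4 (λ z x P l → z :* (x :- P :* l) := z :* x :- P :* (z :* l)) refl (jz z) x P l) (IsZModule.scale B-module z p) } }

  -- `c` is P in whatever form the equation has it; the solver writes P as a constant `cₙ`.
  modulo : ∀ {x y l c} → c ≡ P → B+PΛ y → Λ l → x ≡ y + c * l → B+PΛ x
  modulo {x} {y} {l} refl (k , k∈ , p) l∈ e = k + l , IsZModule.add Λ-module k∈ l∈ , subst B
    (trans (solve 4 (λ y P k l → y :- P :* k := (y :+ P :* l) :- P :* (k :+ l)) refl y P k l) (cong (λ w → w - P * (k + l)) (sym e))) p

module SixthPower (S : Setting) (C : Congruence S) (N : ℕ) .{{_ : NonZero N}} (σ : Fin 6 → ℤ)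
  (τ-zero : Setting.τ S zero ≡ 1ℤ Z.+ (Z.+ N) Z.* σ zero) (τ-suc : ∀ i → Setting.τ S (suc i) ≡ (Z.+ N) Z.* σ (suc i)) where
  open Setting S
  open Scalars powerBasis
  open Integrality S
  open Local S C using (coef-θ⁶)

  quotient∈ : Zθ (j (recip N) * (θ ^ 6 - 1#))
  quotient∈ = zθ λ i → σ i , trans (coef-j i (recip N) (θ ^ 6 - 1#)) (trans (cong (recip N ℚ.*_) (trans (coef-+ i (θ ^ 6) (- 1#))
      (trans (cong₂ ℚ._+_ (coef-θ⁶ i) (trans (Linear.lin-neg (coef-linear i) 1#) (cong ℚ.-_ (coef-θ^ i zero)))) (difference i))))
      (trans (sym (ℚP.*-assoc (recip N) (ιₙ N) (ι (σ i)))) (trans (cong (ℚ._* ι (σ i)) (recip-inverse N)) (ℚP.*-identityˡ (ι (σ i))))))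
    where
    cancel : ∀ a → 1ℚ ℚ.+ a ℚ.+ ℚ.- 1ℚ ≡ a
    cancel a = trans (cong (ℚ._+ ℚ.- 1ℚ) (ℚP.+-comm 1ℚ a)) (trans (ℚP.+-assoc a 1ℚ (ℚ.- 1ℚ)) (ℚP.+-identityʳ a))
    difference : ∀ i → ι (τ i) ℚ.+ ℚ.- (δ i (zero {5})) ≡ ιₙ N ℚ.* ι (σ i)
    difference zero    = trans (cong (ℚ._+ ℚ.- 1ℚ) (trans (cong ι τ-zero) (trans (ι-+ 1ℤ _) (cong₂ ℚ._+_ (ι≡ι₀ 1ℤ) (ι-* (Z.+ N) (σ zero)))))) (cancel (ιₙ N ℚ.* ι (σ zero)))
    difference (suc i) = trans (ℚP.+-identityʳ (ι (τ (suc i)))) (trans (cong ι (τ-suc i)) (ι-* (Z.+ N) (σ (suc i))))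

-- The prime 2.

-- The 2-maximal order: κ = (θ³ − 1)/2 satisfies κ² + κ = 2s where 8s = θ⁶ − 1, so that
-- Λ/2Λ = 𝔽₂[θ, κ]/(θ³ − 1, κ² + κ).
module AtTwo (S : Setting) (σ : Fin 6 → ℤ)
  (τ-zero : Setting.τ S zero ≡ 1ℤ Z.+ (Z.+ 8) Z.* σ zero) (τ-suc : ∀ i → Setting.τ S (suc i) ≡ (Z.+ 8) Z.* σ (suc i)) where

  -- 6 = 2 · 3 and 3 · 1 = 1 + 2 · 1. Here p² = 4 is extracted and the third factor 2 of the 8 moves
  -- into σ; that factor returns as the 2 in κ² + κ = 2s.
  congruence : Congruence S
  congruence = record
    { p = 2 ; p≢0 = _ ; ε = Z.+ 3 ; ε⁻¹ = 1ℤ ; k = 1ℤ ; pε≡6 = refl ; εε⁻¹ = refl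
    ; σ = λ i → (Z.+ 2) Z.* σ i
    ; τ-zero = trans τ-zero (cong (λ w → 1ℤ Z.+ w) (eight (σ zero)))
    ; τ-suc = λ i → trans (τ-suc i) (eight (σ (suc i))) }
    where
    eight : ∀ x → (Z.+ 8) Z.* x ≡ (Z.+ 2) Z.* ((Z.+ 2) Z.* ((Z.+ 2) Z.* x))
    eight = ℤR.solve 1 (λ x → ℤR.con (Z.+ 8) ℤR.:* x ℤR.:= ℤR.con (Z.+ 2) ℤR.:* (ℤR.con (Z.+ 2) ℤR.:* (ℤR.con (Z.+ 2) ℤR.:* x))) refl

  open Setting S
  open Scalars powerBasis
  open Integrality S
  open Lattices S
  open RingTools S
  open Local S congruence using (P)
  open Orders S congruence
  open SixthPower S congruence 8 σ τ-zero τ-suc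
  open Solver using (solve; _:=_; _:+_; _:*_; _:-_; :-_; con; _:^_; Polynomial)

  private
    -½ : ℚ
    -½ = ℚ.- ℚ.½

    2ℚ : ℚ
    2ℚ = ι₀ (Z.+ 2)

    -- The rows of `Y` are 1, θ, θ², κ, θκ, θ²κ; the columns of `X` expand the powers of θ in them
    -- by means of θ³ = 1 + 2κ.
    X Y : Fin 6 → Fin 6 → ℚ
    X i k = lookup (lookup ((1ℚ ∷ 0ℚ ∷ 0ℚ ∷ 1ℚ ∷ 0ℚ ∷ 0ℚ ∷ []) ∷ (0ℚ ∷ 1ℚ ∷ 0ℚ ∷ 0ℚ ∷ 1ℚ ∷ 0ℚ ∷ []) ∷ (0ℚ ∷ 0ℚ ∷ 1ℚ ∷ 0ℚ ∷ 0ℚ ∷ 1ℚ ∷ [])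
      ∷ (0ℚ ∷ 0ℚ ∷ 0ℚ ∷ 2ℚ ∷ 0ℚ ∷ 0ℚ ∷ []) ∷ (0ℚ ∷ 0ℚ ∷ 0ℚ ∷ 0ℚ ∷ 2ℚ ∷ 0ℚ ∷ []) ∷ (0ℚ ∷ 0ℚ ∷ 0ℚ ∷ 0ℚ ∷ 0ℚ ∷ 2ℚ ∷ []) ∷ []) i) k
    Y k l = lookup (lookup ((1ℚ ∷ 0ℚ ∷ 0ℚ ∷ 0ℚ ∷ 0ℚ ∷ 0ℚ ∷ []) ∷ (0ℚ ∷ 1ℚ ∷ 0ℚ ∷ 0ℚ ∷ 0ℚ ∷ 0ℚ ∷ []) ∷ (0ℚ ∷ 0ℚ ∷ 1ℚ ∷ 0ℚ ∷ 0ℚ ∷ 0ℚ ∷ [])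
      ∷ (-½ ∷ 0ℚ ∷ 0ℚ ∷ ℚ.½ ∷ 0ℚ ∷ 0ℚ ∷ []) ∷ (0ℚ ∷ -½ ∷ 0ℚ ∷ 0ℚ ∷ ℚ.½ ∷ 0ℚ ∷ []) ∷ (0ℚ ∷ 0ℚ ∷ -½ ∷ 0ℚ ∷ 0ℚ ∷ ℚ.½ ∷ []) ∷ []) k) l

  abstract
    XY : ∀ i k → sumℚ (λ l → Y k l ℚ.* X i l) ≡ δ i k
    XY = from-yes (FinP.all? λ i → FinP.all? λ k → sumℚ (λ l → Y k l ℚ.* X i l) ℚP.≟ δ i k)

    YX : ∀ l k → sumℚ (λ i → X i k ℚ.* Y i l) ≡ δ l k
    YX = from-yes (FinP.all? λ l → FinP.all? λ k → sumℚ (λ i → X i k ℚ.* Y i l) ℚP.≟ δ l k)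

    X-int : ∀ i k → Int (X i k)
    X-int i k = ℚ.↥ X i k , trans (from-yes (FinP.all? λ i → FinP.all? λ k → X i k ℚP.≟ ι₀ (ℚ.↥ X i k)) i k) (sym (ι≡ι₀ _))

  open MatrixBasis S congruence X Y XY YX X-int
  open Basis basis

  -- Modulo 2, η is the idempotent of the factor 𝔽₂ on which θ = 1 and κ = 0: 1 + θ + θ² selects θ =
  -- 1, and κ + 1 selects κ = 0.
  κ s η : K
  κ = j ℚ.½ * (θ ^ 3 - 1#)
  s = j (recip 8) * (θ ^ 6 - 1#)
  η = (1# + θ + θ ^ 2) * (κ + 1#)

  module Formal where
    c : ∀ {n} → ℕ → Polynomial n
    c k = con (ι₀ (Z.+ k))
    κ̂ ŝ η̂ q̂ σ̂ τ̂ α̂ : ∀ {n} → Polynomial n → Polynomial n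
    κ̂ t = con ℚ.½ :* (t :^ 3 :- t :^ 0)
    ŝ t = con (recip 8) :* (t :^ 6 :- t :^ 0)
    η̂ t = (t :^ 0 :+ t :+ t :^ 2) :* (κ̂ t :+ t :^ 0)
    q̂ t = c 5 :* t :^ 0 :+ c 4 :* t :+ c 3 :* t :^ 2 :+ c 2 :* t :^ 3 :+ t :^ 4
    σ̂ t = ŝ t :* q̂ t
    τ̂ t = c 4 :* ŝ t :+ σ̂ t
    α̂ t = t :+ η̂ t
  open Formal

  P≡ : cₙ 2 ≡ P
  P≡ = cong j (sym (ι≡ι₀ (Z.+ 2)))

  private
    gen-0 : gen 0F ≡ 1#
    gen-0 = gen-row 0F (solve 2 (λ t o → row 0F t o := t :^ 0 :+ o) refl θ 0#)
    gen-1 : gen 1F ≡ θ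
    gen-1 = gen-row 1F (solve 2 (λ t o → row 1F t o := t :+ o) refl θ 0#)
    gen-2 : gen 2F ≡ θ ^ 2
    gen-2 = gen-row 2F (solve 2 (λ t o → row 2F t o := t :^ 2 :+ o) refl θ 0#)
    gen-3 : gen 3F ≡ κ
    gen-3 = gen-row 3F (solve 2 (λ t o → row 3F t o := κ̂ t :+ o) refl θ 0#)
    gen-4 : gen 4F ≡ θ * κ
    gen-4 = gen-row 4F (solve 2 (λ t o → row 4F t o := t :* κ̂ t :+ o) refl θ 0#)
    gen-5 : gen 5F ≡ θ ^ 2 * κ
    gen-5 = gen-row 5F (solve 2 (λ t o → row 5F t o := t :^ 2 :* κ̂ t :+ o) refl θ 0#)

  by-gen : ∀ {Q : K → Set} → Q 1# → Q θ → Q (θ ^ 2) → Q κ → Q (θ * κ) → Q (θ ^ 2 * κ) → ∀ k → Q (gen k)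
  by-gen {Q} a b c d e f 0F = subst Q (sym gen-0) a
  by-gen {Q} a b c d e f 1F = subst Q (sym gen-1) b
  by-gen {Q} a b c d e f 2F = subst Q (sym gen-2) c
  by-gen {Q} a b c d e f 3F = subst Q (sym gen-3) d
  by-gen {Q} a b c d e f 4F = subst Q (sym gen-4) e
  by-gen {Q} a b c d e f 5F = subst Q (sym gen-5) f

  infixl 6 _⊞_
  _⊞_ : ∀ {x y} → Λ x → Λ y → Λ (x + y)
  _⊞_ = IsZModule.add Λ-module

  s∈Zθ : Zθ s
  s∈Zθ = quotient∈

  θκ∈ : Λ (θ * κ)
  θκ∈ = subst Λ gen-4 (gen∈Λ 4F)
  κ∈ : Λ κ
  κ∈ = subst Λ gen-3 (gen∈Λ 3F)
  θ²κ∈ : Λ (θ ^ 2 * κ)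
  θ²κ∈ = subst Λ gen-5 (gen∈Λ 5F)

  Λ-1 : Λ 1#
  Λ-1 = Zθ⇒Λ Zθ-1

  stable : ∀ a → (∀ k → Λ (a * gen k)) → ∀ {x} → Λ x → Λ (a * x)
  stable a h = Λ-combination (scaled-module Λ-module a) h

  θ-stable : ∀ {x} → Λ x → Λ (θ * x)
  θ-stable = stable θ (by-gen {λ y → Λ (θ * y)}
    (Zθ⇒Λ (Zθ-θ^ 1)) (Zθ⇒Λ (Zθ-θ* Zθ-θ)) (Zθ⇒Λ (Zθ-θ^ 3)) θκ∈
    (subst Λ (solve 1 (λ t → t :^ 2 :* κ̂ t := t :* (t :* κ̂ t)) refl θ) θ²κ∈)
    -- θ³κ = (1 + 2κ)κ = 4s - κ.
    (subst Λ (solve 1 (λ t → c 4 :* ŝ t :- κ̂ t := t :* (t :^ 2 :* κ̂ t)) refl θ) (Λ-sub (Zθ⇒Λ (Zθ-* (Zθ-c 4) s∈Zθ)) κ∈)))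

  Λ-κ² : Λ (cₙ 2 * s - κ)
  Λ-κ² = Λ-sub (Zθ⇒Λ (Zθ-* (Zθ-c 2) s∈Zθ)) κ∈

  κ-stable : ∀ {x} → Λ x → Λ (κ * x)
  κ-stable = stable κ (by-gen {λ y → Λ (κ * y)}
    (subst Λ (solve 1 (λ t → κ̂ t := κ̂ t :* t :^ 0) refl θ) κ∈)
    (subst Λ (*-comm θ κ) θκ∈) (subst Λ (*-comm (θ ^ 2) κ) θ²κ∈)
    (subst Λ (solve 1 (λ t → c 2 :* ŝ t :- κ̂ t := κ̂ t :* κ̂ t) refl θ) Λ-κ²)
    (subst Λ (solve 1 (λ t → t :* (c 2 :* ŝ t :- κ̂ t) := κ̂ t :* (t :* κ̂ t)) refl θ) (θ-stable Λ-κ²))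
    (subst Λ (solve 1 (λ t → t :* (t :* (c 2 :* ŝ t :- κ̂ t)) := κ̂ t :* (t :^ 2 :* κ̂ t)) refl θ) (θ-stable (θ-stable Λ-κ²))))

  gen-stable : ∀ k {y} → Λ y → Λ (gen k * y)
  gen-stable = by-gen {λ g → ∀ {y} → Λ y → Λ (g * y)} (λ {y} p → subst Λ (sym (*-identityˡ y)) p) θ-stable θ²-stable κ-stable
    (λ {y} p → subst Λ (sym (*-assoc θ κ y)) (θ-stable (κ-stable p))) (λ {y} p → subst Λ (sym (*-assoc (θ ^ 2) κ y)) (θ²-stable (κ-stable p)))
    where
    θ²-stable : ∀ {y} → Λ y → Λ (θ ^ 2 * y)
    θ²-stable {y} p = subst Λ (solve 2 (λ t y → t :* (t :* y) := t :^ 2 :* y) refl θ y) (θ-stable (θ-stable p))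

  Λ-* : ∀ {x y} → Λ x → Λ y → Λ (x * y)
  Λ-* {x} {y} x∈ y∈ = subst Λ (*-comm y x) (stable y (λ k → subst Λ (*-comm (gen k) y) (gen-stable k y∈)) x∈)

  Λ-c : ∀ k → Λ (cₙ k)
  Λ-c k = Zθ⇒Λ (Zθ-c k)

  pΛ⊆Zθ : ∀ {x} → Λ x → Zθ (P * x)
  pΛ⊆Zθ = Λ-combination (scaled-module Zθ-module P) (by-gen {λ y → Zθ (P * y)}
    (Zθ-scale (Z.+ 2) Zθ-1) (Zθ-scale (Z.+ 2) Zθ-θ) (Zθ-scale (Z.+ 2) (Zθ-θ^ 2))
    (via (solve 1 (λ t → t :^ 3 :- t :^ 0 := c 2 :* κ̂ t) refl θ) (Zθ-sub (Zθ-θ^ 3) Zθ-1))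
    (via (solve 1 (λ t → t :^ 4 :- t := c 2 :* (t :* κ̂ t)) refl θ) (Zθ-sub (Zθ-θ^ 4) Zθ-θ))
    (via (solve 1 (λ t → t :^ 5 :- t :^ 2 := c 2 :* (t :^ 2 :* κ̂ t)) refl θ) (Zθ-sub (Zθ-θ^ 5) (Zθ-θ^ 2))))
    where
    via : ∀ {x y} → x ≡ cₙ 2 * y → Zθ x → Zθ (P * y)
    via {y = y} e = subst Zθ (trans e (cong (_* y) P≡))

  -- Λ/2Λ has no nilpotents, so the radical is 2Λ itself and all six coordinates survive in the
  -- quotient.
  J : K → Set
  J x = ∃ λ l → Λ l × x ≡ P * l

  J-module : IsZModule J
  J-module = record
    { zero∈ = 0# , Λ-0 , sym (zeroʳ P)
    ; add = λ { (a , a∈ , refl) (b , b∈ , refl) → a + b , a∈ ⊞ b∈ , sym (distribˡ P a b) }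
    ; scale = λ { z (a , a∈ , refl) → jz z * a , Λ-scale z a∈ , solve 3 (λ z p a → z :* (p :* a) := p :* (z :* a)) refl (jz z) P a } }

  Λ*J : ∀ {x y} → Λ x → J y → J (x * y)
  Λ*J {x} x∈ (l , l∈ , refl) = x * l , Λ-* x∈ l∈ , solve 3 (λ x p l → x :* (p :* l) := p :* (x :* l)) refl x P l

  twice : ∀ {x l} → Λ l → x ≡ cₙ 2 * l → J x
  twice {l = l} l∈ e = l , l∈ , trans e (cong (_* l) P≡)

  -- Squaring is additive modulo 2, so the solutions of z⁴ ≡ z form a subring, and 1, θ and κ are
  -- the only elements to test.
  Frobenius : K → Set
  Frobenius z = Λ z × J (z ^ 4 - z)

  frobenius-* : ∀ {x y} → Frobenius x → Frobenius y → Frobenius (x * y)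
  frobenius-* {x} {y} (x∈ , p) (y∈ , q) = Λ-* x∈ y∈ , subst J
    (solve 2 (λ x y → x :^ 4 :* (y :^ 4 :- y) :+ y :* (x :^ 4 :- x) := (x :* y) :^ 4 :- x :* y) refl x y)
    (IsZModule.add J-module (Λ*J (x⁴ x∈) q) (Λ*J y∈ p))
    where
    x⁴ : ∀ {x} → Λ x → Λ (x ^ 4)
    x⁴ h = Λ-* h (Λ-* h (Λ-* h (Λ-* h Λ-1)))

  frobenius-module : IsZModule Frobenius
  frobenius-module = subgroup⇒module
    (Λ-0 , twice (Λ-0) (trans (solve 1 (λ z → z :^ 4 :- z := z :* (z :^ 3 :- z :^ 0)) refl 0#) (trans (zeroˡ _) (sym (zeroʳ (cₙ 2))))))
    (λ { {x} {y} (x∈ , p) (y∈ , q) → x∈ ⊞ y∈ , subst J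
      (solve 2 (λ x y → x :^ 4 :- x :+ (y :^ 4 :- y) :+ c 2 :* (x :* y :* (c 2 :* (x :* x) :+ c 3 :* (x :* y) :+ c 2 :* (y :* y))) := (x :+ y) :^ 4 :- (x :+ y)) refl x y)
      (IsZModule.add J-module (IsZModule.add J-module p q)
        (twice (Λ-* (Λ-* x∈ y∈) (Λ-* (Λ-c 2) (Λ-* x∈ x∈) ⊞ Λ-* (Λ-c 3) (Λ-* x∈ y∈) ⊞ Λ-* (Λ-c 2) (Λ-* y∈ y∈))) refl)) })
    (λ { {x} (x∈ , p) → Λ-neg x∈ , subst J (solve 1 (λ x → x :^ 4 :- x :+ c 2 :* x := (:- x) :^ 4 :- (:- x)) refl x)
      (IsZModule.add J-module p (twice x∈ refl)) })

  power : ∀ {z} → Λ z → J (z ^ 4 - z)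
  power z∈ = proj₂ (Λ-combination frobenius-module (by-gen {Frobenius} f1 fθ (subst Frobenius (solve 1 (λ t → t :* t := t :^ 2) refl θ) (frobenius-* fθ fθ)) fκ (frobenius-* fθ fκ)
      (subst Frobenius (solve 1 (λ t → t :* (t :* κ̂ t) := t :^ 2 :* κ̂ t) refl θ) (frobenius-* fθ (frobenius-* fθ fκ)))) z∈)
    where
    f1 : Frobenius 1#
    f1 = Λ-1 , twice (Λ-0) (trans (solve 1 (λ t → (t :^ 0) :^ 4 :- t :^ 0 := con 0ℚ) refl θ) (trans j-0 (sym (zeroʳ (cₙ 2)))))
    fθ : Frobenius θ
    fθ = Zθ⇒Λ Zθ-θ , twice θκ∈ (solve 1 (λ t → t :^ 4 :- t := c 2 :* (t :* κ̂ t)) refl θ)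
    fκ : Frobenius κ
    fκ = κ∈ , twice (Λ-sub (Λ-sub (Λ-* (Λ-c 2) (Λ-* s∈ s∈)) (Λ-* (Λ-c 2) (Λ-* s∈ κ∈)) ⊞ s∈) κ∈)
      (solve 1 (λ t → κ̂ t :^ 4 :- κ̂ t := c 2 :* (c 2 :* (ŝ t :* ŝ t) :- c 2 :* (ŝ t :* κ̂ t) :+ ŝ t :- κ̂ t)) refl θ)
      where
      s∈ : Λ s
      s∈ = Zθ⇒Λ s∈Zθ

  order : MaximalOrder
  order = record
    { basis = basis ; Λ-* = Λ-* ; Zθ⇒Λ = Zθ⇒Λ ; pΛ⊆Zθ = pΛ⊆Zθ
    -- J is 2Λ, so 2x ∈ J already gives x ∈ Λ. The exponent 4 is passed as 2, being 2 + 2.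
    ; maximal = λ x∈ Px∈ h → h (cancel (Nilpotent.integral⇒J Λ J Λ-module Λ-1 Λ-* J-module Λ*J P (subst Λ P≡ (Λ-c 2)) (λ {x} x∈ → x , x∈ , refl) 2 power Px∈ x∈))
    ; q = 4 ; v = 2 ; r = 6 ; 1<q = ℕ.s≤s (ℕ.s≤s ℕ.z≤n) ; q+v≤r = ℕP.≤-refl ; 1<p = ℕP.≤-refl ; prime = from-yes (prime? 2)
    ; inverse = λ x h → 1ℤ , odd x h
    ; ρ = λ i → i ; ρ-δ = λ _ _ → refl ; J = J ; Λ*J = Λ*J
    ; J-ξ = λ { (l , l∈ , refl) i → proj₁ (ξ-int l∈ i) , trans (Linear.lin-j (ξ-linear i) (ιₙ 2) l) (cong (ιₙ 2 ℚ.*_) (proj₂ (ξ-int l∈ i))) }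
    ; power = power }
    where
    cancel : ∀ {x} → J (P * x) → Λ x
    cancel (l , l∈ , e) = subst Λ (sym (jₙ-cancel 2 e)) l∈
    open Mod 2
    odd : ∀ x → ¬ ((Z.+ 2) ∣ℤ x) → x Z.* 1ℤ ≡ₚ 1ℤ
    odd x h = by-residue (residue x) (≡ₚ-residue x)
      where
      by-residue : ∀ r → x ≡ₚ Z.+ toℕ r → x Z.* 1ℤ ≡ₚ 1ℤ
      by-residue 0F d = contradiction (subst ((Z.+ 2) ∣ℤ_) (ℤP.+-identityʳ x) d) h
      by-residue 1F d = subst (λ w → w ≡ₚ 1ℤ) (sym (ℤP.*-identityʳ x)) d

  open MaximalOrderTheory order using (Λ⇒O; p^v∣index; module UpperBound) public

  -- On the four residue fields α takes the values 0, 1, θ, θ: adding η to θ separates the copies of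
  -- 𝔽₂, while those of 𝔽₄ stay together. The other elements come from θη = η + 4s and η² = 3η + 2ς,
  -- which give α² = θ² + 5η + 2τ′; squaring again and sorting by 2 and 4 gives α⁴ - α = 2 (θκ + ς +
  -- 2Ξ).
  ς τ′ α Ξ w₀ : K
  ς = s * (cₙ 5 * 1# + cₙ 4 * θ + cₙ 3 * θ ^ 2 + cₙ 2 * θ ^ 3 + θ ^ 4)
  τ′ = cₙ 4 * s + ς
  α = θ + η
  Ξ = cₙ 21 * η + cₙ 12 * ς + cₙ 10 * (s * (1# + θ)) + τ′ * τ′ + θ ^ 2 * τ′ + cₙ 5 * (η * τ′)
  w₀ = θ * κ + ς + cₙ 2 * Ξ

  private
    s∈ : Λ s
    s∈ = Zθ⇒Λ s∈Zθ
    θ∈ : Λ θ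
    θ∈ = Zθ⇒Λ Zθ-θ
    θ²∈ : Λ (θ ^ 2)
    θ²∈ = Zθ⇒Λ (Zθ-θ^ 2)
    η∈ : Λ η
    η∈ = Λ-* (Λ-1 ⊞ θ∈ ⊞ θ²∈) (κ∈ ⊞ Λ-1)
    ς∈Zθ : Zθ ς
    ς∈Zθ = Zθ-* s∈Zθ (Zθ-+ (Zθ-+ (Zθ-+ (Zθ-+ (Zθ-* (Zθ-c 5) Zθ-1) (Zθ-* (Zθ-c 4) Zθ-θ)) (Zθ-* (Zθ-c 3) (Zθ-θ^ 2))) (Zθ-* (Zθ-c 2) (Zθ-θ^ 3))) (Zθ-θ^ 4))
    ς∈ : Λ ς
    ς∈ = Zθ⇒Λ ς∈Zθ
    τ∈ : Λ τ′
    τ∈ = Λ-* (Λ-c 4) s∈ ⊞ ς∈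
    Ξ∈ : Λ Ξ
    Ξ∈ = Λ-* (Λ-c 21) η∈ ⊞ Λ-* (Λ-c 12) ς∈ ⊞ Λ-* (Λ-c 10) (Λ-* s∈ (Λ-1 ⊞ θ∈)) ⊞ Λ-* τ∈ τ∈ ⊞ Λ-* θ²∈ τ∈ ⊞ Λ-* (Λ-c 5) (Λ-* η∈ τ∈)
    w₀∈ : Λ w₀
    w₀∈ = θκ∈ ⊞ ς∈ ⊞ Λ-* (Λ-c 2) Ξ∈

  α∈ : Λ α
  α∈ = θ∈ ⊞ η∈

  w : Fin 2 → K
  w 0F = w₀
  w 1F = α * w₀

  w∈ : ∀ k → Λ (w k)
  w∈ 0F = w₀∈
  w∈ 1F = Λ-* α∈ w₀∈

  private
    Ξ̂ ŵ : ∀ {n} → Polynomial n → Polynomial n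
    Ξ̂ t = c 21 :* η̂ t :+ c 12 :* σ̂ t :+ c 10 :* (ŝ t :* (t :^ 0 :+ t)) :+ τ̂ t :* τ̂ t :+ t :^ 2 :* τ̂ t :+ c 5 :* (η̂ t :* τ̂ t)
    ŵ t = t :* κ̂ t :+ σ̂ t :+ c 2 :* Ξ̂ t

  Pw₀ : P * w₀ ≡ α ^ 4 - α
  Pw₀ = trans (cong (_* w₀) (sym P≡)) (solve 1 (λ t → c 2 :* ŵ t := α̂ t :^ 4 :- α̂ t) refl θ)

  Pw∈ : ∀ k → InZ[ α ] (P * w k)
  Pw∈ = λ where
      0F → Pw₀∈
      1F → subst InZ[ α ] (solve 3 (λ a p w → a :* (p :* w) := p :* (a :* w)) refl α P w₀) (InZ-* α (InZ-α α) Pw₀∈)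
    where
    α^∈ : ∀ n → InZ[ α ] (α ^ n)
    α^∈ zero    = InZ-1 α
    α^∈ (suc n) = InZ-* α (InZ-α α) (α^∈ n)
    Pw₀∈ : InZ[ α ] (P * w₀)
    Pw₀∈ = subst InZ[ α ] (sym Pw₀) (IsZModule.sub (InZ-module α) (α^∈ 4) (InZ-α α))

  -- On the residue fields α³ is 0 where η is 1, and 1 elsewhere, so η ≡ α³ - 1 modulo 2. With η
  -- come θ = α - η, θ² ≡ α² - η and then all of ℤ[θ]. Removing parts in ℤ[θ] and η ℤ[θ] from w₀ and
  -- α w₀ leaves θκ and θ²κ, and the definition of η then yields κ.
  generates-mod-p : ∀ i → ∃ λ l → Λ l × adjoinAll InZ[ α ] w (gen i - P * l)
  generates-mod-p = by-gen {E} E1 Eθ Eθ² Eκ Eθκ Eθ²κ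
    where
    B-module : IsZModule (adjoinAll InZ[ α ] w)
    B-module = adjoinAll-module (InZ-module α) w
    open ModuloP S congruence basis (adjoinAll InZ[ α ] w) B-module renaming (B+PΛ to E)
    open IsZModule B+PΛ-module
    ofα : ∀ {x} → InZ[ α ] x → E x
    ofα p = B⊆ (⊆adjoinAll w p)
    E1 : E 1#
    E1 = ofα (InZ-1 α)
    Eα : E α
    Eα = ofα (InZ-α α)
    Eη : E η
    Eη = modulo P≡ (sub (ofα (InZ-* α (InZ-α α) (InZ-* α (InZ-α α) (InZ-α α)))) E1)
      (Λ-neg (κ∈ ⊞ Λ-* (Λ-c 10) η∈ ⊞ Λ-* (Λ-c 12) s∈ ⊞ Λ-* (Λ-c 2) (Λ-* s∈ θ∈) ⊞ Λ-* τ∈ θ∈ ⊞ Λ-* (Λ-c 5) ς∈ ⊞ Λ-* τ∈ η∈))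
      (solve 1 (λ t → η̂ t := α̂ t :* (α̂ t :* α̂ t) :- t :^ 0 :+ c 2 :* (:- (κ̂ t :+ c 10 :* η̂ t :+ c 12 :* ŝ t :+ c 2 :* (ŝ t :* t) :+ τ̂ t :* t :+ c 5 :* σ̂ t :+ τ̂ t :* η̂ t))) refl θ)
    Eθ : E θ
    Eθ = subst E (solve 2 (λ t e → (t :+ e) :- e := t) refl θ η) (sub Eα Eη)
    Eθ² : E (θ ^ 2)
    Eθ² = modulo P≡ (sub (ofα (InZ-* α (InZ-α α) (InZ-α α))) Eη)
      (Λ-neg (Λ-* (Λ-c 2) η∈ ⊞ τ∈))
      (solve 1 (λ t → t :^ 2 := α̂ t :* α̂ t :- η̂ t :+ c 2 :* (:- (c 2 :* η̂ t :+ τ̂ t))) refl θ)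
    EZθ : ∀ {x} → Zθ x → E x
    EZθ {x} x∈ = combination (expand x) (coef-int x∈) λ where
      0F → E1
      1F → subst E (sym (trans (*-comm θ 1#) (*-identityˡ θ))) Eθ
      2F → Eθ²
      3F → modulo P≡ E1 κ∈ (solve 1 (λ t → t :^ 3 := t :^ 0 :+ c 2 :* κ̂ t) refl θ)
      4F → modulo P≡ Eθ θκ∈ (solve 1 (λ t → t :^ 4 := t :+ c 2 :* (t :* κ̂ t)) refl θ)
      5F → modulo P≡ Eθ² θ²κ∈ (solve 1 (λ t → t :^ 5 := t :^ 2 :+ c 2 :* (t :^ 2 :* κ̂ t)) refl θ)
    -- θ acts as 1 on the factor that η selects; exactly, θη = η + 4s.
    ηθ^ : ∀ n → ∃ λ l → Λ l × η * θ ^ n ≡ η + cₙ 2 * l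
    ηθ^ zero = 0# , Λ-0 , trans (trans (*-comm η 1#) (*-identityˡ η)) (sym (trans (cong (η +_) (zeroʳ (cₙ 2))) (+-identityʳ η)))
    ηθ^ (suc n) with ηθ^ n
    ... | l , l∈ , e = cₙ 2 * s + θ * l , Λ-* (Λ-c 2) s∈ ⊞ Λ-* θ∈ l∈ , trans
      (solve 3 (λ h t T → h :* (t :* T) := t :* (h :* T)) refl η θ (θ ^ n)) (trans (cong (θ *_) e)
      (solve 2 (λ t l → t :* (η̂ t :+ c 2 :* l) := η̂ t :+ c 2 :* (c 2 :* ŝ t :+ t :* l)) refl θ l))
    EηZθ : ∀ {x} → Zθ x → E (η * x)
    EηZθ {x} x∈ = IsZModule.combination {Q = λ y → E (η * y)} (scaled-module B+PΛ-module η) (expand x) (coef-int x∈) λ i →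
      modulo P≡ Eη (proj₁ (proj₂ (ηθ^ (toℕ i)))) (proj₂ (proj₂ (ηθ^ (toℕ i))))
    Eθκ : E (θ * κ)
    Eθκ = modulo P≡ (sub (B⊆ (∈adjoinAll (InZ-module α) w 0F)) (EZθ ς∈Zθ)) (Λ-neg Ξ∈)
      (solve 3 (λ k o x → k := (k :+ o :+ c 2 :* x) :- o :+ c 2 :* (:- x)) refl (θ * κ) ς Ξ)
    Eθ²κ : E (θ ^ 2 * κ)
    Eθ²κ = modulo P≡ (sub (sub (B⊆ (∈adjoinAll (InZ-module α) w 1F)) (EZθ (Zθ-* Zθ-θ ς∈Zθ))) (EηZθ ς∈Zθ))
      (Λ-neg (Λ-* (Λ-* s∈ θ∈) (Λ-1 ⊞ θ∈ ⊞ θ²∈) ⊞ Λ-* α∈ Ξ∈))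
      (solve 1 (λ t → t :^ 2 :* κ̂ t := α̂ t :* ŵ t :- t :* σ̂ t :- η̂ t :* σ̂ t :+ c 2 :* (:- (ŝ t :* t :* (t :^ 0 :+ t :+ t :^ 2) :+ α̂ t :* Ξ̂ t))) refl θ)
    Eκ : E κ
    Eκ = subst E (solve 1 (λ t → η̂ t :- t :* κ̂ t :- t :^ 2 :* κ̂ t :- (t :^ 0 :+ t :+ t :^ 2) := κ̂ t) refl θ)
      (sub (sub (sub Eη Eθκ) Eθ²κ) (add (add E1 Eθ) Eθ²))

  open UpperBound α α∈ w (λ k → Λ⇒O (w∈ k)) Pw∈ generates-mod-p public using (finite-index; p^[1+v]∤; denominator-InZ)

-- The prime 3.

-- The 3-maximal order: with Δ = θ² − 1, κ = Δ²/3 and 9s = θ⁶ − 1 one has Δκ = 3s − θ²Δ and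
-- κ² = sΔ − θ²κ.  The ideal J = 3Λ + ΔΛ is the radical, and Λ/J = 𝔽₃[θ, κ]/(θ² − 1, κ² + κ).
module AtThree (S : Setting) (σ : Fin 6 → ℤ)
  (τ-zero : Setting.τ S zero ≡ 1ℤ Z.+ (Z.+ 9) Z.* σ zero) (τ-suc : ∀ i → Setting.τ S (suc i) ≡ (Z.+ 9) Z.* σ (suc i)) where

  congruence : Congruence S
  congruence = record
    { p = 3 ; p≢0 = _ ; ε = Z.+ 2 ; ε⁻¹ = Z.+ 2 ; k = 1ℤ ; pε≡6 = refl ; εε⁻¹ = refl
    ; σ = σ
    ; τ-zero = trans τ-zero (cong (λ w → 1ℤ Z.+ w) (nine (σ zero)))
    ; τ-suc = λ i → trans (τ-suc i) (nine (σ (suc i))) }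
    where
    nine : ∀ x → (Z.+ 9) Z.* x ≡ (Z.+ 3) Z.* ((Z.+ 3) Z.* x)
    nine = ℤR.solve 1 (λ x → ℤR.con (Z.+ 9) ℤR.:* x ℤR.:= ℤR.con (Z.+ 3) ℤR.:* (ℤR.con (Z.+ 3) ℤR.:* x)) refl

  open Setting S
  open Scalars powerBasis
  open Integrality S
  open Lattices S
  open RingTools S
  open Local S congruence using (P)
  open Orders S congruence
  open SixthPower S congruence 9 σ τ-zero τ-suc
  open Solver using (solve; _:=_; _:+_; _:*_; _:-_; :-_; con; _:^_; Polynomial)

  private
    ⅓ -⅔ 2ℚ 3ℚ -1ℚ : ℚ
    ⅓ = recip 3
    -⅔ = ℚ.- (recip 3 ℚ.+ recip 3)
    2ℚ = ι₀ (Z.+ 2)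
    3ℚ = ι₀ (Z.+ 3)
    -1ℚ = ℚ.- 1ℚ

    -- The rows of `Y` are 1, θ, Δ, θΔ, κ, θκ; `X` comes from θ² = 1 + Δ and θ⁴ = 1 + 2Δ + 3κ.
    X Y : Fin 6 → Fin 6 → ℚ
    X i k = lookup (lookup ((1ℚ ∷ 0ℚ ∷ 1ℚ ∷ 0ℚ ∷ 1ℚ ∷ 0ℚ ∷ []) ∷ (0ℚ ∷ 1ℚ ∷ 0ℚ ∷ 1ℚ ∷ 0ℚ ∷ 1ℚ ∷ []) ∷ (0ℚ ∷ 0ℚ ∷ 1ℚ ∷ 0ℚ ∷ 2ℚ ∷ 0ℚ ∷ [])
      ∷ (0ℚ ∷ 0ℚ ∷ 0ℚ ∷ 1ℚ ∷ 0ℚ ∷ 2ℚ ∷ []) ∷ (0ℚ ∷ 0ℚ ∷ 0ℚ ∷ 0ℚ ∷ 3ℚ ∷ 0ℚ ∷ []) ∷ (0ℚ ∷ 0ℚ ∷ 0ℚ ∷ 0ℚ ∷ 0ℚ ∷ 3ℚ ∷ []) ∷ []) i) k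
    Y k l = lookup (lookup ((1ℚ ∷ 0ℚ ∷ 0ℚ ∷ 0ℚ ∷ 0ℚ ∷ 0ℚ ∷ []) ∷ (0ℚ ∷ 1ℚ ∷ 0ℚ ∷ 0ℚ ∷ 0ℚ ∷ 0ℚ ∷ []) ∷ (-1ℚ ∷ 0ℚ ∷ 1ℚ ∷ 0ℚ ∷ 0ℚ ∷ 0ℚ ∷ [])
      ∷ (0ℚ ∷ -1ℚ ∷ 0ℚ ∷ 1ℚ ∷ 0ℚ ∷ 0ℚ ∷ []) ∷ (⅓ ∷ 0ℚ ∷ -⅔ ∷ 0ℚ ∷ ⅓ ∷ 0ℚ ∷ []) ∷ (0ℚ ∷ ⅓ ∷ 0ℚ ∷ -⅔ ∷ 0ℚ ∷ ⅓ ∷ []) ∷ []) k) l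

  abstract
    XY : ∀ i k → sumℚ (λ l → Y k l ℚ.* X i l) ≡ δ i k
    XY = from-yes (FinP.all? λ i → FinP.all? λ k → sumℚ (λ l → Y k l ℚ.* X i l) ℚP.≟ δ i k)

    YX : ∀ l k → sumℚ (λ i → X i k ℚ.* Y i l) ≡ δ l k
    YX = from-yes (FinP.all? λ l → FinP.all? λ k → sumℚ (λ i → X i k ℚ.* Y i l) ℚP.≟ δ l k)

    X-int : ∀ i k → Int (X i k)
    X-int i k = ℚ.↥ X i k , trans (from-yes (FinP.all? λ i → FinP.all? λ k → X i k ℚP.≟ ι₀ (ℚ.↥ X i k)) i k) (sym (ι≡ι₀ _))

  open MatrixBasis S congruence X Y XY YX X-int
  open Basis basis

  Δ κ s : K
  Δ = θ ^ 2 - 1#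
  κ = j ⅓ * (Δ * Δ)
  s = j (recip 9) * (θ ^ 6 - 1#)

  module Formal where
    c : ∀ {n} → ℕ → Polynomial n
    c k = con (ι₀ (Z.+ k))
    Δ̂ κ̂ ŝ : ∀ {n} → Polynomial n → Polynomial n
    Δ̂ t = t :^ 2 :- t :^ 0
    κ̂ t = con ⅓ :* (Δ̂ t :* Δ̂ t)
    ŝ t = con (recip 9) :* (t :^ 6 :- t :^ 0)
  open Formal

  P≡ : cₙ 3 ≡ P
  P≡ = cong j (sym (ι≡ι₀ (Z.+ 3)))

  private
    gen-0 : gen 0F ≡ 1#
    gen-0 = gen-row 0F (solve 2 (λ t o → row 0F t o := t :^ 0 :+ o) refl θ 0#)
    gen-1 : gen 1F ≡ θ
    gen-1 = gen-row 1F (solve 2 (λ t o → row 1F t o := t :+ o) refl θ 0#)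
    gen-2 : gen 2F ≡ Δ
    gen-2 = gen-row 2F (solve 2 (λ t o → row 2F t o := Δ̂ t :+ o) refl θ 0#)
    gen-3 : gen 3F ≡ θ * Δ
    gen-3 = gen-row 3F (solve 2 (λ t o → row 3F t o := t :* Δ̂ t :+ o) refl θ 0#)
    gen-4 : gen 4F ≡ κ
    gen-4 = gen-row 4F (solve 2 (λ t o → row 4F t o := κ̂ t :+ o) refl θ 0#)
    gen-5 : gen 5F ≡ θ * κ
    gen-5 = gen-row 5F (solve 2 (λ t o → row 5F t o := t :* κ̂ t :+ o) refl θ 0#)

  by-gen : ∀ {Q : K → Set} → Q 1# → Q θ → Q Δ → Q (θ * Δ) → Q κ → Q (θ * κ) → ∀ k → Q (gen k)
  by-gen {Q} a b c d e f 0F = subst Q (sym gen-0) a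
  by-gen {Q} a b c d e f 1F = subst Q (sym gen-1) b
  by-gen {Q} a b c d e f 2F = subst Q (sym gen-2) c
  by-gen {Q} a b c d e f 3F = subst Q (sym gen-3) d
  by-gen {Q} a b c d e f 4F = subst Q (sym gen-4) e
  by-gen {Q} a b c d e f 5F = subst Q (sym gen-5) f

  infixl 6 _⊞_
  _⊞_ : ∀ {x y} → Λ x → Λ y → Λ (x + y)
  _⊞_ = IsZModule.add Λ-module

  s∈Zθ : Zθ s
  s∈Zθ = quotient∈

  Δ∈Zθ : Zθ Δ
  Δ∈Zθ = Zθ-sub (Zθ-θ^ 2) Zθ-1

  s∈ : Λ s
  s∈ = Zθ⇒Λ s∈Zθ
  θ∈ : Λ θ
  θ∈ = Zθ⇒Λ Zθ-θ
  Δ∈ : Λ Δ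
  Δ∈ = Zθ⇒Λ Δ∈Zθ
  κ∈ : Λ κ
  κ∈ = subst Λ gen-4 (gen∈Λ 4F)
  θκ∈ : Λ (θ * κ)
  θκ∈ = subst Λ gen-5 (gen∈Λ 5F)
  Λ-1 : Λ 1#
  Λ-1 = Zθ⇒Λ Zθ-1
  Λ-c : ∀ k → Λ (cₙ k)
  Λ-c k = Zθ⇒Λ (Zθ-c k)

  stable : ∀ a → (∀ k → Λ (a * gen k)) → ∀ {x} → Λ x → Λ (a * x)
  stable a h = Λ-combination (scaled-module Λ-module a) h

  Δκ∈ : Zθ (cₙ 3 * s - θ ^ 2 * Δ)
  Δκ∈ = Zθ-sub (Zθ-* (Zθ-c 3) s∈Zθ) (Zθ-* (Zθ-θ^ 2) Δ∈Zθ)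

  θ-stable : ∀ {x} → Λ x → Λ (θ * x)
  θ-stable = stable θ (by-gen {λ y → Λ (θ * y)}
    (Zθ⇒Λ (Zθ-θ^ 1)) (Zθ⇒Λ (Zθ-θ* Zθ-θ)) (Zθ⇒Λ (Zθ-θ* Δ∈Zθ)) (Zθ⇒Λ (Zθ-θ* (Zθ-θ* Δ∈Zθ))) θκ∈
    (subst Λ (solve 1 (λ t → κ̂ t :+ (c 3 :* ŝ t :- t :^ 2 :* Δ̂ t) := t :* (t :* κ̂ t)) refl θ) (κ∈ ⊞ Zθ⇒Λ Δκ∈)))

  Λ-κ² : Λ (s * Δ - θ * (θ * κ))
  Λ-κ² = Λ-sub (Zθ⇒Λ (Zθ-* s∈Zθ Δ∈Zθ)) (θ-stable θκ∈)

  κ-stable : ∀ {x} → Λ x → Λ (κ * x)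
  κ-stable = stable κ (by-gen {λ y → Λ (κ * y)}
    (subst Λ (solve 1 (λ t → κ̂ t := κ̂ t :* t :^ 0) refl θ) κ∈)
    (subst Λ (*-comm θ κ) θκ∈)
    (subst Λ (solve 1 (λ t → c 3 :* ŝ t :- t :^ 2 :* Δ̂ t := κ̂ t :* Δ̂ t) refl θ) (Zθ⇒Λ Δκ∈))
    (subst Λ (solve 1 (λ t → t :* (c 3 :* ŝ t :- t :^ 2 :* Δ̂ t) := κ̂ t :* (t :* Δ̂ t)) refl θ) (θ-stable (Zθ⇒Λ Δκ∈)))
    (subst Λ (solve 1 (λ t → ŝ t :* Δ̂ t :- t :* (t :* κ̂ t) := κ̂ t :* κ̂ t) refl θ) Λ-κ²)
    (subst Λ (solve 1 (λ t → t :* (ŝ t :* Δ̂ t :- t :* (t :* κ̂ t)) := κ̂ t :* (t :* κ̂ t)) refl θ) (θ-stable Λ-κ²)))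

  Δ-stable : ∀ {x} → Λ x → Λ (Δ * x)
  Δ-stable {x} p = subst Λ (solve 2 (λ t x → t :* (t :* x) :- x := Δ̂ t :* x) refl θ x) (Λ-sub (θ-stable (θ-stable p)) p)

  gen-stable : ∀ k {y} → Λ y → Λ (gen k * y)
  gen-stable = by-gen {λ g → ∀ {y} → Λ y → Λ (g * y)} (λ {y} p → subst Λ (sym (*-identityˡ y)) p) θ-stable Δ-stable
    (λ {y} p → subst Λ (sym (*-assoc θ Δ y)) (θ-stable (Δ-stable p))) κ-stable (λ {y} p → subst Λ (sym (*-assoc θ κ y)) (θ-stable (κ-stable p)))

  Λ-* : ∀ {x y} → Λ x → Λ y → Λ (x * y)
  Λ-* {x} {y} x∈ y∈ = subst Λ (*-comm y x) (stable y (λ k → subst Λ (*-comm (gen k) y) (gen-stable k y∈)) x∈)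

  pΛ⊆Zθ : ∀ {x} → Λ x → Zθ (P * x)
  pΛ⊆Zθ = Λ-combination (scaled-module Zθ-module P) (by-gen {λ y → Zθ (P * y)}
    (Zθ-scale (Z.+ 3) Zθ-1) (Zθ-scale (Z.+ 3) Zθ-θ) (Zθ-scale (Z.+ 3) Δ∈Zθ) (Zθ-scale (Z.+ 3) (Zθ-θ* Δ∈Zθ))
    (via (solve 1 (λ t → Δ̂ t :* Δ̂ t := c 3 :* κ̂ t) refl θ) (Zθ-* Δ∈Zθ Δ∈Zθ))
    (via (solve 1 (λ t → t :* (Δ̂ t :* Δ̂ t) := c 3 :* (t :* κ̂ t)) refl θ) (Zθ-θ* (Zθ-* Δ∈Zθ Δ∈Zθ))))
    where
    via : ∀ {x y} → x ≡ cₙ 3 * y → Zθ x → Zθ (P * y)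
    via {y = y} e = subst Zθ (trans e (cong (_* y) P≡))

  -- Modulo 3Λ the ideal ΔΛ is spanned by Δ and θΔ.
  record J (x : K) : Set where
    constructor normal-form
    field
      a b : ℤ
      l   : K
      l∈  : Λ l
      eq  : x ≡ jz a * Δ + jz b * (θ * Δ) + P * l

  private
    jz-0 : jz 0ℤ ≡ 0#
    jz-0 = trans (cong j (ι≡ι₀ 0ℤ)) j-0

  J-module : IsZModule J
  J-module = record
    { zero∈ = normal-form 0ℤ 0ℤ 0# (Λ-0) (sym (trans (cong₂ _+_ (trans (cong₂ _+_ (trans (cong (_* Δ) jz-0) (zeroˡ Δ)) (trans (cong (_* (θ * Δ)) jz-0) (zeroˡ (θ * Δ)))) (+-identityˡ 0#)) (zeroʳ P)) (+-identityˡ 0#)))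
    ; add = λ { (normal-form a b l l∈ refl) (normal-form a′ b′ l′ l′∈ refl) → normal-form (a Z.+ a′) (b Z.+ b′) (l + l′) (l∈ ⊞ l′∈)
        (trans (solve 9 (λ a b l a′ b′ l′ d t p → (a :* d :+ b :* (t :* d) :+ p :* l) :+ (a′ :* d :+ b′ :* (t :* d) :+ p :* l′) := (a :+ a′) :* d :+ (b :+ b′) :* (t :* d) :+ p :* (l :+ l′)) refl (jz a) (jz b) l (jz a′) (jz b′) l′ Δ θ P)
          (cong₂ (λ u v → u * Δ + v * (θ * Δ) + P * (l + l′)) (sym (jz-+ a a′)) (sym (jz-+ b b′)))) }
    ; scale = λ { z (normal-form a b l l∈ refl) → normal-form (z Z.* a) (z Z.* b) (jz z * l) (Λ-scale z l∈)
        (trans (solve 7 (λ z a b l d t p → z :* (a :* d :+ b :* (t :* d) :+ p :* l) := (z :* a) :* d :+ (z :* b) :* (t :* d) :+ p :* (z :* l)) refl (jz z) (jz a) (jz b) l Δ θ P)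
          (cong₂ (λ u v → u * Δ + v * (θ * Δ) + P * (jz z * l)) (sym (jz-* z a)) (sym (jz-* z b)))) } }

  thrice : ∀ {x l} → Λ l → x ≡ cₙ 3 * l → J x
  thrice {x} {l} l∈ e = normal-form 0ℤ 0ℤ l l∈ (trans e (trans (cong (_* l) P≡) (sym (trans (cong (_+ P * l) (trans (cong₂ _+_ (trans (cong (_* Δ) jz-0) (zeroˡ Δ)) (trans (cong (_* (θ * Δ)) jz-0) (zeroˡ (θ * Δ)))) (+-identityˡ 0#))) (+-identityˡ (P * l))))))

  P*∈J : ∀ {x} → Λ x → J (P * x)
  P*∈J {x} x∈ = thrice x∈ (cong (_* x) (sym P≡))

  J-Δ : J Δ
  J-Δ = normal-form 1ℤ 0ℤ 0# (Λ-0) (sym (trans (cong₂ _+_ (cong₂ _+_ (trans (cong (_* Δ) jz-1) (*-identityˡ Δ)) (trans (cong (_* (θ * Δ)) jz-0) (zeroˡ (θ * Δ)))) (zeroʳ P)) (trans (+-identityʳ (Δ + 0#)) (+-identityʳ Δ))))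

  J-θΔ : J (θ * Δ)
  J-θΔ = normal-form 0ℤ 1ℤ 0# (Λ-0) (sym (trans (cong₂ _+_ (cong₂ _+_ (trans (cong (_* Δ) jz-0) (zeroˡ Δ)) (trans (cong (_* (θ * Δ)) jz-1) (*-identityˡ (θ * Δ)))) (zeroʳ P)) (trans (+-identityʳ (0# + θ * Δ)) (+-identityˡ (θ * Δ)))))

  -- Since Δ² = 3κ and Δκ = -Δ + 3 (s - κ), multiplication by Δ sends every generator into the span
  -- of Δ and θΔ modulo 3.
  J-ΔΛ : ∀ {x} → Λ x → J (Δ * x)
  J-ΔΛ = Λ-combination (scaled-module J-module Δ) (by-gen {λ y → J (Δ * y)}
    (subst J (trans (sym (*-identityˡ Δ)) (*-comm 1# Δ)) J-Δ) (subst J (*-comm θ Δ) J-θΔ)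
    (thrice κ∈ (solve 1 (λ t → Δ̂ t :* Δ̂ t := c 3 :* κ̂ t) refl θ))
    (thrice θκ∈ (solve 1 (λ t → Δ̂ t :* (t :* Δ̂ t) := c 3 :* (t :* κ̂ t)) refl θ))
    (subst J (solve 1 (λ t → (:- Δ̂ t) :+ c 3 :* (ŝ t :- κ̂ t) := Δ̂ t :* κ̂ t) refl θ)
      (IsZModule.add J-module (IsZModule.neg J-module J-Δ) (thrice (Λ-sub s∈ κ∈) refl)))
    (subst J (solve 1 (λ t → (:- (t :* Δ̂ t)) :+ c 3 :* (t :* (ŝ t :- κ̂ t)) := Δ̂ t :* (t :* κ̂ t)) refl θ)
      (IsZModule.add J-module (IsZModule.neg J-module J-θΔ) (thrice (θ-stable (Λ-sub s∈ κ∈)) refl))))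

  Λ*J : ∀ {x y} → Λ x → J y → J (x * y)
  Λ*J {x} x∈ (normal-form a b l l∈ refl) = subst J
    (solve 7 (λ x a b l d t p → a :* (d :* x) :+ b :* (d :* (t :* x)) :+ p :* (x :* l) := x :* (a :* d :+ b :* (t :* d) :+ p :* l)) refl x (jz a) (jz b) l Δ θ P)
    (IsZModule.add J-module (IsZModule.add J-module (IsZModule.scale J-module a (J-ΔΛ x∈)) (IsZModule.scale J-module b (J-ΔΛ (θ-stable x∈)))) (P*∈J (Λ-* x∈ l∈)))

  -- Cubing is additive modulo 3, so the solutions of z³ ≡ z modulo J form a subring, and 1, θ, Δ
  -- and κ are the only elements to test.
  Frobenius : K → Set
  Frobenius z = Λ z × J (z ^ 3 - z)

  frobenius-* : ∀ {x y} → Frobenius x → Frobenius y → Frobenius (x * y)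
  frobenius-* {x} {y} (x∈ , p) (y∈ , q) = Λ-* x∈ y∈ , subst J
    (solve 2 (λ x y → x :* (x :* x) :* (y :^ 3 :- y) :+ y :* (x :^ 3 :- x) := (x :* y) :^ 3 :- x :* y) refl x y)
    (IsZModule.add J-module (Λ*J (Λ-* x∈ (Λ-* x∈ x∈)) q) (Λ*J y∈ p))

  frobenius-module : IsZModule Frobenius
  frobenius-module = subgroup⇒module
    (Λ-0 , thrice (Λ-0) (trans (solve 1 (λ z → z :^ 3 :- z := z :* (z :^ 2 :- z :^ 0)) refl 0#) (trans (zeroˡ _) (sym (zeroʳ (cₙ 3))))))
    (λ { {x} {y} (x∈ , p) (y∈ , q) → x∈ ⊞ y∈ , subst J
      (solve 2 (λ x y → x :^ 3 :- x :+ (y :^ 3 :- y) :+ c 3 :* (x :* y :* (x :+ y)) := (x :+ y) :^ 3 :- (x :+ y)) refl x y)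
      (IsZModule.add J-module (IsZModule.add J-module p q) (thrice (Λ-* (Λ-* x∈ y∈) (x∈ ⊞ y∈)) refl)) })
    (λ { {x} (x∈ , p) → Λ-neg x∈ , subst J (solve 1 (λ x → :- (x :^ 3 :- x) := (:- x) :^ 3 :- (:- x)) refl x) (IsZModule.neg J-module p) })

  power : ∀ {z} → Λ z → J (z ^ 3 - z)
  power z∈ = proj₂ (Λ-combination frobenius-module (by-gen {Frobenius} f1 fθ fΔ (frobenius-* fθ fΔ) fκ (frobenius-* fθ fκ)) z∈)
    where
    f1 : Frobenius 1#
    f1 = Λ-1 , thrice (Λ-0) (trans (solve 1 (λ t → (t :^ 0) :^ 3 :- t :^ 0 := con 0ℚ) refl θ) (trans j-0 (sym (zeroʳ (cₙ 3)))))
    fθ : Frobenius θ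
    fθ = θ∈ , subst J (solve 1 (λ t → t :* Δ̂ t := t :^ 3 :- t) refl θ) J-θΔ
    fΔ : Frobenius Δ
    fΔ = Δ∈ , subst J (solve 1 (λ d → (d :* d :- d :^ 0) :* d := d :^ 3 :- d) refl Δ) (Λ*J (Λ-sub (Λ-* Δ∈ Δ∈) Λ-1) J-Δ)
    fκ : Frobenius κ
    fκ = κ∈ , subst J (solve 1 (λ t → ((t :^ 2 :+ t :^ 0) :* κ̂ t :- t :^ 2 :* ŝ t :+ ŝ t :* κ̂ t) :* Δ̂ t := κ̂ t :^ 3 :- κ̂ t) refl θ)
      (Λ*J (Λ-sub (Λ-* (Zθ⇒Λ (Zθ-θ^ 2) ⊞ Λ-1) κ∈) (Λ-* (Zθ⇒Λ (Zθ-θ^ 2)) s∈) ⊞ Λ-* s∈ κ∈) J-Δ)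

  -- The coordinates of 1, θ, κ and θκ, a basis of Λ/J over 𝔽₃; the positions left out are those of
  -- Δ and θΔ.
  ρ : Fin 4 → Fin 6
  ρ 0F = 0F
  ρ 1F = 1F
  ρ 2F = 4F
  ρ 3F = 5F

  J-ξ : ∀ {x} → J x → ∀ i → ∃ λ z → ξ (ρ i) x ≡ ιₙ 3 ℚ.* ι z
  J-ξ (normal-form a b l l∈ refl) i = proj₁ (ξ-int l∈ (ρ i)) , trans (lin-+ (jz a * Δ + jz b * (θ * Δ)) (P * l)) (trans
      (cong₂ ℚ._+_ (trans (lin-+ (jz a * Δ) (jz b * (θ * Δ))) (trans
          (cong₂ ℚ._+_ (trans (lin-j (ι a) Δ) (trans (cong (ι a ℚ.*_) ξΔ) (ℚP.*-zeroʳ (ι a)))) (trans (lin-j (ι b) (θ * Δ)) (trans (cong (ι b ℚ.*_) ξθΔ) (ℚP.*-zeroʳ (ι b)))))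
          (ℚP.+-identityˡ 0ℚ)))
        (trans (lin-j (ιₙ 3) l) (cong (ιₙ 3 ℚ.*_) (proj₂ (ξ-int l∈ (ρ i))))))
      (ℚP.+-identityˡ (ιₙ 3 ℚ.* ι (proj₁ (ξ-int l∈ (ρ i))))))
    where
    open Linear (ξ-linear (ρ i))
    off : ∀ i → δ (ρ i) 2F ≡ 0ℚ × δ (ρ i) 3F ≡ 0ℚ
    off 0F = refl , refl
    off 1F = refl , refl
    off 2F = refl , refl
    off 3F = refl , refl
    ξΔ : ξ (ρ i) Δ ≡ 0ℚ
    ξΔ = trans (cong (ξ (ρ i)) (sym gen-2)) (trans (ξ-gen (ρ i) 2F) (proj₁ (off i)))
    ξθΔ : ξ (ρ i) (θ * Δ) ≡ 0ℚ
    ξθΔ = trans (cong (ξ (ρ i)) (sym gen-3)) (trans (ξ-gen (ρ i) 3F) (proj₂ (off i)))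

  open Mod 3

  -- −1 is not a square modulo 3.
  sum-of-squares : ∀ a b → (Z.+ 3) ∣ℤ (a Z.* a Z.+ b Z.* b) → (Z.+ 3) ∣ℤ a × (Z.+ 3) ∣ℤ b
  sum-of-squares a b d = from-zero a (proj₁ zeros) , from-zero b (proj₂ zeros)
    where
    r t : Fin 3
    r = residue a
    t = residue b
    from-zero : ∀ x → residue x ≡ 0F → (Z.+ 3) ∣ℤ x
    from-zero x e = ∣-cong (ℤP.+-identityʳ x) (subst (λ r → x ≡ₚ Z.+ toℕ r) e (≡ₚ-residue x))
    residues : (r t : Fin 3) → (Z.+ 3) ∣ℤ ((Z.+ toℕ r) Z.* (Z.+ toℕ r) Z.+ (Z.+ toℕ t) Z.* (Z.+ toℕ t)) → r ≡ 0F × t ≡ 0F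
    residues 0F 0F _ = refl , refl
    residues 0F 1F d = contradiction d (from-no ((Z.+ 3) ∣ℤ? (Z.+ 1)))
    residues 0F 2F d = contradiction d (from-no ((Z.+ 3) ∣ℤ? (Z.+ 4)))
    residues 1F 0F d = contradiction d (from-no ((Z.+ 3) ∣ℤ? (Z.+ 1)))
    residues 1F 1F d = contradiction d (from-no ((Z.+ 3) ∣ℤ? (Z.+ 2)))
    residues 1F 2F d = contradiction d (from-no ((Z.+ 3) ∣ℤ? (Z.+ 5)))
    residues 2F 0F d = contradiction d (from-no ((Z.+ 3) ∣ℤ? (Z.+ 4)))
    residues 2F 1F d = contradiction d (from-no ((Z.+ 3) ∣ℤ? (Z.+ 5)))
    residues 2F 2F d = contradiction d (from-no ((Z.+ 3) ∣ℤ? (Z.+ 8)))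
    zeros : r ≡ 0F × t ≡ 0F
    zeros = residues r t (∣-cong
      (ℤR.solve 4 (λ a b r t → (a ℤR.:* a ℤR.:+ b ℤR.:* b) ℤR.:- ((a ℤR.:+ r) ℤR.:* (a ℤR.:- r) ℤR.:+ (b ℤR.:+ t) ℤR.:* (b ℤR.:- t)) ℤR.:= r ℤR.:* r ℤR.:+ t ℤR.:* t) refl a b (Z.+ toℕ r) (Z.+ toℕ t))
      (ℤD.∣m∣n⇒∣m-n d (ℤD.∣m∣n⇒∣m+n (ℤD.∣n⇒∣m*n (a Z.+ Z.+ toℕ r) (≡ₚ-residue a)) (ℤD.∣n⇒∣m*n (b Z.+ Z.+ toℕ t) (≡ₚ-residue b)))))

  integral⇒J : ∀ {x} → Λ (P * x) → Integral x → J (P * x)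
  integral⇒J Px∈ = Nilpotent.integral⇒J Λ J Λ-module Λ-1 Λ-* J-module Λ*J P (subst Λ P≡ (Λ-c 3)) P*∈J 1 power Px∈

  -- Λ/3Λ has nilpotents, so 3x ∈ J is not yet x ∈ Λ. Write 3x = (a + bθ)Δ + 3l and y = x - l;
  -- squaring gives 3y² = κ (a + bθ)². As y² is integral, this lies in J, and modulo J, where θ² ≡
  -- 1, it is (a² + b²)κ + 2ab θκ. So 3 divides a² + b², hence a and b, and x ∈ Λ.
  J-descent : ∀ {x} → Integral x → J (P * x) → ¬ ¬ Λ x
  J-descent {x} x∈ (normal-form a b l l∈ Px≡) h = O⇒¬¬integral (O-* y∈ y∈) λ i → h (x∈Λ i)
    where
    Λ-^ : ∀ k → Λ (l ^ k)
    Λ-^ zero    = Λ-1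
    Λ-^ (suc k) = Λ-* l∈ (Λ-^ k)
    y : K
    y = x - l
    y∈ : O y
    y∈ = IsZModule.sub O-module (integral⇒O x∈) (3 , _ , λ k → pΛ⊆Zθ (Λ-^ k))
    Py≡ : P * y ≡ (jz a + jz b * θ) * Δ
    Py≡ = trans (solve 3 (λ p x l → p :* (x :- l) := p :* x :- p :* l) refl P x l) (trans (cong (_- P * l) Px≡)
      (solve 6 (λ a b d t p l → (a :* d :+ b :* (t :* d) :+ p :* l) :- p :* l := (a :+ b :* t) :* d) refl (jz a) (jz b) Δ θ P l))
    Py²≡ : P * (y * y) ≡ κ * ((jz a + jz b * θ) * (jz a + jz b * θ))
    Py²≡ = jₙ-cancel 3 (trans (solve 2 (λ p y → p :* (p :* (y :* y)) := (p :* y) :* (p :* y)) refl P y) (trans (cong₂ _*_ Py≡ Py≡)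
      (trans (solve 2 (λ t g → (g :* Δ̂ t) :* (g :* Δ̂ t) := c 3 :* (κ̂ t :* (g :* g))) refl θ (jz a + jz b * θ)) (cong (_* (κ * ((jz a + jz b * θ) * (jz a + jz b * θ)))) P≡))))
    Λ-jz : ∀ z → Λ (jz z)
    Λ-jz z = Zθ⇒Λ (Zθ-jz z)
    g∈ : Λ (jz a + jz b * θ)
    g∈ = Λ-jz a ⊞ Λ-* (Λ-jz b) θ∈
    A B : ℤ
    A = a Z.* a Z.+ b Z.* b
    B = a Z.* b Z.+ a Z.* b
    residue∈J : Integral (y * y) → J (jz A * κ + jz B * (θ * κ))
    residue∈J i = subst J (trans
        (solve 3 (λ t a b → κ̂ t :* ((a :+ b :* t) :* (a :+ b :* t)) :- Δ̂ t :* (b :* b :* κ̂ t) := (a :* a :+ b :* b) :* κ̂ t :+ (a :* b :+ a :* b) :* (t :* κ̂ t)) refl θ (jz a) (jz b))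
        (sym (cong₂ (λ u v → u * κ + v * (θ * κ)) (trans (jz-+ (a Z.* a) (b Z.* b)) (cong₂ _+_ (jz-* a a) (jz-* b b))) (trans (jz-+ (a Z.* b) (a Z.* b)) (cong₂ _+_ (jz-* a b) (jz-* a b))))))
      (IsZModule.sub J-module (subst J Py²≡ (integral⇒J (subst Λ (sym Py²≡) (Λ-* κ∈ (Λ-* g∈ g∈))) i)) (J-ΔΛ (Λ-* (Λ-* (Λ-jz b) (Λ-jz b)) κ∈)))
    ξ-residue : ξ 4F (jz A * κ + jz B * (θ * κ)) ≡ ι A
    ξ-residue = trans (lin-+ (jz A * κ) (jz B * (θ * κ))) (trans (cong₂ ℚ._+_
        (trans (lin-j (ι A) κ) (trans (cong (ι A ℚ.*_) (trans (cong (ξ 4F) (sym gen-4)) (ξ-gen 4F 4F))) (ℚP.*-identityʳ (ι A))))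
        (trans (lin-j (ι B) (θ * κ)) (trans (cong (ι B ℚ.*_) (trans (cong (ξ 4F) (sym gen-5)) (ξ-gen 4F 5F))) (ℚP.*-zeroʳ (ι B)))))
      (ℚP.+-identityʳ (ι A)))
      where open Linear (ξ-linear 4F)
    3∣A : Integral (y * y) → (Z.+ 3) ∣ℤ A
    3∣A i = divides z (ι-injective (trans (sym ξ-residue) (trans (proj₂ (J-ξ (residue∈J i) 2F)) (trans (sym (ι-* (Z.+ 3) z)) (cong ι (ℤP.*-comm (Z.+ 3) z))))))
      where
      z : ℤ
      z = proj₁ (J-ξ (residue∈J i) 2F)
    x∈Λ : Integral (y * y) → Λ x
    x∈Λ i = divisible (sum-of-squares a b (3∣A i))
      where
      divisible : (Z.+ 3) ∣ℤ a × (Z.+ 3) ∣ℤ b → Λ x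
      divisible (divides a′ a≡ , divides b′ b≡) = subst Λ (sym (jₙ-cancel 3 (trans Px≡ (trans (cong₂ (λ u v → u * Δ + v * (θ * Δ) + P * l) (trans (cong jz a≡) (jz-* a′ (Z.+ 3))) (trans (cong jz b≡) (jz-* b′ (Z.+ 3))))
        (solve 6 (λ a b d t p l → a :* p :* d :+ b :* p :* (t :* d) :+ p :* l := p :* (a :* d :+ b :* (t :* d) :+ l)) refl (jz a′) (jz b′) Δ θ P l)))))
        (Λ-* (Λ-jz a′) Δ∈ ⊞ Λ-* (Λ-jz b′) (Λ-* θ∈ Δ∈) ⊞ l∈)

  maximal : ∀ {x} → Integral x → Λ (P * x) → ¬ ¬ Λ x
  maximal x∈ Px∈ = J-descent x∈ (integral⇒J Px∈ x∈)

  order : MaximalOrder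
  order = record
    { basis = basis ; Λ-* = Λ-* ; Zθ⇒Λ = Zθ⇒Λ ; pΛ⊆Zθ = pΛ⊆Zθ ; maximal = maximal
    ; q = 3 ; v = 1 ; r = 4 ; 1<q = ℕ.s≤s (ℕ.s≤s ℕ.z≤n) ; q+v≤r = ℕP.≤-refl ; 1<p = ℕ.s≤s (ℕ.s≤s ℕ.z≤n) ; prime = from-yes (prime? 3)
    ; inverse = inverse
    ; ρ = ρ ; ρ-δ = from-yes (FinP.all? λ i → FinP.all? λ k → δ (ρ i) (ρ k) ℚP.≟ δ i k) ; J = J ; Λ*J = Λ*J ; J-ξ = J-ξ
    ; power = power }
    where
    inverse : ∀ x → ¬ ((Z.+ 3) ∣ℤ x) → ∃ λ y → x Z.* y ≡ₚ 1ℤ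
    inverse x h = by-residue (residue x) (≡ₚ-residue x)
      where
      by-residue : ∀ r → x ≡ₚ Z.+ toℕ r → ∃ λ y → x Z.* y ≡ₚ 1ℤ
      by-residue 0F d = contradiction (subst ((Z.+ 3) ∣ℤ_) (ℤP.+-identityʳ x) d) h
      by-residue 1F d = 1ℤ , subst (λ w → w ≡ₚ 1ℤ) (sym (ℤP.*-identityʳ x)) d
      by-residue 2F d = Z.+ 2 , ∣-cong (ℤR.solve 1 (λ x → (x ℤR.:- ℤR.con (Z.+ 2)) ℤR.:* ℤR.con (Z.+ 2) ℤR.:+ ℤR.con (Z.+ 3) ℤR.:= x ℤR.:* ℤR.con (Z.+ 2) ℤR.:- ℤR.con 1ℤ) refl x)
        (ℤD.∣m∣n⇒∣m+n (ℤD.∣m⇒∣m*n (Z.+ 2) d) ℤD.∣-refl)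

  open MaximalOrderTheory order using (Λ⇒O; p^v∣index; module UpperBound) public

  -- ε² + ε and Δε + Δ lie in 3Λ, and α³ − α = θΔ + 3 M.
  ε Ξ M α w₀ : K
  ε = κ + (1# + s) * Δ
  Ξ = s + cₙ 2 * (s * s) + s * s * κ
  M = θ ^ 2 * ε + θ * (ε * ε) + Ξ * (ε - 1#)
  α = θ + ε
  w₀ = θ ^ 2 * κ + cₙ 2 * (θ * Δ * M) + cₙ 3 * (M * M)

  private
    ε̂ Ξ̂ M̂ α̂ ŵ Û V̂ : ∀ {n} → Polynomial n → Polynomial n
    ε̂ t = κ̂ t :+ (t :^ 0 :+ ŝ t) :* Δ̂ t
    Ξ̂ t = ŝ t :+ c 2 :* (ŝ t :* ŝ t) :+ ŝ t :* ŝ t :* κ̂ t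
    M̂ t = t :^ 2 :* ε̂ t :+ t :* (ε̂ t :* ε̂ t) :+ Ξ̂ t :* (ε̂ t :- t :^ 0)
    α̂ t = t :+ ε̂ t
    ŵ t = t :^ 2 :* κ̂ t :+ c 2 :* (t :* Δ̂ t :* M̂ t) :+ c 3 :* (M̂ t :* M̂ t)
    Û t = t :^ 3 :* ε̂ t :+ ε̂ t
    V̂ t = t :^ 3 :* ε̂ t :+ c 3 :* ŝ t :+ Ξ̂ t :+ c 2 :* (M̂ t :* (t :^ 3 :+ ε̂ t)) :+ c 3 :* (M̂ t :* M̂ t)

    θ^∈ : ∀ k → Λ (θ ^ k)
    θ^∈ k = Zθ⇒Λ (Zθ-θ^ k)
    ε∈ : Λ ε
    ε∈ = κ∈ ⊞ Λ-* (Λ-1 ⊞ s∈) Δ∈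
    Ξ∈ : Λ Ξ
    Ξ∈ = s∈ ⊞ Λ-* (Λ-c 2) (Λ-* s∈ s∈) ⊞ Λ-* (Λ-* s∈ s∈) κ∈
    M∈ : Λ M
    M∈ = Λ-* (θ^∈ 2) ε∈ ⊞ Λ-* θ∈ (Λ-* ε∈ ε∈) ⊞ Λ-* Ξ∈ (Λ-sub ε∈ Λ-1)
    w₀∈ : Λ w₀
    w₀∈ = Λ-* (θ^∈ 2) κ∈ ⊞ Λ-* (Λ-c 2) (Λ-* (Λ-* θ∈ Δ∈) M∈) ⊞ Λ-* (Λ-c 3) (Λ-* M∈ M∈)

  α∈ : Λ α
  α∈ = θ∈ ⊞ ε∈

  w : Fin 1 → K
  w _ = w₀

  private
    module A = IsZModule (InZ-module α)
    A-α : InZ[ α ] α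
    A-α = InZ-α α
    A-α³ : InZ[ α ] (α * (α * α))
    A-α³ = InZ-* α A-α (InZ-* α A-α A-α)

  -- The square of α³ - α = θΔ + 3M is θ²Δ² + 6θΔM + 9M², and Δ² = 3κ makes it three times `w₀`.
  Pw∈ : ∀ k → InZ[ α ] (P * w k)
  Pw∈ _ = subst InZ[ α ] (trans (solve 1 (λ t → (α̂ t :* (α̂ t :* α̂ t) :- α̂ t) :* (α̂ t :* (α̂ t :* α̂ t) :- α̂ t) := c 3 :* ŵ t) refl θ) (cong (_* w₀) P≡))
    (InZ-* α (A.sub A-α³ A-α) (A.sub A-α³ A-α))

  -- Modulo J, α is θ + κ; at κ = 0 and κ = -1 it takes the values 1, -1 and 0, 1 for θ = 1, -1. So
  -- α vanishes on a single factor, which 1 - α⁶ ≡ U picks out. Multiplying U by α - α³ ≡ -θΔ gives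
  -- Δ + θΔ modulo 3, whence all of J; then w₀ ≡ κ modulo J separates the two factors with value 1,
  -- and U supplies θκ.
  generates-mod-p : ∀ i → ∃ λ l → Λ l × adjoinAll InZ[ α ] w (gen i - P * l)
  generates-mod-p = by-gen {E} E1 Eθ EΔ EθΔ Eκ Eθκ
    where
    open ModuloP S congruence basis (adjoinAll InZ[ α ] w) (adjoinAll-module (InZ-module α) w) renaming (B+PΛ to E)
    open IsZModule B+PΛ-module
    ofα : ∀ {x} → InZ[ α ] x → E x
    ofα p = B⊆ (⊆adjoinAll w p)
    A-1-α⁶ : InZ[ α ] (1# - α * (α * α) * (α * (α * α)))
    A-1-α⁶ = A.sub (InZ-1 α) (InZ-* α A-α³ A-α³)
    U V : K
    U = θ ^ 3 * ε + ε
    V = θ ^ 3 * ε + cₙ 3 * s + Ξ + cₙ 2 * (M * (θ ^ 3 + ε)) + cₙ 3 * (M * M)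
    U∈ : Λ U
    U∈ = Λ-* (θ^∈ 3) ε∈ ⊞ ε∈
    V∈ : Λ V
    V∈ = Λ-* (θ^∈ 3) ε∈ ⊞ Λ-* (Λ-c 3) s∈ ⊞ Ξ∈ ⊞ Λ-* (Λ-c 2) (Λ-* M∈ (θ^∈ 3 ⊞ ε∈)) ⊞ Λ-* (Λ-c 3) (Λ-* M∈ M∈)
    E1 : E 1#
    E1 = ofα (InZ-1 α)
    EU : E U
    EU = modulo P≡ (ofα A-1-α⁶) V∈ (solve 1 (λ t → Û t := t :^ 0 :- α̂ t :* (α̂ t :* α̂ t) :* (α̂ t :* (α̂ t :* α̂ t)) :+ c 3 :* V̂ t) refl θ)
    EθΔ : E (θ * Δ)
    EθΔ = modulo P≡ (ofα (A.sub A-α³ A-α)) (Λ-neg M∈) (solve 1 (λ t → t :* Δ̂ t := α̂ t :* (α̂ t :* α̂ t) :- α̂ t :+ c 3 :* (:- M̂ t)) refl θ)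
    EΔ : E Δ
    EΔ = modulo P≡ (sub (ofα (InZ-* α A-1-α⁶ (A.sub A-α A-α³))) EθΔ)
      (Λ-neg (Λ-* (Λ-c 2) κ∈ ⊞ Λ-* κ∈ Δ∈) ⊞ Λ-* (θ^∈ 4 ⊞ θ∈) (s∈ ⊞ Λ-* s∈ κ∈) ⊞ Λ-* U∈ M∈ ⊞ Λ-neg (Λ-* V∈ (Λ-* θ∈ Δ∈)) ⊞ Λ-neg (Λ-* (Λ-c 3) (Λ-* V∈ M∈)))
      (solve 1 (λ t → Δ̂ t := (t :^ 0 :- α̂ t :* (α̂ t :* α̂ t) :* (α̂ t :* (α̂ t :* α̂ t))) :* (α̂ t :- α̂ t :* (α̂ t :* α̂ t)) :- t :* Δ̂ t
        :+ c 3 :* (:- (c 2 :* κ̂ t :+ κ̂ t :* Δ̂ t) :+ (t :^ 4 :+ t) :* (ŝ t :+ ŝ t :* κ̂ t) :+ Û t :* M̂ t :+ (:- (V̂ t :* (t :* Δ̂ t))) :+ (:- (c 3 :* (V̂ t :* M̂ t))))) refl θ)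
    EJ : ∀ {x} → J x → E x
    EJ (normal-form a b l l∈ e) = modulo refl (add (scale a EΔ) (scale b EθΔ)) l∈ e
    Eκ : E κ
    Eκ = modulo P≡ (sub (B⊆ (∈adjoinAll (InZ-module α) w 0F)) (EJ (J-ΔΛ (Λ-* (Λ-c 2) (Λ-* θ∈ M∈) ⊞ κ∈)))) (Λ-neg (Λ-* M∈ M∈))
      (solve 2 (λ t m → κ̂ t := t :^ 2 :* κ̂ t :+ c 2 :* (t :* Δ̂ t :* m) :+ c 3 :* (m :* m) :- Δ̂ t :* (c 2 :* (t :* m) :+ κ̂ t) :+ c 3 :* (:- (m :* m))) refl θ M)
    Eε : E ε
    Eε = add Eκ (subst E (*-comm Δ (1# + s)) (EJ (J-ΔΛ (Λ-1 ⊞ s∈))))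
    Eθ : E θ
    Eθ = subst E (solve 2 (λ t e → (t :+ e) :- e := t) refl θ ε) (sub (ofα A-α) Eε)
    Eθκ : E (θ * κ)
    Eθκ = subst E (solve 1 (λ t → Û t :- ε̂ t :- Δ̂ t :* (t :* ε̂ t :+ t :* (t :^ 0 :+ ŝ t)) := t :* κ̂ t) refl θ)
      (sub (sub EU Eε) (EJ (J-ΔΛ (Λ-* θ∈ ε∈ ⊞ Λ-* θ∈ (Λ-1 ⊞ s∈)))))

  open UpperBound α α∈ w (λ k → Λ⇒O w₀∈) Pw∈ generates-mod-p public using (finite-index; p^[1+v]∤; denominator-InZ)

-- Return to the definitions of the statement.

module Bounds (S : Setting) where
  open Setting S
  open Scalars powerBasis
  open Integrality S
  open Lattices S

  record Representatives (α : K) (n : ℕ) : Set where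
    field
      rep   : Fin n → K
      rep∈  : ∀ i → Integral (rep i)
      cover : ∀ {x} → Integral x → ∃ λ i → InZ[ α ] (x - rep i)
      uniq  : ∀ x {i k} → InZ[ α ] (x - rep i) → InZ[ α ] (x - rep k) → i ≡ k

  -- `upper` is doubly negated because integrality of α and of the representatives, and the
  -- representatives themselves, are obtained only in that form.
  record IndexBounds (p v : ℕ) : Set where
    field
      lower : ∀ {α n} → Integral α → Representatives α n → p ℕ.^ v ℕD.∣ n
      upper : ¬ ¬ ∃ λ α → Integral α × (∀ x → ∃ λ D → NonZero D × InZ[ α ] (jₙ D * x))
                × ∃ λ n → ¬ (p ℕ.^ suc v ℕD.∣ n) × Representatives α n

  bounds : ∀ p v → (∀ {α} → O α → ∀ {n} (rep : Fin n → K) → (∀ i → O (rep i)) → (∀ {x} → O x → ¬ ¬ ∃ λ i → InZ[ α ] (x - rep i)) →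
      (∀ x {i k} → InZ[ α ] (x - rep i) → InZ[ α ] (x - rep k) → i ≡ k) → p ℕ.^ v ℕD.∣ n) →
    ∀ {α N} → O α → (∀ x → ∃ λ D → NonZero D × InZ[ α ] (jₙ D * x)) →
    ¬ ¬ (∃ λ n → n ℕD.∣ N × HasIndex InZ[ α ] O n) → (∀ {n} → n ℕD.∣ N → ¬ (p ℕ.^ suc v ℕD.∣ n)) → IndexBounds p v
  bounds p v low {α} α∈ denominators finite valuation = record
    { lower = λ α∈ R → let open Representatives R in
        low (integral⇒O α∈) rep (integral⇒O ∘ rep∈) (λ x∈ h → O⇒¬¬integral x∈ (h ∘ cover)) uniq
    ; upper = λ h → finite λ { (n , n∣N , H) → O⇒¬¬integral α∈ λ i → ¬¬-Fin (λ k → O⇒¬¬integral (HasIndex.rep∈ H k)) λ rep∈ →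
        h (α , i , denominators , n , valuation n∣N , record
          { rep = HasIndex.rep H ; rep∈ = rep∈ ; cover = HasIndex.cover H ∘ integral⇒O ; uniq = HasIndex.uniq H }) } }

  trivial-representatives : ∀ {α} → (∀ {x} → Integral x → InZ[ α ] x) → Representatives α 1
  trivial-representatives {α} all = record
    { rep = λ _ → 0# ; rep∈ = λ _ → 0ℤ ∷ [] , trans (cong₂ _+_ (trans (cong j (ι≡ι₀ 0ℤ)) j-0) (zeroˡ _)) (+-identityˡ 0#)
    ; cover = λ x∈ → zero , IsZModule.sub (InZ-module α) (all x∈) (IsZModule.zero∈ (InZ-module α))
    ; uniq = λ { x {zero} {zero} _ _ → refl } }

module FieldIndex (m : ℕ) (a b c : ℤ) (τ : Fin 6 → ℤ)
  (τ-coeff : ∀ i → lookup (Field.θ⁶ m a b c) i ≡ ι (τ i)) where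

  open Field m a b c
  open FieldRing m a b c τ τ-coeff using (setting)
  private
    module S = Setting setting
    module I = Integrality setting
    module L = Lattices setting
    module Sc = Scalars S.powerBasis
  open Bounds setting

  abstract
    ev≡ : ∀ g x → I.ev g x ≡ evalZ g x
    ev≡ []      x = refl
    ev≡ (z ∷ g) x = cong₂ (λ q y → (q • 1K) +K (x *K y)) (ι≡ι₀ z) (ev≡ g x)

    toInZ : ∀ {α x} → InZ[ α ] x → L.InZ[ α ] x
    toInZ {α} (g , e) = g , trans (ev≡ g α) e

    fromInZ : ∀ {α x} → L.InZ[ α ] x → InZ[ α ] x
    fromInZ {α} (g , e) = g , trans (sym (ev≡ g α)) e

    toIntegral : ∀ {x} → InOK x → I.Integral x
    toIntegral {x} (g , e) = g , trans (ev≡ (g ∷ʳ 1ℤ) x) e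

    fromIntegral : ∀ {x} → I.Integral x → InOK x
    fromIntegral {x} (g , e) = g , trans (sym (ev≡ (g ∷ʳ 1ℤ) x)) e

    toRepresentatives : ∀ {α n} → Index α n → Representatives α n
    toRepresentatives (r , r∈ , cover , uniq) = record
      { rep = lookup r ; rep∈ = λ i → toIntegral (r∈ i)
      ; cover = λ {x} x∈ → proj₁ (cover x (fromIntegral x∈)) , toInZ (proj₂ (cover x (fromIntegral x∈)))
      ; uniq = λ x {i} {k} p q → uniq x i k (fromInZ p) (fromInZ q) }

    fromRepresentatives : ∀ {α n} → Representatives α n → Index α n
    fromRepresentatives {α} {n} R = tabulate rep , (λ i → subst InOK (sym (look i)) (fromIntegral (rep∈ i))) ,
        (λ x x∈ → proj₁ (cover (toIntegral x∈)) , subst (λ y → InZ[ α ] (x -K y)) (sym (look (proj₁ (cover (toIntegral x∈))))) (fromInZ (proj₂ (cover (toIntegral x∈))))) ,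
        (λ x i k p q → uniq x (toInZ (subst (λ y → InZ[ α ] (x -K y)) (look i) p)) (toInZ (subst (λ y → InZ[ α ] (x -K y)) (look k) q)))
      where
      open Representatives R
      look : ∀ i → lookup (tabulate rep) i ≡ rep i
      look = lookup∘tabulate rep

    -- An integer denominator suffices: the constant polynomial D serves as h.
    generates : ∀ {α} → (∀ x → ∃ λ D → NonZero D × L.InZ[ α ] (Sc.jₙ D S.* x)) → Generates α
    generates {α} h β = List.map ι₀ g , q ∷ [] , (λ e → contradiction (zero-denominator (trans (sym eval-h) e)) λ ()) ,
        trans (cong (β *K_) eval-h) (trans (Sc.*-comm β (Sc.jₙ D)) (sym (proj₂ (fromInZ (proj₂ (proj₂ (h β)))))))
      where
      D : ℕ
      D = proj₁ (h β)
      g : List ℤ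
      g = proj₁ (fromInZ (proj₂ (proj₂ (h β))))
      q : ℚ
      q = ιₙ D
      eval-h : evalK (q ∷ []) α ≡ Sc.jₙ D
      eval-h = trans (cong ((q • 1K) +K_) (Sc.zeroʳ α)) (Sc.+-identityʳ (Sc.jₙ D))
      zero-denominator : Sc.jₙ D ≡ 0K → 1ℚ ≡ 0ℚ
      zero-denominator e = cong (λ v → lookup v 0F) (Sc.jₙ-cancel D {{proj₁ (proj₂ (h β))}} {1K} {0K} (trans (cong (_*K 1K) e) (trans (Sc.zeroˡ 1K) (sym (Sc.zeroʳ (Sc.jₙ D))))))

  -- p^v divides every index, hence their greatest common divisor d; and d divides the index in
  -- `upper`, which p^(v+1) does not. The second claim is a negation, so the double negation of
  -- `upper` may be opened.
  valuation : ∀ {p v} → IndexBounds p v → ∀ d → IsFieldIndex d → Valuation p d v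
  valuation {p} {v} B d (d∣ , greatest) =
      greatest (p ℕ.^ v) (λ α n α∈ _ ind → IndexBounds.lower B (toIntegral α∈) (toRepresentatives ind)) ,
      λ h → IndexBounds.upper B λ { (α , α∈ , gen , n , p∤n , R) →
        p∤n (ℕD.∣-trans h (d∣ α n (fromIntegral α∈) (generates gen) (fromRepresentatives R))) }

  -- If ℤ[α] is all of O_K, the single representative 0 is complete, so p^v would divide 1.
  non-monogenic : ∀ {p v} → IndexBounds p v → ¬ (p ℕ.^ v ≡ 1) → ¬ Monogenic
  non-monogenic {p} {v} B p^v≢1 (α , α∈ , all) = p^v≢1 (ℕD.∣1⇒≡1 (IndexBounds.lower B (toIntegral α∈) (trivial-representatives λ x∈ → toInZ (all _ (fromIntegral x∈)))))

-- The coefficients of f, and the conclusion.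

module Coefficients (k : ℕ) (a b c : ℤ) (N : ℕ) (N∣a : Z.+ N ℤDU.∣ a) (N∣b : Z.+ N ℤDU.∣ b) (N∣c+1 : Z.+ N ℤDU.∣ (c Z.+ 1ℤ)) where

  private
    m : ℕ
    -- With m = k + 2 the test `0 ≡ᵇ m` computes to false, so a stays out of the constant
    -- coefficient.
    m = suc (suc k)

    quotient : ∀ x → Z.+ N ℤDU.∣ x → ∃ λ y → x ≡ (Z.+ N) Z.* y
    quotient x h with ℤD.∣ᵤ⇒∣ {Z.+ N} {x} h
    ... | divides y e = y , trans e (ℤP.*-comm y (Z.+ N))

    a′ b′ c′ : ℤ
    a′ = proj₁ (quotient a N∣a)
    b′ = proj₁ (quotient b N∣b)
    c′ = proj₁ (quotient (c Z.+ 1ℤ) N∣c+1)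

  -- The coordinates of θ⁶ are the negated coefficients of f; for the constant one, c + 1 = N c′
  -- gives -c = 1 - N c′.
  σ : Fin 6 → ℤ
  σ zero    = Z.- c′
  σ (suc i) = Z.- ((if toℕ (suc i) ≡ᵇ m then a′ else 0ℤ) Z.+ (if toℕ (suc i) ≡ᵇ 1 then b′ else 0ℤ))

  τ : Fin 6 → ℤ
  τ zero    = 1ℤ Z.+ (Z.+ N) Z.* σ zero
  τ (suc i) = (Z.+ N) Z.* σ (suc i)

  private
    switch : ∀ p {x y} → x ≡ (Z.+ N) Z.* y → (if p then ι₀ x else 0ℚ) ≡ ιₙ N ℚ.* ι (if p then y else 0ℤ)
    switch true  {x} {y} e = trans (sym (ι≡ι₀ x)) (trans (cong ι e) (ι-* (Z.+ N) y))
    switch false e = sym (trans (cong (ιₙ N ℚ.*_) (ι≡ι₀ 0ℤ)) (ℚP.*-zeroʳ (ιₙ N)))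

    coefficient : ∀ p q → ℚ.- (0ℚ ℚ.+ ((if p then ι₀ a else 0ℚ) ℚ.+ ((if q then ι₀ b else 0ℚ) ℚ.+ 0ℚ)))
      ≡ ι ((Z.+ N) Z.* (Z.- ((if p then a′ else 0ℤ) Z.+ (if q then b′ else 0ℤ))))
    coefficient p q = trans (cong₂ (λ x y → ℚ.- (0ℚ ℚ.+ (x ℚ.+ (y ℚ.+ 0ℚ)))) (switch p (proj₂ (quotient a N∣a))) (switch q (proj₂ (quotient b N∣b))))
      (trans (ℚR.solve 3 (λ n x y → ℚR.:- (ℚR.con 0ℚ ℚR.:+ (n ℚR.:* x ℚR.:+ (n ℚR.:* y ℚR.:+ ℚR.con 0ℚ))) ℚR.:= n ℚR.:* (ℚR.:- (x ℚR.:+ y))) refl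
          (ιₙ N) (ι (if p then a′ else 0ℤ)) (ι (if q then b′ else 0ℤ)))
        (sym (trans (ι-* (Z.+ N) _) (cong (ιₙ N ℚ.*_) (trans (ι-neg _) (cong ℚ.-_ (ι-+ (if p then a′ else 0ℤ) (if q then b′ else 0ℤ))))))))

    constant : ℚ.- (0ℚ ℚ.+ (0ℚ ℚ.+ (0ℚ ℚ.+ ι₀ c))) ≡ ι (1ℤ Z.+ (Z.+ N) Z.* (Z.- c′))
    constant = trans (cong (λ x → ℚ.- (0ℚ ℚ.+ (0ℚ ℚ.+ (0ℚ ℚ.+ x)))) (sym (ι≡ι₀ c)))
      (trans (ℚR.solve 1 (λ x → ℚR.:- (ℚR.con 0ℚ ℚR.:+ (ℚR.con 0ℚ ℚR.:+ (ℚR.con 0ℚ ℚR.:+ x))) ℚR.:= ℚR.:- x) refl (ι c))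
      (trans (sym (ι-neg c)) (cong ι (trans (ℤR.solve 1 (λ c → ℤR.:- c ℤR.:= ℤR.con 1ℤ ℤR.:- (c ℤR.:+ ℤR.con 1ℤ)) refl c)
        (trans (cong (λ x → 1ℤ Z.- x) (proj₂ (quotient (c Z.+ 1ℤ) N∣c+1))) (cong (λ x → 1ℤ Z.+ x) (ℤP.neg-distribʳ-* (Z.+ N) c′)))))))

  τ-coeff : ∀ i → lookup (Field.θ⁶ m a b c) i ≡ ι (τ i)
  τ-coeff 0F = constant
  τ-coeff 1F = coefficient (1 ≡ᵇ m) true
  τ-coeff 2F = coefficient (2 ≡ᵇ m) false
  τ-coeff 3F = coefficient (3 ≡ᵇ m) false
  τ-coeff 4F = coefficient (4 ≡ᵇ m) false
  τ-coeff 5F = coefficient (5 ≡ᵇ m) false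

index-bounds-2 : ∀ S (σ : Fin 6 → ℤ) → Setting.τ S zero ≡ 1ℤ Z.+ (Z.+ 8) Z.* σ zero → (∀ i → Setting.τ S (suc i) ≡ (Z.+ 8) Z.* σ (suc i)) → Bounds.IndexBounds S 2 2
index-bounds-2 S σ τ-zero τ-suc = Bounds.bounds S 2 2 (λ α∈ → p^v∣index α∈) (Λ⇒O α∈) denominator-InZ finite-index p^[1+v]∤
  where open AtTwo S σ τ-zero τ-suc

index-bounds-3 : ∀ S (σ : Fin 6 → ℤ) → Setting.τ S zero ≡ 1ℤ Z.+ (Z.+ 9) Z.* σ zero → (∀ i → Setting.τ S (suc i) ≡ (Z.+ 9) Z.* σ (suc i)) → Bounds.IndexBounds S 3 1
index-bounds-3 S σ τ-zero τ-suc = Bounds.bounds S 3 1 (λ α∈ → p^v∣index α∈) (Λ⇒O α∈) denominator-InZ finite-index p^[1+v]∤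
  where open AtThree S σ τ-zero τ-suc

open import Data.Nat using (_≤_)
open import Data.Integer using (_+_)
open import Data.Integer.Divisibility using (_∣_)

theorem1p1 : (m : ℕ) → 2 ≤ m → m ≤ 5 → (a b c : ℤ) →
    IrreducibleQ (fPoly m a b c) →
    ((ℤ.pos 8 ∣ a → ℤ.pos 8 ∣ b → ℤ.pos 8 ∣ (c + 1ℤ) →
    (∀ d → Field.IsFieldIndex m a b c d → Valuation 2 d 2) × ¬ Field.Monogenic m a b c) ×
    (ℤ.pos 9 ∣ a → ℤ.pos 9 ∣ b → ℤ.pos 9 ∣ (c + 1ℤ) →
    (∀ d → Field.IsFieldIndex m a b c d → Valuation 3 d 1) × ¬ Field.Monogenic m a b c))
theorem1p1 (suc (suc k)) (ℕ.s≤s (ℕ.s≤s _)) _ a b c _ = at-2 , at-3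
  where
  at-2 : ℤ.pos 8 ∣ a → ℤ.pos 8 ∣ b → ℤ.pos 8 ∣ (c + 1ℤ) →
    (∀ d → Field.IsFieldIndex (suc (suc k)) a b c d → Valuation 2 d 2) × ¬ Field.Monogenic (suc (suc k)) a b c
  at-2 8∣a 8∣b 8∣c+1 = valuation {2} {2} B , non-monogenic {2} {2} B λ ()
    where
    open Coefficients k a b c 8 8∣a 8∣b 8∣c+1
    open FieldIndex (suc (suc k)) a b c τ τ-coeff
    B : Bounds.IndexBounds (FieldRing.setting (suc (suc k)) a b c τ τ-coeff) 2 2
    B = index-bounds-2 (FieldRing.setting (suc (suc k)) a b c τ τ-coeff) σ refl (λ _ → refl)
  at-3 : ℤ.pos 9 ∣ a → ℤ.pos 9 ∣ b → ℤ.pos 9 ∣ (c + 1ℤ) →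
    (∀ d → Field.IsFieldIndex (suc (suc k)) a b c d → Valuation 3 d 1) × ¬ Field.Monogenic (suc (suc k)) a b c
  at-3 9∣a 9∣b 9∣c+1 = valuation {3} {1} B , non-monogenic {3} {1} B λ ()
    where
    open Coefficients k a b c 9 9∣a 9∣b 9∣c+1
    open FieldIndex (suc (suc k)) a b c τ τ-coeff
    B : Bounds.IndexBounds (FieldRing.setting (suc (suc k)) a b c τ τ-coeff) 3 1
    B = index-bounds-3 (FieldRing.setting (suc (suc k)) a b c τ τ-coeff) σ refl (λ _ → refl)
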